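{- Let $P$ be any finite poset and let $\lambda=(\lambda_1,\dots,\lambda_r)$ be a partition of $|P|$. Then the number $\psi^\lambda(\mathrm{inc}(P))$ is equal to each of the following: (1) the number of cyclically row-semistrict $P$-tableaux of shape $\lambda$; (2) the number of $P$-record-free, row-semistrict $P$-tableaux of shape $\lambda$; (3) the number of disjoint cyclic vertex covers of $\mathrm{ngr}(P)$ of type $\lambda$; (4) the number of acyclic orientations $(O_1,\dots,O_r)$ of sequences $(\mathrm{inc}(P_{I_1}),\dots,\mathrm{inc}(P_{I_r}))\in\mathcal I_\lambda(\mathrm{inc}(P))$ in which each oriented component $O_i$ has exactly one source.
   Context: Let $n=|P|$. Trace evaluations at graphs: for a graph $G$ on $n$ vertices and $\lambda=(\lambda_1,\dots,\lambda_\ell)\vdash n$, let $c(G,\lambda)$ be the number of proper colorings of $G$ by positive integers in which exactly $\lambda_i$ vertices have color $i$ for $i=1,\dots,\ell$. Let $\epsilon^\lambda$ be the character of $\mathfrak S_n$ induced from the sign character of the Young subgroup $\mathfrak S_\lambda$; the $\epsilon^\lambda$ form a basis of the space of class functions. For a class function $\theta=\sum_{\lambda\vdash n}a_\lambda\epsilon^\lambda$ define $\theta(G)=\sum_{\lambda\vdash n}a_\lambda c(G,\lambda)$. The power sum trace $\psi^\lambda$ is the class function with $\psi^\lambda(w)=z_\lambda$ if $w$ has cycle type $\lambda$ and $\psi^\lambda(w)=0$ otherwise, where $z_\lambda=\lambda_1\cdots\lambda_r\,\alpha_1!\cdots\alpha_n!$ and $\alpha_i$ is the number of parts of $\lambda$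 equal to $i$. (Equivalently, $\omega X_G=\sum_\lambda \frac{\psi^\lambda(G)}{z_\lambda}p_\lambda$, where $X_G=\sum_\lambda c(G,\lambda)m_\lambda$ is Stanley's chromatic symmetric function, $m_\lambda$ and $p_\lambda$ are the monomial and power sum symmetric functions, and $\omega$ is the involutive automorphism of the ring of symmetric functions sending each elementary symmetric function $e_k$ to the complete homogeneous symmetric function $h_k$.) The incomparability graph $\mathrm{inc}(P)$ has vertex set $P$ and an edge $\{i,j\}$ for each incomparable pair. $P_I$ denotes the subposet induced by $I\subseteq P$. The directed graph $\mathrm{ngr}(P)$ has vertex set $P$ and edge set $\{(i,j)\in P^2: i\not>_P j\}$, including all loops $(i,i)$. A $P$-tableau of shape $\lambda$ is a filling of a Young diagram of shape $\lambda$ (with $\lambda_i$ boxes in row $i$) with the elements of $P$, one per box, each used exactly once; $U_{i,j}$ is the $j$th entry of row $i$. It is row-semistrict if $U_{i,j}\not>_P U_{i,j+1}$ for all horizontally adjacent entries; cyclically row-semistrict if it is row-semistrict and $U_{i,\lambda_i}\not>_P U_{i,1}$ for all $i$; $P$-record-free if there is no position $(i,j)$ with $j\neq 1$ such that all of $U_{i,1},\dots,U_{i,j-1}$ are less than $U_{i,j}$ in $P$. For a directed graph $D$ on $n$ vertices, a disjoint cyclic vertex cover of $D$ of type $\lambda$ is a sequence $(H_1,\dots,H_r)$ of vertex-disjoint subdigraphs of $D$ with $H_j$ isomorphic to the (directed) cycle graph $C_{\lambda_j}$ on $\lambda_j$ vertices for each $j$ (a loop if $\lambda_j=1$, a pair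 of opposite edges if $\lambda_j=2$). An ordered set partition of an $n$-element set of type $\lambda$ is a sequence $(I_1,\dots,I_r)$ of pairwise disjoint subsets with union the whole set and $|I_i|=\lambda_i$. $\mathcal I_\lambda(G)$ is the set of sequences $(G_{I_1},\dots,G_{I_r})$ of induced subgraphs of $G$ over all ordered set partitions of its vertex set of type $\lambda$. An acyclic orientation of such a sequence is a sequence $(O_1,\dots,O_r)$ with $O_j$ an acyclic orientation of $G_{I_j}$ (one direction for each edge, no directed cycle). A source is a vertex with indegree $0$.
   Formalization: In (3) each cycle H_j is counted together with an isomorphism to C_{λ_j} (a starting vertex); counting bare subdigraphs is false: for the 2-element antichain and λ=(2) there is 1 cover but ψ^λ(inc(P))=2. The order of P is taken to be decidable, which is automatic classically. -}

module Defs where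

open import Level using (0ℓ)
open import Data.Bool.Base using (Bool; true; false; T; if_then_else_)
open import Data.Nat.Base as ℕ using (ℕ; zero; suc; NonZero; _≥_; _∸_; _<ᵇ_; _!)
import Data.Nat.Properties as ℕ
open import Data.Nat.GeneralisedArithmetic using (iterate)
open import Data.Nat.ListAction using (sum; product)
open import Data.Nat.ListAction.Properties using (product≢0)
open import Data.Integer.Base as ℤ using (ℤ; +_; 0ℤ; -1ℤ)
open import Data.Rational.Base as ℚ using (ℚ; 0ℚ)
open import Data.Fin.Base using (Fin; toℕ) renaming (zero to fzero; _<_ to _<ᶠ_)
import Data.Fin.Properties as Fin
open import Data.Fin.Permutation
  using (Permutation′; _⟨$⟩ʳ_; _∘ₚ_; flip; insert) renaming (id to idₚ)
open import Data.List.Base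
  using (List; []; _∷_; length; lookup; map; foldr; filter; concatMap;
         cartesianProduct; allFin; upTo)
open import Data.List.Relation.Unary.All as All using (All)
open import Data.List.Relation.Unary.All.Properties using (map⁺)
open import Data.List.Relation.Unary.Linked using (Linked)
open import Data.Product.Base
  using (Σ; Σ-syntax; ∃; ∃-syntax; _×_; _,_; proj₁; proj₂)
open import Data.Sum.Base using (_⊎_)
open import Function.Base using (_∘_; _on_)
open import Function.Bundles using (Inverse; _↔_; _⇔_)
open import Function.Definitions using (Bijective)
open import Relation.Binary.Bundles using (Setoid)
open import Relation.Binary.Core using (Rel)
open import Relation.Binary.Structures using (IsDecPartialOrder)
import Relation.Binary.Construct.NonStrictToStrict as NonStrictToStrict
import Relation.Binary.Construct.On as On
open import Relation.Binary.Construct.Closure.Transitive using (TransClosure)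
open import Relation.Binary.PropositionalEquality
  using (_≡_; _≢_; refl; sym; trans; subst; setoid; _→-setoid_)
open import Relation.Nullary.Decidable using (Dec; does; _×-dec_; _→-dec_)
open import Relation.Nullary.Negation using (¬_)
open import Relation.Unary using (Pred; Decidable)

------------------------------------------------------------------------
-- Cardinality

-- Sets of functions and of structured objects are setoids here, so "the
-- number of X is N" is a bijection of setoids with Fin N.
HasSize : Setoid 0ℓ 0ℓ → ℕ → Set
HasSize S N = Inverse (setoid (Fin N)) S

_such-that_ : (S : Setoid 0ℓ 0ℓ) → (Setoid.Carrier S → Set) → Setoid 0ℓ 0ℓ
S such-that P = On.setoid {B = Σ (Setoid.Carrier S) P} S proj₁

_∈_ : {V : Set} → V → (V → Bool) → Set
v ∈ I = T (I v)

------------------------------------------------------------------------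
-- Integer partitions

record Partition (n : ℕ) : Set where
  field
    parts      : List ℕ
    positive   : All NonZero parts
    decreasing : Linked _≥_ parts
    total      : sum parts ≡ n

  len : ℕ
  len = length parts

  part : Fin len → ℕ
  part = lookup parts

open Partition public

multiplicity : ℕ → List ℕ → ℕ
multiplicity k xs = length (filter (k ℕ.≟_) xs)

z : ∀ {n} → Partition n → ℕ
z {n} lam =
  product (parts lam) ℕ.*
  product (map (λ k → multiplicity (suc k) (parts lam) !) (upTo n))

------------------------------------------------------------------------
-- The symmetric group and its class functions.  The characters used here
-- are rational valued, so ℚ serves as the field of scalars.

allPermutations : ∀ n → List (Permutation′ n)
allPermutations zero    = idₚ ∷ []
allPermutations (suc n) =
  concatMap (λ i → map (insert fzero i) (allPermutations n)) (allFin (suc n))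

inversions : ∀ {n} → Permutation′ n → ℕ
inversions {n} w =
  length (filter (λ p → (proj₁ p Fin.<? proj₂ p)
                        ×-dec ((w ⟨$⟩ʳ proj₂ p) Fin.<? (w ⟨$⟩ʳ proj₁ p)))
                 (cartesianProduct (allFin n) (allFin n)))

sign : ∀ {n} → Permutation′ n → ℤ
sign w = -1ℤ ℤ.^ inversions w

-- The index of the segment containing position i, when ℕ is cut from the left
-- into consecutive segments of the given lengths.
segment : List ℕ → ℕ → ℕ
segment []       i = 0
segment (m ∷ ms) i = if i <ᵇ m then 0 else suc (segment ms (i ∸ m))

InYoung : ∀ {n} → Partition n → Permutation′ n → Set
InYoung {n} mu w =
  (i : Fin n) → segment (parts mu) (toℕ (w ⟨$⟩ʳ i)) ≡ segment (parts mu) (toℕ i)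

inYoung? : ∀ {n} (mu : Partition n) → Decidable (InYoung mu)
inYoung? mu w = Fin.all? (λ i → _ ℕ.≟ _)

youngOrder : ∀ {n} → Partition n → ℕ
youngOrder mu = product (map _! (parts mu))

youngOrder≢0 : ∀ {n} (mu : Partition n) → NonZero (youngOrder mu)
youngOrder≢0 mu = product≢0 (map⁺ (All.universal ℕ._!≢0 (parts mu)))

-- Frobenius' formula  (χ↑G)(w) = |H|⁻¹ Σ_{g ∈ G} χ°(g⁻¹ w g),  where χ° extends
-- χ by zero, for the sign character of the Young subgroup H.
ε : ∀ {n} → Partition n → Permutation′ n → ℚ
ε {n} mu w =
  foldr ℤ._+_ 0ℤ (map (λ g → sign° (g ∘ₚ w ∘ₚ flip g)) (allPermutations n))
  ℚ./ youngOrder mu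
  where
  instance _ = youngOrder≢0 mu

  sign° : Permutation′ n → ℤ
  sign° v = if does (inYoung? mu v) then sign v else 0ℤ

SameCycle : ∀ {n} → Permutation′ n → Fin n → Fin n → Set
SameCycle {n} w i j = ∃[ k ] iterate (w ⟨$⟩ʳ_) i (toℕ {n} k) ≡ j

sameCycle? : ∀ {n} (w : Permutation′ n) i j → Dec (SameCycle w i j)
sameCycle? w i j = Fin.any? (λ k → _ Fin.≟ j)

-- One entry per cycle, contributed by the least element of that cycle.
cycleLengths : ∀ {n} → Permutation′ n → List ℕ
cycleLengths {n} w =
  map (λ i → length (filter (sameCycle? w i) (allFin n)))
      (filter (λ i → Fin.all? (λ j → sameCycle? w i j →-dec (i Fin.≤? j))) (allFin n))

HasCycleType : ∀ {n} → Partition n → Permutation′ n → Set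
HasCycleType {n} lam w =
  (k : Fin (suc n)) →
  multiplicity (toℕ k) (cycleLengths w) ≡ multiplicity (toℕ k) (parts lam)

hasCycleType? : ∀ {n} (lam : Partition n) → Decidable (HasCycleType lam)
hasCycleType? lam w = Fin.all? (λ k → _ ℕ.≟ _)

ψ : ∀ {n} → Partition n → Permutation′ n → ℚ
ψ lam w = if does (hasCycleType? lam w) then (+ z lam) ℚ./ 1 else 0ℚ

------------------------------------------------------------------------
-- Graphs and trace evaluations

record Graph (V : Set) : Set₁ where
  field
    Adj    : Rel V 0ℓ
    symm   : ∀ {u v} → Adj u v → Adj v u
    irrefl : ∀ {v} → ¬ Adj v v

open Graph public

induced : {V : Set} → Graph V → (I : V → Bool) → Graph (Σ[ v ∈ V ] v ∈ I)
induced G I = record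
  { Adj    = Adj G on proj₁
  ; symm   = symm G
  ; irrefl = irrefl G
  }

-- The prescribed colour multiplicities add up to n = |V|, so the positive
-- integers 1, …, ℓ, represented by Fin ℓ, are the only colours that can occur.
ProperColourings : ∀ {n} {V : Set} → Graph V → Partition n → Setoid 0ℓ 0ℓ
ProperColourings {V = V} G mu =
  (V →-setoid Fin (len mu)) such-that λ κ →
    (∀ {u v} → Adj G u v → κ u ≢ κ v) ×
    (∀ i → HasSize (setoid V such-that λ v → κ v ≡ i) (part mu i))

-- A formal linear combination of partitions; coefficients of a partition
-- occurring repeatedly add up.
LinComb : ℕ → Set
LinComb n = List (ℚ × Partition n)

linear : ∀ {n} → (Partition n → ℚ) → LinComb n → ℚ
linear f = foldr (λ (a , mu) s → a ℚ.* f mu ℚ.+ s) 0ℚ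

_IsExpansionOf_ : ∀ {n} → LinComb n → (Permutation′ n → ℚ) → Set
a IsExpansionOf θ = ∀ w → θ w ≡ linear (λ mu → ε mu w) a

-- θ(G) = q.  That the value is well defined, i.e. that θ has an expansion in
-- the ε's and that any expansion gives the same value, is part of the claim.
record _⟦_⟧≔_ {n} {V : Set} (θ : Permutation′ n → ℚ) (G : Graph V) (q : ℚ) : Set where
  field
    c          : Partition n → ℕ
    c-counts   : ∀ mu → HasSize (ProperColourings G mu) (c mu)
    expansion  : ∃[ a ] a IsExpansionOf θ
    evaluation : ∀ a → a IsExpansionOf θ → linear (λ mu → (+ c mu) ℚ./ 1) a ≡ q

------------------------------------------------------------------------
-- Directed graphs and cyclic vertex covers

record Digraph (V : Set) : Set₁ where
  field
    Arc : Rel V 0ℓ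

open Digraph public

record DigraphIso {V W : Set} (D : Digraph V) (E : Digraph W) : Set where
  field
    bijection : V ↔ W
  open Inverse bijection public using (to)
  field
    preserves : ∀ u v → Arc D u v ⇔ Arc E (to u) (to v)

cycleGraph : (k : ℕ) → Digraph (Fin k)
cycleGraph k .Arc i j =
  (toℕ j ≡ suc (toℕ i)) ⊎ (suc (toℕ i) ≡ k × toℕ j ≡ 0)

record Subdigraph {V : Set} (D : Digraph V) : Set where
  field
    vertices : V → Bool
    arcs     : V → V → Bool
    arcs⊆    : ∀ {u v} → T (arcs u v) → Arc D u v
    ends     : ∀ {u v} → T (arcs u v) → u ∈ vertices × v ∈ vertices

  asDigraph : Digraph (Σ[ v ∈ V ] v ∈ vertices)
  asDigraph .Arc (u , _) (v , _) = T (arcs u v)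

open Subdigraph public

-- The isomorphisms with the cycle graphs are part of the data, so each H_j
-- carries a starting vertex and contributes λ_j covers.  If only the bare
-- subdigraphs were counted, the total would be ψ^λ divided by λ₁ ⋯ λ_r: for the
-- two-element antichain and λ = (2) it would be 1, while ψ^λ(inc P) = 2.
record CyclicCover {n} {V : Set} (D : Digraph V) (lam : Partition n) : Set where
  field
    H        : Fin (len lam) → Subdigraph D
    disjoint : ∀ {i j v} → i ≢ j → v ∈ vertices (H i) → ¬ v ∈ vertices (H j)
    iso      : ∀ j → DigraphIso (cycleGraph (part lam j)) (asDigraph (H j))

  cycleVertex : (j : Fin (len lam)) → Fin (part lam j) → V
  cycleVertex j k = proj₁ (DigraphIso.to (iso j) k)

open CyclicCover public

CyclicCovers : ∀ {n} {V : Set} → Digraph V → Partition n → Setoid 0ℓ 0ℓ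
CyclicCovers D lam = record
  { Carrier = CyclicCover D lam
  ; _≈_     = λ X Y →
      (∀ j v → vertices (H X j) v ≡ vertices (H Y j) v) ×
      (∀ j u v → arcs (H X j) u v ≡ arcs (H Y j) u v) ×
      (∀ j k → cycleVertex X j k ≡ cycleVertex Y j k)
  ; isEquivalence = record
      { refl  = (λ _ _ → refl) , (λ _ _ _ → refl) , (λ _ _ → refl)
      ; sym   = λ (p , q , r) →
          (λ j v → sym (p j v)) , (λ j u v → sym (q j u v)) , (λ j k → sym (r j k))
      ; trans = λ (p , q , r) (p′ , q′ , r′) →
          (λ j v → trans (p j v) (p′ j v)) ,
          (λ j u v → trans (q j u v) (q′ j u v)) ,
          (λ j k → trans (r j k) (r′ j k))
      }
  }

------------------------------------------------------------------------
-- Acyclic orientations of sequences of induced subgraphs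

record OrderedSetPartition {n} (V : Set) (lam : Partition n) : Set where
  field
    block    : Fin (len lam) → V → Bool
    disjoint : ∀ {i j v} → i ≢ j → v ∈ block i → ¬ v ∈ block j
    covering : ∀ v → ∃[ i ] v ∈ block i
    sizes    : ∀ i → HasSize (setoid V such-that (_∈ block i)) (part lam i)

record Orientation {W : Set} (G : Graph W) : Set where
  field
    arc    : W → W → Bool
    sound  : ∀ {u v} → T (arc u v) → Adj G u v
    orient : ∀ {u v} → Adj G u v → T (arc u v) ⊎ T (arc v u)
    oneWay : ∀ {u v} → T (arc u v) → ¬ T (arc v u)

  Acyclic : Set
  Acyclic = ∀ v → ¬ TransClosure (λ x y → T (arc x y)) v v

  Source : W → Set
  Source v = ∀ u → ¬ T (arc u v)

  HasOneSource : Set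
  HasOneSource = ∃[ v ] Source v × (∀ u → Source u → u ≡ v)

record OrientedSequence {n} {V : Set} (G : Graph V) (lam : Partition n) : Set where
  field
    blocks : OrderedSetPartition V lam
  open OrderedSetPartition blocks public using (block)
  field
    O : ∀ j → Orientation (induced G (block j))

open OrientedSequence public

OrientedSequences : ∀ {n} {V : Set} → Graph V → Partition n → Setoid 0ℓ 0ℓ
OrientedSequences G lam = record
  { Carrier = OrientedSequence G lam
  ; _≈_     = λ X Y →
      (∀ j v → block X j v ≡ block Y j v) ×
      (∀ j u v (p : u ∈ block X j) (q : v ∈ block X j)
               (p′ : u ∈ block Y j) (q′ : v ∈ block Y j) →
         Orientation.arc (O X j) (u , p) (v , q) ≡
         Orientation.arc (O Y j) (u , p′) (v , q′))
  ; isEquivalence = record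
      { refl  = λ {X} → (λ _ _ → refl) , λ j u v p q p′ q′ → same X j p p′ q q′
      ; sym   = λ (b , a) →
          (λ j v → sym (b j v)) , λ j u v p q p′ q′ → sym (a j u v p′ q′ p q)
      ; trans = λ (b , a) (b′ , a′) →
          (λ j v → trans (b j v) (b′ j v)) ,
          λ j u v p q p″ q″ →
            let p′ = subst T (b j u) p ; q′ = subst T (b j v) q in
            trans (a j u v p q p′ q′) (a′ j u v p′ q′ p″ q″)
      }
  }
  where
  T-unique : ∀ {x} (p q : T x) → p ≡ q
  T-unique {true} _ _ = refl

  same : ∀ (X : OrientedSequence G lam) j {u v}
         (p p′ : u ∈ block X j) (q q′ : v ∈ block X j) →
         Orientation.arc (O X j) (u , p) (v , q) ≡
         Orientation.arc (O X j) (u , p′) (v , q′)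
  same X j p p′ q q′ with refl ← T-unique p p′ | refl ← T-unique q q′ = refl

------------------------------------------------------------------------
-- Posets and tableaux

-- Decidability of the order is automatic classically; constructively, the
-- counts below need not exist without it.
record FinitePoset (n : ℕ) : Set₁ where
  field
    Carrier           : Set
    _≤_               : Rel Carrier 0ℓ
    isDecPartialOrder : IsDecPartialOrder _≡_ _≤_
    size              : HasSize (setoid Carrier) n

  open IsDecPartialOrder isDecPartialOrder public using () renaming (refl to ≤-refl)
  open NonStrictToStrict {A = Carrier} _≡_ _≤_ public using (_<_)

inc : ∀ {n} (P : FinitePoset n) → Graph (FinitePoset.Carrier P)
inc P = record
  { Adj    = λ i j → ¬ (i ≤ j) × ¬ (j ≤ i)
  ; symm   = λ (p , q) → q , p
  ; irrefl = λ (p , _) → p ≤-refl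
  }
  where open FinitePoset P

ngr : ∀ {n} (P : FinitePoset n) → Digraph (FinitePoset.Carrier P)
ngr P .Arc i j = ¬ (j < i)
  where open FinitePoset P

module _ {n} (P : FinitePoset n) (lam : Partition n) where

  open FinitePoset P

  Box : Set
  Box = Σ[ i ∈ Fin (len lam) ] Fin (part lam i)

  Tableaux : Setoid 0ℓ 0ℓ
  Tableaux = (Box →-setoid Carrier) such-that Bijective _≡_ _≡_

  Tableau : Set
  Tableau = Setoid.Carrier Tableaux

  entry : Tableau → (i : Fin (len lam)) → Fin (part lam i) → Carrier
  entry U i j = proj₁ U (i , j)

  RowSemistrict : Tableau → Set
  RowSemistrict U = ∀ i j j′ → toℕ j′ ≡ suc (toℕ j) → ¬ (entry U i j′ < entry U i j)

  CyclicallyRowSemistrict : Tableau → Set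
  CyclicallyRowSemistrict U =
    RowSemistrict U ×
    (∀ i first last → toℕ first ≡ 0 → suc (toℕ last) ≡ part lam i →
       ¬ (entry U i first < entry U i last))

  RecordFree : Tableau → Set
  RecordFree U =
    ¬ (∃[ i ] ∃[ j ] toℕ j ≢ 0 × (∀ k → k <ᶠ j → entry U i k < entry U i j))

{-# OPTIONS --safe #-}

-- Number P by e : Fin n → P and call w ∈ 𝔖ₙ drop-free if no e(w i) lies below e(i).  The functional
-- L(θ) = Σ_w θ(w) [w drop-free] satisfies L(ε^μ) = c(inc P, μ): by Frobenius' formula it is an average, over all
-- arrangements of P into segments of lengths μ, of signed sums of drop-free permutations preserving the segments,
-- and such a sum is 1 if every segment is a chain and 0 otherwise, because a segment that is not a chain contains
-- two elements with the same lower set.  So L(θ) is the only possible value of θ(inc P).  That ψ^λ has an expansion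
-- follows by elimination, since ε^μ(w) ≠ 0 forces the cycles of w to refine μ up to conjugation.  As z_λ counts the
-- ways to identify the rows of the diagram with the cycles of a permutation of type λ, L(ψ^λ) counts the cyclically
-- row-semistrict tableaux, which are the same thing as cyclic covers.
--
-- For (2), fix the first entry v of a row and consider pairs of a k-element chain above v and a semistrict word v a
-- on the remaining letters.  Moving the last letter of the word to the top of the chain, and moving the first record
-- to the bottom of the chain, give two systems of bijections between a part of level k and the complement of the
-- corresponding part of level k + 1; downward induction on k makes the two parts, hence their complements at k = 0,
-- equinumerous, and these complements are the cyclic and the record-free words.
--
-- For (4), semistrict words are the normal forms of acyclic orientations of inc(P): orient each edge by the order
-- of its ends in the word; the inverse repeatedly removes the P-least source.  Sources other than the first letter
-- are exactly the records.

module Submission where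

open import Defs
open import Level using (0ℓ)
open import Data.Bool.Base using (Bool; true; false; T; if_then_else_)
open import Data.Nat.Base as ℕ using (ℕ; zero; suc; NonZero; _∸_; _!; z≤n; s≤s)
import Data.Nat.Properties as ℕ
open import Data.Integer.Base as ℤ using (ℤ; +_; 0ℤ; -1ℤ; 1ℤ)
import Data.Integer.Properties as ℤ
open import Data.Rational.Base as ℚ using (ℚ; 0ℚ; 1ℚ; _/_)
import Data.Rational.Properties as ℚ
open import Data.Fin.Base as Fin using (Fin; toℕ; fromℕ<) renaming (zero to fzero; suc to fsuc)
import Data.Fin.Properties as Fin
open import Data.Fin.Permutation using (Permutation′; _⟨$⟩ʳ_; _⟨$⟩ˡ_; _∘ₚ_; flip; insert; remove; insert-remove; insert-punchIn; transpose; permutation) renaming (id to idₚ; inverseˡ to inverseˡₚ; inverseʳ to inverseʳₚ)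
import Data.Fin.Permutation as Perm
open import Data.List.Base using (List; []; _∷_; _++_; [_]; _∷ʳ_; length; lookup; map; foldr; filter; concatMap; cartesianProduct; allFin; upTo; applyUpTo; tabulate)
import Data.List.Properties as List
open import Data.Product.Base using (Σ; Σ-syntax; ∃; ∃-syntax; _×_; _,_; proj₁; proj₂)
open import Data.Product.Relation.Binary.Pointwise.NonDependent using (_×ₛ_)
open import Data.Sum.Base using (_⊎_; inj₁; inj₂; [_,_]′)
open import Data.Empty using (⊥; ⊥-elim)
open import Data.Unit.Base using (⊤; tt)
open import Function.Base using (_∘_; id; case_of_)
open import Function.Bundles using (Inverse; mk⇔; Equivalence)
open import Function.Definitions using (Bijective; Injective)
import Function.Properties.Inverse as Inv
open import Relation.Binary.Bundles using (Setoid)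
open import Relation.Binary.Core using (Rel)
open import Relation.Binary.PropositionalEquality using (_≡_; _≢_; refl; sym; trans; cong; cong₂; subst; setoid; _→-setoid_; module ≡-Reasoning)
open import Relation.Nullary.Decidable using (Dec; does-⇔; _⊎-dec_; T?; yes; no; does; _×-dec_; _→-dec_; ¬?; map′; dec-true; dec-false)
open import Relation.Nullary.Negation using (¬_; contradiction)
import Algebra.Properties.CommutativeMonoid.Sum as Sum
open import Algebra.Bundles using (CommutativeMonoid)
open import Relation.Binary.Definitions using (tri<; tri≈; tri>)
open import Relation.Binary.Structures using (IsStrictPartialOrder; IsDecPartialOrder)
import Relation.Binary.PropositionalEquality as Eq
open import Induction.WellFounded using (WellFounded; Acc; acc; module Subrelation)
open import Data.Fin.Induction as FinInd using (spo-wellFounded; spo-noetherian)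
import Data.Nat.ListAction
import Data.Rational.Unnormalised.Base as ℚᵘ
import Data.Rational.Unnormalised.Properties as ℚᵘ
open import Data.List.Relation.Unary.Unique.Propositional using (Unique)
open import Data.List.Relation.Unary.AllPairs as AllPairs using ([]; _∷_)
import Data.List.Relation.Unary.Unique.Propositional.Properties as Unique
open import Data.List.Membership.Propositional using () renaming (_∈_ to _∈ₗ_; _∉_ to _∉ₗ_)
open import Data.List.Membership.Propositional.Properties using (∈-lookup; ∈-filter⁺; ∈-filter⁻; ∈-allFin; ∈-insert; ∈-tabulate⁻; ∈-map⁺; ∈-++⁻)
open import Data.List.Relation.Unary.Any as Any using (Any; here; there)
open import Data.List.Relation.Unary.Any.Properties as AnyP using (lookup-index)
open import Data.List.Relation.Unary.All as All using (All; []; _∷_)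
import Data.List.Relation.Unary.All.Properties as AllP
open import Data.Nat.GeneralisedArithmetic using (iterate)
open import Data.List.Relation.Binary.Permutation.Propositional using (↭-sym)
import Data.List.Relation.Binary.Permutation.Propositional.Properties as ↭P
open import Data.Nat.ListAction.Properties using (sum-↭; product≢0)
import Relation.Binary.Construct.Flip.EqAndOrd as Flip
open import Data.List.Sort (Flip.decTotalOrder ℕ.≤-decTotalOrder) using (sort; sort-↭; sort-↗)
open import Data.Vec.Base as Vec using (Vec)
import Data.Vec.Properties as VecP
import Data.Product.Properties as ×P
open import Relation.Binary.Construct.Closure.Transitive using (TransClosure) renaming ([_] to [_]⁺; _∷_ to _∷⁺_; _++_ to _++⁺_)

-- Finite setoids

-- A count is a bijection with `Fin N`, so equal counts compose as bijections, but subtraction has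
-- to pass through numbers: `complement-≅` compares sizes, and the bijection between cyclic and
-- record-free words comes from enumerations rather than from a rule. To be applied row by row it
-- must keep the letters of a row; hence the pair argument is run for a fixed first letter and a
-- fixed multiset of the remaining ones. In Frobenius' formula the denominator ∏ μ_i! cancels
-- because each proper colouring arises from exactly that many arrangements of P. A drop-free
-- permutation of a chain is the identity, hence the value 1; elements with the same lower set can
-- have their images exchanged, hence the value 0. The elimination needs a measure: the number of
-- pairs lying in a common cycle. It is a conjugacy invariant, and on the Young subgroup of type μ
-- it is maximal precisely when the cycles are the segments, which singles out one conjugacy class.

∣_∣ₛ : Setoid 0ℓ 0ℓ → Set
∣ S ∣ₛ = Setoid.Carrier S

infix 4 _≅_
_≅_ : Setoid 0ℓ 0ℓ → Setoid 0ℓ 0ℓ → Set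
S ≅ T = Inverse S T

≅-refl : ∀ {S} → S ≅ S
≅-refl = Inv.refl _

≅-sym : ∀ {S T} → S ≅ T → T ≅ S
≅-sym = Inv.sym

≅-trans : ∀ {S T U} → S ≅ T → T ≅ U → S ≅ U
≅-trans = Inv.trans

-- The other round trip follows by applying injectivity to the section equation, so each use has to
-- check only one inverse law.
injection+section : ∀ {S T : Setoid 0ℓ 0ℓ} (f : ∣ S ∣ₛ → ∣ T ∣ₛ) (g : ∣ T ∣ₛ → ∣ S ∣ₛ) →
  (∀ {x y} → Setoid._≈_ S x y → Setoid._≈_ T (f x) (f y)) →
  (∀ {x y} → Setoid._≈_ T (f x) (f y) → Setoid._≈_ S x y) →
  (∀ y → Setoid._≈_ T (f (g y)) y) →
  S ≅ T
injection+section {S} {T} f g cg inj sec = record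
  { to = f
  ; from = g
  ; to-cong = cg
  ; from-cong = λ {x} {y} x≈y → inj (T.trans (sec x) (T.trans x≈y (T.sym (sec y))))
  ; inverse = (λ {x} p → T.trans (cg p) (sec x))
            , (λ {x} {y} p → inj (T.trans (sec y) p))
  }
  where module S = Setoid S ; module T = Setoid T

such-that-≅ : ∀ {S T : Setoid 0ℓ 0ℓ} {P : ∣ S ∣ₛ → Set} {Q : ∣ T ∣ₛ → Set} (φ : S ≅ T) →
  (∀ x → P x → Q (Inverse.to φ x)) → (∀ y → Q y → P (Inverse.from φ y)) →
  (S such-that P) ≅ (T such-that Q)
such-that-≅ φ f g = record
  { to = λ (x , p) → to x , f x p
  ; from = λ (y , q) → from y , g y q
  ; to-cong = to-cong
  ; from-cong = from-cong
  ; inverse = inverseˡ , inverseʳ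
  }
  where open Inverse φ

such-that-⇔ : ∀ {S : Setoid 0ℓ 0ℓ} {P Q : ∣ S ∣ₛ → Set} →
  (∀ x → P x → Q x) → (∀ x → Q x → P x) → (S such-that P) ≅ (S such-that Q)
such-that-⇔ = such-that-≅ ≅-refl

such-that-× : ∀ {S : Setoid 0ℓ 0ℓ} {P : ∣ S ∣ₛ → Set} {Q : ∣ S ∣ₛ → Set} →
  ((S such-that P) such-that (Q ∘ proj₁)) ≅ (S such-that λ x → P x × Q x)
such-that-× {S} = record
  { to = λ ((x , p) , q) → x , p , q
  ; from = λ (x , p , q) → (x , p) , q
  ; to-cong = λ p → p
  ; from-cong = λ p → p
  ; inverse = (λ p → p) , (λ p → p)
  }

size-≅ : ∀ {S T N} → S ≅ T → HasSize S N → HasSize T N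
size-≅ φ h = ≅-trans h φ

size-unique : ∀ {S M N} → HasSize S M → HasSize S N → M ≡ N
size-unique h k = Perm.↔⇒≡ (≅-trans h (≅-sym k))

≡-size : ∀ {S M N} → M ≡ N → HasSize S M → HasSize S N
≡-size refl h = h

size-empty : ∀ {S} → (∣ S ∣ₛ → ⊥) → HasSize S 0
size-empty f = record
  { to = λ ()
  ; from = λ x → ⊥-elim (f x)
  ; to-cong = λ { {()} }
  ; from-cong = λ {x} → ⊥-elim (f x)
  ; inverse = (λ {x} → ⊥-elim (f x)) , λ { {()} }
  }

size-one : ∀ {S} (x : ∣ S ∣ₛ) → (∀ y → Setoid._≈_ S x y) → HasSize S 1
size-one {S} x u = record
  { to = λ _ → x
  ; from = λ _ → fzero
  ; to-cong = λ _ → Setoid.refl S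
  ; from-cong = λ _ → refl
  ; inverse = (λ {y} _ → u y) , λ { {fzero} _ → refl }
  }

module ℕ∑ = Sum ℕ.+-0-commutativeMonoid
module ℕ∏ = Sum ℕ.*-1-commutativeMonoid

∑ᴺ : ∀ {n} → (Fin n → ℕ) → ℕ
∑ᴺ = ℕ∑.sum

∏ᴺ : ∀ {n} → (Fin n → ℕ) → ℕ
∏ᴺ = ℕ∏.sum

join-Σ : ∀ {m} {k : Fin m → ℕ} → (Σ[ i ∈ Fin m ] Fin (k i)) → Fin (∑ᴺ k)
join-Σ {suc m} {k} (fzero , j) = j Fin.↑ˡ _
join-Σ {suc m} {k} (fsuc i , j) = k fzero Fin.↑ʳ join-Σ {m} {k ∘ fsuc} (i , j)

split-Σ : ∀ {m} {k : Fin m → ℕ} → Fin (∑ᴺ k) → Σ[ i ∈ Fin m ] Fin (k i)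
split-Σ {suc m} {k} x with Fin.splitAt (k fzero) x
... | inj₁ j = fzero , j
... | inj₂ y = let (i , j) = split-Σ {m} {k ∘ fsuc} y in fsuc i , j

join-split : ∀ {m} {k : Fin m → ℕ} x → join-Σ {m} {k} (split-Σ x) ≡ x
join-split {suc m} {k} x with Fin.splitAt (k fzero) x in eq
... | inj₁ j = Fin.splitAt⁻¹-↑ˡ eq
... | inj₂ y = trans (cong (k fzero Fin.↑ʳ_) (join-split {m} {k ∘ fsuc} y)) (Fin.splitAt⁻¹-↑ʳ eq)

split-join : ∀ {m} {k : Fin m → ℕ} x → split-Σ {m} {k} (join-Σ {m} {k} x) ≡ x
split-join {suc m} {k} (fzero , j) rewrite Fin.splitAt-↑ˡ (k fzero) j (∑ᴺ (k ∘ fsuc)) = refl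
split-join {suc m} {k} (fsuc i , j)
  rewrite Fin.splitAt-↑ʳ (k fzero) (∑ᴺ (k ∘ fsuc)) (join-Σ {m} {k ∘ fsuc} (i , j))
        | split-join {m} {k ∘ fsuc} (i , j) = refl

size-Σ : ∀ {m} (k : Fin m → ℕ) → HasSize (setoid (Σ[ i ∈ Fin m ] Fin (k i))) (∑ᴺ k)
size-Σ k = record
  { to = split-Σ {k = k}
  ; from = join-Σ {k = k}
  ; to-cong = cong (split-Σ {k = k})
  ; from-cong = cong (join-Σ {k = k})
  ; inverse = (λ { {x} refl → split-join {k = k} x }) , (λ { {x} refl → join-split {k = k} x })
  }

-- An element is coded by the number of its image together with its number inside that fibre. The
-- second component lives in a type indexed by the first, so `lem` and `lem′` generalise over the
-- code before the equation between codes is matched.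
size-fibres : ∀ {S T : Setoid 0ℓ 0ℓ} {M} (π : ∣ T ∣ₛ → ∣ S ∣ₛ) →
  (∀ {x y} → Setoid._≈_ T x y → Setoid._≈_ S (π x) (π y)) →
  (h : HasSize S M) (k : ∣ S ∣ₛ → ℕ) →
  (∀ s → HasSize (T such-that λ t → Setoid._≈_ S (π t) s) (k s)) →
  HasSize T (∑ᴺ (k ∘ Inverse.to h))
size-fibres {S} {T} {M} π cg h k fib = ≅-trans (size-Σ _) (record
  { to = to
  ; from = λ t → code (π t) , Inverse.from (F (code (π t))) (t , π∈ t)
  ; to-cong = λ { refl → T.refl }
  ; from-cong = λ {x} {y} x≈y → lem (h.from-cong (cg x≈y)) x≈y
  ; inverse = (λ { {t} refl → Inverse.inverseˡ (F (code (π t))) refl })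
            , λ { {i , j} {t} t≈ →
                  lem′ (trans (h.from-cong (S.trans (cg t≈) (proj₂ (Inverse.to (F i) j)))) (h.inverseʳ S.refl)) t≈ }
  })
  where
  module S = Setoid S ; module T = Setoid T ; module h = Inverse h
  F = λ i → fib (h.to i)
  code = h.from
  to : (Σ[ i ∈ Fin M ] Fin (k (h.to i))) → T.Carrier
  to (i , j) = proj₁ (Inverse.to (F i) j)
  π∈ : ∀ t → π t S.≈ h.to (code (π t))
  π∈ t = S.sym (h.inverseˡ refl)
  lem : ∀ {x y} (e : code (π x) ≡ code (π y)) → x T.≈ y →
        _≡_ {A = Σ[ i ∈ Fin M ] Fin (k (h.to i))}
        (code (π x) , Inverse.from (F (code (π x))) (x , π∈ x))
        (code (π y) , Inverse.from (F (code (π y))) (y , π∈ y))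
  lem {x} {y} e x≈y with code (π x) | π∈ x | code (π y) | π∈ y
  lem {x} {y} refl x≈y | c | p | _ | q = cong (c ,_) (Inverse.from-cong (F c) x≈y)
  lem′ : ∀ {i j t} → code (π t) ≡ i → t T.≈ to (i , j) →
        _≡_ {A = Σ[ i ∈ Fin M ] Fin (k (h.to i))}
        (code (π t) , Inverse.from (F (code (π t))) (t , π∈ t)) (i , j)
  lem′ {i} {j} {t} e t≈ with code (π t) | π∈ t
  lem′ {i} {j} {t} refl t≈ | c | p = cong (c ,_) (Inverse.inverseʳ (F c) t≈)

∑-const : ∀ n c → ∑ᴺ {n} (λ _ → c) ≡ n ℕ.* c
∑-const zero c = refl
∑-const (suc n) c = cong (c ℕ.+_) (∑-const n c)

∑-congᴺ : ∀ {n} {f g : Fin n → ℕ} → (∀ i → f i ≡ g i) → ∑ᴺ f ≡ ∑ᴺ g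
∑-congᴺ = ℕ∑.sum-cong-≗

size-uniform-fibres : ∀ {S T : Setoid 0ℓ 0ℓ} {M} (π : ∣ T ∣ₛ → ∣ S ∣ₛ) →
  (∀ {x y} → Setoid._≈_ T x y → Setoid._≈_ S (π x) (π y)) →
  HasSize S M → ∀ c →
  (∀ s → HasSize (T such-that λ t → Setoid._≈_ S (π t) s) c) →
  HasSize T (M ℕ.* c)
size-uniform-fibres {S} {T} {M} π cg h c fib =
  ≡-size {T} (∑-const M c) (size-fibres {S} {T} π cg h (λ _ → c) fib)

[_]? : {P : Set} → Dec P → ℕ
[ d ]? = if does d then 1 else 0

size-dec : ∀ {S P} → (∀ x y → P → Setoid._≈_ S x y) → (P → ∣ S ∣ₛ) → (∣ S ∣ₛ → P) →
  (d : Dec P) → HasSize S [ d ]?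
size-dec {S} u f g (yes p) = size-one {S} (f p) (λ y → u _ _ p)
size-dec {S} u f g (no ¬p) = size-empty {S} (λ x → ¬p (g x))

size-such-that : ∀ {S : Setoid 0ℓ 0ℓ} {P : ∣ S ∣ₛ → Set} {M} (h : HasSize S M) →
  (∀ {x y} → Setoid._≈_ S x y → P x → P y) → (P? : ∀ x → Dec (P x)) →
  HasSize (S such-that P) (∑ᴺ λ i → [ P? (Inverse.to h i) ]?)
size-such-that {S} {P} h resp P? = size-fibres {S} {S such-that P} proj₁ (λ p → p) h (λ s → [ P? s ]?)
  λ s → size-dec {(S such-that P) such-that _}
    (λ (_ , p) (_ , q) _ → S.trans p (S.sym q)) (λ p → (s , p) , S.refl) (λ ((t , p) , e) → resp e p) (P? s)
  where module S = Setoid S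

size-× : ∀ {S T : Setoid 0ℓ 0ℓ} {M N} → HasSize S M → HasSize T N → HasSize (S ×ₛ T) (M ℕ.* N)
size-× {S} {T} {M} {N} h k = size-uniform-fibres {S} {S ×ₛ T} proj₁ proj₁ h N
  λ s → size-≅ (record
    { to = λ t → (s , t) , S.refl
    ; from = λ ((_ , t) , _) → t
    ; to-cong = λ p → S.refl , p
    ; from-cong = proj₂
    ; inverse = (λ {((_ , t) , e)} p → S.sym e , p) , proj₂ }) k
  where module S = Setoid S

Πₛ : ∀ {ℓ} → (Fin ℓ → Setoid 0ℓ 0ℓ) → Setoid 0ℓ 0ℓ
Πₛ S = record
  { Carrier = ∀ i → ∣ S i ∣ₛ
  ; _≈_ = λ f g → ∀ i → Setoid._≈_ (S i) (f i) (g i)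
  ; isEquivalence = record
    { refl = λ i → Setoid.refl (S i)
    ; sym = λ p i → Setoid.sym (S i) (p i)
    ; trans = λ p q i → Setoid.trans (S i) (p i) (q i) } }

cons-Π : ∀ {ℓ} {A : Fin (suc ℓ) → Set} → A fzero → (∀ i → A (fsuc i)) → ∀ i → A i
cons-Π x f fzero = x
cons-Π x f (fsuc i) = f i

size-Π : ∀ {ℓ} (S : Fin ℓ → Setoid 0ℓ 0ℓ) (m : Fin ℓ → ℕ) → (∀ i → HasSize (S i) (m i)) →
  HasSize (Πₛ S) (∏ᴺ m)
size-Π {zero} S m h = size-one {Πₛ S} (λ ()) (λ _ ())
size-Π {suc ℓ} S m h = size-≅ (injection+section {S fzero ×ₛ Πₛ (S ∘ fsuc)} {Πₛ S}
    (λ (x , f) → cons-Π x f) (λ f → f fzero , f ∘ fsuc)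
    (λ (p , q) → cons-Π p q) (λ p → p fzero , p ∘ fsuc)
    (λ f → cons-Π (Setoid.refl (S fzero)) (λ i → Setoid.refl (S (fsuc i)))))
  (size-× {S fzero} {Πₛ (S ∘ fsuc)} (h fzero) (size-Π (S ∘ fsuc) (m ∘ fsuc) (h ∘ fsuc)))

all-finite? : ∀ {S : Setoid 0ℓ 0ℓ} {P : ∣ S ∣ₛ → Set} {M} (h : HasSize S M) →
  (∀ {x y} → Setoid._≈_ S x y → P x → P y) → (∀ x → Dec (P x)) → Dec (∀ x → P x)
all-finite? h resp P? = map′ (λ f x → resp (Inverse.inverseˡ h refl) (f (Inverse.from h x)))
  (λ f i → f (Inverse.to h i)) (Fin.all? (λ i → P? (Inverse.to h i)))

any-finite? : ∀ {S : Setoid 0ℓ 0ℓ} {P : ∣ S ∣ₛ → Set} {M} (h : HasSize S M) →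
  (∀ {x y} → Setoid._≈_ S x y → P x → P y) → (∀ x → Dec (P x)) → Dec (∃ P)
any-finite? {S} h resp P? = map′ (λ (i , p) → Inverse.to h i , p)
  (λ (x , p) → Inverse.from h x , resp (Setoid.sym S (Inverse.inverseˡ h refl)) p) (Fin.any? (λ i → P? (Inverse.to h i)))

-- Both setoids have M elements and the two predicates have equally many solutions, so cancellation
-- in ℕ leaves equally many non-solutions. The bijection obtained comes from the enumerations and is
-- not a restriction of the given ones.
complement-≅ : ∀ {S T : Setoid 0ℓ 0ℓ} {P : ∣ S ∣ₛ → Set} {Q : ∣ T ∣ₛ → Set} {M} →
  HasSize S M →
  (∀ {x y} → Setoid._≈_ S x y → P x → P y) → (∀ x → Dec (P x)) →
  (∀ {x y} → Setoid._≈_ T x y → Q x → Q y) → (∀ x → Dec (Q x)) →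
  S ≅ T → (S such-that P) ≅ (T such-that Q) →
  (S such-that (¬_ ∘ P)) ≅ (T such-that (¬_ ∘ Q))
complement-≅ {S} {T} {P} {Q} {M} h respP P? respQ Q? φ ψ =
  ≅-trans (≅-sym ¬S) (≡-size {T such-that (¬_ ∘ Q)} (ℕ.+-cancelˡ-≡ (∑ᴺ (λ i → [ P? (Inverse.to h i) ]?)) _ _ (trans (cong (ℕ._+ nQ) PQ) (trans (sym (split Q Q? k)) (split P P? h)))) ¬T)
  where
  k = size-≅ φ h
  ¬S = size-such-that {S} h (λ e ¬p p → ¬p (respP (Setoid.sym S e) p)) (¬? ∘ P?)
  ¬T = size-such-that {T} k (λ e ¬p p → ¬p (respQ (Setoid.sym T e) p)) (¬? ∘ Q?)
  nQ = ∑ᴺ (λ i → [ ¬? (Q? (Inverse.to k i)) ]?)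
  PQ : ∑ᴺ (λ i → [ P? (Inverse.to h i) ]?) ≡ ∑ᴺ (λ i → [ Q? (Inverse.to k i) ]?)
  PQ = size-unique (≅-trans (size-such-that {S} h respP P?) ψ) (size-such-that {T} k respQ Q?)
  one : ∀ {A : Set} (d : Dec A) → 1 ≡ [ d ]? ℕ.+ [ ¬? d ]?
  one (yes _) = refl
  one (no _) = refl
  split : ∀ {S} (P : ∣ S ∣ₛ → Set) (P? : ∀ x → Dec (P x)) (h : HasSize S M) →
    M ≡ ∑ᴺ (λ i → [ P? (Inverse.to h i) ]?) ℕ.+ ∑ᴺ (λ i → [ ¬? (P? (Inverse.to h i)) ]?)
  split P P? h = trans (sym (trans (∑-const M 1) (ℕ.*-identityʳ M)))
    (trans (∑-congᴺ (λ i → one (P? (Inverse.to h i)))) (ℕ∑.∑-distrib-+ (λ i → [ P? (Inverse.to h i) ]?) (λ i → [ ¬? (P? (Inverse.to h i)) ]?)))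

-- Finite sums indexed by setoids

module FiniteSum (M : CommutativeMonoid 0ℓ 0ℓ) where

  open CommutativeMonoid M using (_≈_; _∙_; ∙-cong) renaming (Carrier to C; ε to 𝟎; refl to ≈-refl; sym to ≈-sym; trans to ≈-trans; reflexive to ≈-reflexive; assoc to ∙-assoc; identityˡ to ∙-identityˡ; identityʳ to ∙-identityʳ)
  module Tab = Sum M

  ∑ : ∀ {S N} → HasSize S N → (∣ S ∣ₛ → C) → C
  ∑ h f = Tab.sum (f ∘ Inverse.to h)

  ∑-cong : ∀ {S N} (h : HasSize S N) {f g : ∣ S ∣ₛ → C} → (∀ s → f s ≈ g s) → ∑ {S} h f ≈ ∑ {S} h g
  ∑-cong h e = Tab.sum-cong-≋ (λ i → e (Inverse.to h i))

  ∑-∙ : ∀ {S N} (h : HasSize S N) (f g : ∣ S ∣ₛ → C) → ∑ {S} h (λ s → f s ∙ g s) ≈ ∑ {S} h f ∙ ∑ {S} h g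
  ∑-∙ h f g = Tab.∑-distrib-+ (f ∘ Inverse.to h) (g ∘ Inverse.to h)

  ∑-ε : ∀ {S N} (h : HasSize S N) {f : ∣ S ∣ₛ → C} → (∀ s → f s ≈ 𝟎) → ∑ {S} h f ≈ 𝟎
  ∑-ε {S} {N} h e = ≈-trans (∑-cong {S} h e) (Tab.sum-replicate-zero N)

  ∑-swap : ∀ {S T M N} (h : HasSize S M) (k : HasSize T N) (f : ∣ S ∣ₛ → ∣ T ∣ₛ → C) →
    ∑ {S} h (λ s → ∑ {T} k (f s)) ≈ ∑ {T} k (λ t → ∑ {S} h (λ s → f s t))
  ∑-swap h k f = Tab.∑-comm (λ i j → f (Inverse.to h i) (Inverse.to k j))

  ∑-reindex : ∀ {S T M N} (h : HasSize S M) (k : HasSize T N) (φ : S ≅ T) {f : ∣ T ∣ₛ → C} →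
    (∀ {x y} → Setoid._≈_ T x y → f x ≈ f y) → ∑ {S} h (f ∘ Inverse.to φ) ≈ ∑ {T} k f
  ∑-reindex {S} {T} {m} h k φ {f} resp = ≈-sym (≈-trans (Tab.sum-permute (f ∘ Inverse.to k) π)
      (Tab.sum-cong-≋ {m} λ i → resp (Inverse.inverseˡ k refl)))
    where π = ≅-trans h (≅-trans φ (≅-sym k))

  ∑-≡-size : ∀ {S M N} (e : M ≡ N) (h : HasSize S M) f → ∑ {S} (≡-size {S} e h) f ≡ ∑ {S} h f
  ∑-≡-size refl h f = refl

  sum-++ : ∀ m {n} (f : Fin (m ℕ.+ n) → C) → Tab.sum f ≈ Tab.sum (λ i → f (i Fin.↑ˡ n)) ∙ Tab.sum (λ j → f (m Fin.↑ʳ j))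
  sum-++ zero f = ≈-sym (∙-identityˡ _)
  sum-++ (suc m) f = ≈-trans (∙-cong ≈-refl (sum-++ m (f ∘ fsuc))) (≈-sym (∙-assoc _ _ _))

  sum-split : ∀ {m} (k : Fin m → ℕ) (f : (Σ[ i ∈ Fin m ] Fin (k i)) → C) →
    Tab.sum (f ∘ split-Σ {m} {k}) ≈ Tab.sum (λ i → Tab.sum (λ j → f (i , j)))
  sum-split {zero} k f = ≈-refl
  sum-split {suc m} k f = ≈-trans (sum-++ (k fzero) (f ∘ split-Σ {suc m} {k}))
    (∙-cong (Tab.sum-cong-≋ (λ j → ≈-reflexive (cong f (split-join {suc m} {k} (fzero , j)))))
            (≈-trans (Tab.sum-cong-≋ (λ y → ≈-reflexive (cong f (right y))))
                     (sum-split (k ∘ fsuc) (λ (i , j) → f (fsuc i , j)))))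
    where
    right : ∀ y → split-Σ {suc m} {k} (k fzero Fin.↑ʳ y) ≡ (let (i , j) = split-Σ {m} {k ∘ fsuc} y in fsuc i , j)
    right y rewrite Fin.splitAt-↑ʳ (k fzero) (∑ᴺ (k ∘ fsuc)) y = refl

  ∑-× : ∀ {S T M N} (h : HasSize S M) (k : HasSize T N) (f : ∣ S ∣ₛ × ∣ T ∣ₛ → C) →
    ∑ {S ×ₛ T} (size-× {S} {T} h k) f ≈ ∑ {S} h (λ s → ∑ {T} k (λ t → f (s , t)))
  ∑-× {S} {T} {M} {N} h k f = ≈-trans (≈-reflexive (∑-≡-size {S ×ₛ T} (∑-const M N) _ f))
    (sum-split _ (λ (i , j) → f (Inverse.to h i , Inverse.to k j)))

  ∑-such-that : ∀ {S : Setoid 0ℓ 0ℓ} {P : ∣ S ∣ₛ → Set} {M N} (h : HasSize S M)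
    (k : HasSize (S such-that P) N) →
    (∀ {x y} → Setoid._≈_ S x y → P x → P y) → (P? : ∀ x → Dec (P x)) →
    (f : ∣ S ∣ₛ → C) → (∀ {x y} → Setoid._≈_ S x y → f x ≈ f y) →
    ∑ {S} h (λ s → if does (P? s) then f s else 𝟎) ≈ ∑ {S such-that P} k (f ∘ proj₁)
  ∑-such-that {S} {P} h k resp P? f fresp =
    ≈-sym (≈-trans (∑-reindex {S such-that P} {S such-that P} k (size-such-that {S} h resp P?) ≅-refl fresp)
     (≈-trans (sum-split _ (λ (i , j) → f (proj₁ (proj₁ (Inverse.to (fib i) j)))))
      (Tab.sum-cong-≋ λ i → one i)))
    where
    module S = Setoid S
    fib = λ i → let s = Inverse.to h i in size-dec {(S such-that P) such-that λ t → proj₁ t S.≈ s}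
      (λ (_ , p) (_ , q) _ → S.trans p (S.sym q)) (λ p → (s , p) , S.refl) (λ ((t , p) , e) → resp e p) (P? s)
    one : ∀ i → Tab.sum (λ j → f (proj₁ (proj₁ (Inverse.to (fib i) j)))) ≈ (if does (P? (Inverse.to h i)) then f (Inverse.to h i) else 𝟎)
    one i with P? (Inverse.to h i)
    ... | yes _ = ∙-identityʳ _
    ... | no _ = ≈-refl

  -- Connects the list enumerations of the definitions with the sums over `Fin` used in the proof.
  listSum : {A : Set} → (A → C) → List A → C
  listSum f xs = foldr _∙_ 𝟎 (map f xs)

  listSum-++ : {A : Set} (f : A → C) (xs ys : List A) → listSum f (xs ++ ys) ≈ listSum f xs ∙ listSum f ys
  listSum-++ f [] ys = ≈-sym (∙-identityˡ _)
  listSum-++ f (x ∷ xs) ys = ≈-trans (∙-cong ≈-refl (listSum-++ f xs ys)) (≈-sym (∙-assoc _ _ _))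

  listSum-concatMap : {A B : Set} (f : B → C) (g : A → List B) (xs : List A) →
    listSum f (concatMap g xs) ≈ listSum (λ x → listSum f (g x)) xs
  listSum-concatMap f g [] = ≈-refl
  listSum-concatMap f g (x ∷ xs) = ≈-trans (listSum-++ f (g x) (concatMap g xs)) (∙-cong ≈-refl (listSum-concatMap f g xs))

  listSum-map : {A B : Set} (f : B → C) (g : A → B) (xs : List A) → listSum f (map g xs) ≈ listSum (f ∘ g) xs
  listSum-map f g [] = ≈-refl
  listSum-map f g (x ∷ xs) = ∙-cong ≈-refl (listSum-map f g xs)

  listSum-tabulate : {A : Set} (f : A → C) {n : ℕ} (g : Fin n → A) → listSum f (tabulate g) ≈ Tab.sum (f ∘ g)
  listSum-tabulate f {zero} g = ≈-refl
  listSum-tabulate f {suc n} g = ∙-cong ≈-refl (listSum-tabulate f (g ∘ fsuc))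

-- The symmetric group as a finite setoid

Perms : ℕ → Setoid 0ℓ 0ℓ
Perms n = record
  { Carrier = Permutation′ n
  ; _≈_ = Perm._≈_
  ; isEquivalence = record
    { refl = λ _ → refl ; sym = λ p i → sym (p i) ; trans = λ p q i → trans (p i) (q i) } }

-- A permutation amounts to the image of `fzero` and what is left after removing it.
-- `allPermutations` follows the same recursion, which lets `listSum-allPermutations` compare the
-- two enumerations.
insert-≅ : ∀ n → (setoid (Fin (suc n)) ×ₛ Perms n) ≅ Perms (suc n)
insert-≅ n = injection+section {setoid (Fin (suc n)) ×ₛ Perms n} {Perms (suc n)}
  (λ (i , π) → insert fzero i π) (λ π → π ⟨$⟩ʳ fzero , remove fzero π)
  (λ { {i , π} {.i , ρ} (refl , e) fzero → refl
     ; {i , π} {.i , ρ} (refl , e) (fsuc k) → trans (insert-punchIn fzero i π k) (trans (cong (Fin.punchIn i) (e k)) (sym (insert-punchIn fzero i ρ k))) })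
  (λ {(i , π)} {(j , ρ)} e → e fzero , λ k → inj i j π ρ (e fzero) (e (fsuc k)))
  (insert-remove fzero)
  where
  inj : ∀ i j (π ρ : Permutation′ n) {k} → i ≡ j → insert fzero i π ⟨$⟩ʳ fsuc k ≡ insert fzero j ρ ⟨$⟩ʳ fsuc k → π ⟨$⟩ʳ k ≡ ρ ⟨$⟩ʳ k
  inj i .i π ρ {k} refl e = Fin.punchIn-injective i _ _
    (trans (sym (insert-punchIn fzero i π k)) (trans e (insert-punchIn fzero i ρ k)))

size-Perms : ∀ n → HasSize (Perms n) (n !)
size-Perms zero = size-one {Perms 0} idₚ (λ _ ())
size-Perms (suc n) = size-≅ (insert-≅ n) (size-× {setoid (Fin (suc n))} {Perms n} ≅-refl (size-Perms n))

module PermSum (M : CommutativeMonoid 0ℓ 0ℓ) where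
  open CommutativeMonoid M using (_≈_) renaming (Carrier to C; refl to ≈-refl; sym to ≈-sym; trans to ≈-trans)
  open FiniteSum M public

  ∑ₚ : ∀ {n} → (Permutation′ n → C) → C
  ∑ₚ {n} = ∑ {Perms n} (size-Perms n)

  listSum-allPermutations : ∀ n {f : Permutation′ n → C} → listSum f (allPermutations n) ≈ ∑ₚ f
  listSum-allPermutations zero = ≈-refl
  listSum-allPermutations (suc n) {f} =
    ≈-trans (listSum-concatMap f (λ i → map (insert fzero i) (allPermutations n)) (allFin (suc n)))
    (≈-trans (listSum-tabulate (λ i → listSum f (map (insert fzero i) (allPermutations n))) id)
    (≈-trans (Tab.sum-cong-≋ {suc n} (λ i → ≈-trans (listSum-map f (insert fzero i) (allPermutations n)) (listSum-allPermutations n {f ∘ insert fzero i})))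
     (≈-sym (∑-× {setoid (Fin (suc n))} {Perms n} ≅-refl (size-Perms n) (λ (i , π) → f (insert fzero i π))))))

  ∑ₚ-reindex : ∀ {n} (φ : Perms n ≅ Perms n) {f : Permutation′ n → C} →
    (∀ {π ρ} → π Perm.≈ ρ → f π ≈ f ρ) → ∑ₚ (f ∘ Inverse.to φ) ≈ ∑ₚ f
  ∑ₚ-reindex {n} φ = ∑-reindex {Perms n} {Perms n} (size-Perms n) (size-Perms n) φ

  ∑ₚ-cong : ∀ {n} {f g : Permutation′ n → C} → (∀ w → f w ≈ g w) → ∑ₚ f ≈ ∑ₚ g
  ∑ₚ-cong {n} = ∑-cong {Perms n} (size-Perms n)

  ∑ₚ-ε : ∀ {n} {f : Permutation′ n → C} → (∀ w → f w ≈ CommutativeMonoid.ε M) → ∑ₚ f ≈ CommutativeMonoid.ε M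
  ∑ₚ-ε {n} = ∑-ε {Perms n} (size-Perms n)

-- The sign of a permutation

module ℤ∏ = FiniteSum ℤ.*-1-commutativeMonoid

∏ᶻ : ∀ {n} → (Fin n → ℤ) → ℤ
∏ᶻ = ℤ∏.Tab.sum

∏ᶻ-cong : ∀ {n} {f g : Fin n → ℤ} → (∀ i → f i ≡ g i) → ∏ᶻ f ≡ ∏ᶻ g
∏ᶻ-cong = ℤ∏.Tab.sum-cong-≗

∏∏ : ∀ {n} → (Fin n → Fin n → ℤ) → ℤ
∏∏ f = ∏ᶻ λ i → ∏ᶻ (f i)

∏∏-cong : ∀ {n} {f g : Fin n → Fin n → ℤ} → (∀ i j → f i j ≡ g i j) → ∏∏ f ≡ ∏∏ g
∏∏-cong e = ∏ᶻ-cong λ i → ∏ᶻ-cong (e i)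

∏∏-* : ∀ {n} (f g : Fin n → Fin n → ℤ) → ∏∏ (λ i j → f i j ℤ.* g i j) ≡ ∏∏ f ℤ.* ∏∏ g
∏∏-* f g = trans (∏ᶻ-cong λ i → ℤ∏.Tab.∑-distrib-+ (f i) (g i)) (ℤ∏.Tab.∑-distrib-+ (∏ᶻ ∘ f) (∏ᶻ ∘ g))

∏∏-permute : ∀ {n} (f : Fin n → Fin n → ℤ) (π : Permutation′ n) → ∏∏ (λ i j → f (π ⟨$⟩ʳ i) (π ⟨$⟩ʳ j)) ≡ ∏∏ f
∏∏-permute f π = sym (trans (ℤ∏.Tab.sum-permute (∏ᶻ ∘ f) π) (∏ᶻ-cong λ i → ℤ∏.Tab.sum-permute (f (π ⟨$⟩ʳ i)) π))

∏∏-1 : ∀ {n} {f : Fin n → Fin n → ℤ} → (∀ i j → f i j ≡ 1ℤ) → ∏∏ f ≡ 1ℤ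
∏∏-1 {n} e = trans (∏ᶻ-cong {n} λ i → trans (∏ᶻ-cong (e i)) (ℤ∏.Tab.sum-replicate-zero n)) (ℤ∏.Tab.sum-replicate-zero n)

when : {P : Set} → Dec P → ℤ → ℤ
when d x = if does d then x else 1ℤ

ord : ∀ {n} → Fin n → Fin n → ℤ
ord a b = when (b Fin.<? a) -1ℤ

ord² : ∀ {n} (a b : Fin n) → ord a b ℤ.* ord a b ≡ 1ℤ
ord² a b with does (b Fin.<? a)
... | true = refl
... | false = refl

ord-< : ∀ {n} {a b : Fin n} → a Fin.< b → ord a b ≡ 1ℤ
ord-< {a = a} {b} a<b rewrite dec-false (b Fin.<? a) (Fin.<-asym a<b) = refl

ord-> : ∀ {n} {a b : Fin n} → b Fin.< a → ord a b ≡ -1ℤ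
ord-> {a = a} {b} b<a rewrite dec-true (b Fin.<? a) b<a = refl

ord-flip : ∀ {n} {a b : Fin n} → a ≢ b → ord a b ≡ ℤ.- ord b a
ord-flip {a = a} {b} a≢b with Fin.<-cmp a b
... | tri< a<b _ _ rewrite ord-< a<b | ord-> a<b = refl
... | tri≈ _ a≡b _ = contradiction a≡b a≢b
... | tri> _ _ b<a rewrite ord-< b<a | ord-> b<a = refl

-- The value is -1 exactly when `w` reverses the order of the pair. The factor `ord i j` removes the
-- dependence on the order in which the pair is listed.
cross : ∀ {n} → Permutation′ n → Fin n → Fin n → ℤ
cross w i j = ord i j ℤ.* ord (w ⟨$⟩ʳ i) (w ⟨$⟩ʳ j)

⟨$⟩ʳ-injective : ∀ {n} (w : Permutation′ n) {i j} → w ⟨$⟩ʳ i ≡ w ⟨$⟩ʳ j → i ≡ j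
⟨$⟩ʳ-injective w {i} {j} e = trans (sym (inverseˡₚ w)) (trans (cong (w ⟨$⟩ˡ_) e) (inverseˡₚ w))

neg-*-neg : ∀ x y → (ℤ.- x) ℤ.* (ℤ.- y) ≡ x ℤ.* y
neg-*-neg x y = trans (sym (ℤ.neg-distribˡ-* x (ℤ.- y))) (trans (cong ℤ.-_ (sym (ℤ.neg-distribʳ-* x y))) (ℤ.neg-involutive _))

cross-sym : ∀ {n} (w : Permutation′ n) i j → cross w i j ≡ cross w j i
cross-sym w i j with i Fin.≟ j
... | yes refl = refl
... | no i≢j = trans (cong₂ ℤ._*_ (ord-flip i≢j) (ord-flip (i≢j ∘ ⟨$⟩ʳ-injective w)))
                     (neg-*-neg (ord j i) (ord (w ⟨$⟩ʳ j) (w ⟨$⟩ʳ i)))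

∏< : ∀ {n} → (Fin n → Fin n → ℤ) → ℤ
∏< f = ∏∏ λ i j → when (i Fin.<? j) (f i j)

when-cong : {P : Set} (d : Dec P) {x y : ℤ} → (P → x ≡ y) → when d x ≡ when d y
when-cong (yes p) e = e p
when-cong (no _) e = refl

when-× : {P Q : Set} (d : Dec P) (e : Dec Q) {x : ℤ} → (P → when e -1ℤ ≡ x) → when (d ×-dec e) -1ℤ ≡ when d x
when-× (yes p) e f = f p
when-× (no _) e f = refl

when-1 : {P : Set} (d : Dec P) {x : ℤ} → (P → x ≡ 1ℤ) → when d x ≡ 1ℤ
when-1 (yes p) e = e p
when-1 (no _) e = refl

when-* : {P : Set} (d : Dec P) (x y : ℤ) → when d (x ℤ.* y) ≡ when d x ℤ.* when d y
when-* (yes _) x y = refl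
when-* (no _) x y = refl

-- The product is split along the diagonal; exchanging the two indices in the lower half puts its
-- factors next to those of the upper half.
∏<-symmetrize : ∀ {n} (f : Fin n → Fin n → ℤ) → (∀ i → f i i ≡ 1ℤ) → ∏∏ f ≡ ∏< (λ i j → f i j ℤ.* f j i)
∏<-symmetrize {n} f diag = begin
  ∏∏ f
    ≡⟨ ∏∏-cong {n} split ⟩
  ∏∏ (λ i j → when (i Fin.<? j) (f i j) ℤ.* when (j Fin.<? i) (f i j))
    ≡⟨ ∏∏-* (λ i j → when (i Fin.<? j) (f i j)) (λ i j → when (j Fin.<? i) (f i j)) ⟩
  ∏∏ (λ i j → when (i Fin.<? j) (f i j)) ℤ.* ∏∏ (λ i j → when (j Fin.<? i) (f i j))
    ≡⟨ cong (∏∏ (λ i j → when (i Fin.<? j) (f i j)) ℤ.*_) (ℤ∏.Tab.∑-comm (λ i j → when (j Fin.<? i) (f i j))) ⟩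
  ∏∏ (λ i j → when (i Fin.<? j) (f i j)) ℤ.* ∏∏ (λ i j → when (i Fin.<? j) (f j i))
    ≡⟨ sym (∏∏-* (λ i j → when (i Fin.<? j) (f i j)) (λ i j → when (i Fin.<? j) (f j i))) ⟩
  ∏∏ (λ i j → when (i Fin.<? j) (f i j) ℤ.* when (i Fin.<? j) (f j i))
    ≡⟨ ∏∏-cong {n} (λ i j → sym (when-* (i Fin.<? j) (f i j) (f j i))) ⟩
  ∏< (λ i j → f i j ℤ.* f j i) ∎
  where
  open ≡-Reasoning
  split : ∀ i j → f i j ≡ when (i Fin.<? j) (f i j) ℤ.* when (j Fin.<? i) (f i j)
  split i j with Fin.<-cmp i j
  ... | tri< p _ q rewrite dec-true (i Fin.<? j) p | dec-false (j Fin.<? i) q = sym (ℤ.*-identityʳ _)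
  ... | tri> q _ p rewrite dec-true (j Fin.<? i) p | dec-false (i Fin.<? j) q = sym (ℤ.*-identityˡ _)
  ... | tri≈ p refl q rewrite dec-false (i Fin.<? i) p = diag i

∏<-cong : ∀ {n} {f g : Fin n → Fin n → ℤ} → (∀ {i j} → i Fin.< j → f i j ≡ g i j) → ∏< f ≡ ∏< g
∏<-cong {n} e = ∏∏-cong {n} λ i j → when-cong (i Fin.<? j) e

∏<-* : ∀ {n} (f g : Fin n → Fin n → ℤ) → ∏< (λ i j → f i j ℤ.* g i j) ≡ ∏< f ℤ.* ∏< g
∏<-* {n} f g = trans (∏∏-cong {n} λ i j → when-* (i Fin.<? j) (f i j) (g i j)) (∏∏-* (λ i j → when (i Fin.<? j) (f i j)) (λ i j → when (i Fin.<? j) (g i j)))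

-- Reindexing turns the condition on `i` and `j` into one on their preimages, so `g` still selects
-- each unordered pair once, but possibly in the other order; by symmetry of `f` both orders
-- contribute the same factor.
∏<-permute : ∀ {n} (f : Fin n → Fin n → ℤ) (w : Permutation′ n) → (∀ i j → f i j ≡ f j i) →
  ∏< (λ i j → f (w ⟨$⟩ʳ i) (w ⟨$⟩ʳ j)) ≡ ∏< f
∏<-permute {n} f w f-sym = begin
  ∏< (λ i j → f (w ⟨$⟩ʳ i) (w ⟨$⟩ʳ j))
    ≡⟨ ∏∏-cong {n} (λ i j → cong₂ (λ a b → when (a Fin.<? b) (f (w ⟨$⟩ʳ i) (w ⟨$⟩ʳ j))) (sym (inverseˡₚ w)) (sym (inverseˡₚ w))) ⟩
  ∏∏ (λ i j → g (w ⟨$⟩ʳ i) (w ⟨$⟩ʳ j))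
    ≡⟨ ∏∏-permute g w ⟩
  ∏∏ g
    ≡⟨ ∏<-symmetrize g (λ i → cong (λ b → if b then f i i else 1ℤ) (dec-false (w ⟨$⟩ˡ i Fin.<? w ⟨$⟩ˡ i) (Fin.<-irrefl refl))) ⟩
  ∏< (λ i j → g i j ℤ.* g j i)
    ≡⟨ ∏<-cong {n} merge ⟩
  ∏< f ∎
  where
  open ≡-Reasoning
  g : Fin n → Fin n → ℤ
  g a b = when (w ⟨$⟩ˡ a Fin.<? w ⟨$⟩ˡ b) (f a b)
  merge : ∀ {i j} → i Fin.< j → g i j ℤ.* g j i ≡ f i j
  merge {i} {j} i<j with Fin.<-cmp (w ⟨$⟩ˡ i) (w ⟨$⟩ˡ j)
  ... | tri< p _ q rewrite dec-true (w ⟨$⟩ˡ i Fin.<? w ⟨$⟩ˡ j) p | dec-false (w ⟨$⟩ˡ j Fin.<? w ⟨$⟩ˡ i) q = ℤ.*-identityʳ _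
  ... | tri> q _ p rewrite dec-true (w ⟨$⟩ˡ j Fin.<? w ⟨$⟩ˡ i) p | dec-false (w ⟨$⟩ˡ i Fin.<? w ⟨$⟩ˡ j) q = trans (ℤ.*-identityˡ _) (f-sym j i)
  ... | tri≈ _ e _ = contradiction (⟨$⟩ʳ-injective (flip w) e) (Fin.<⇒≢ i<j)

-1^length-filter : {A : Set} {P : A → Set} (P? : ∀ x → Dec (P x)) (xs : List A) →
  -1ℤ ℤ.^ length (filter P? xs) ≡ ℤ∏.listSum (λ x → when (P? x) -1ℤ) xs
-1^length-filter P? [] = refl
-1^length-filter P? (x ∷ xs) with does (P? x)
... | true = cong (-1ℤ ℤ.*_) (-1^length-filter P? xs)
... | false = trans (-1^length-filter P? xs) (sym (ℤ.*-identityˡ _))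

listSum-cartesianProduct : {A B : Set} (f : A × B → ℤ) (xs : List A) (ys : List B) →
  ℤ∏.listSum f (cartesianProduct xs ys) ≡ ℤ∏.listSum (λ x → ℤ∏.listSum (λ y → f (x , y)) ys) xs
listSum-cartesianProduct f [] ys = refl
listSum-cartesianProduct f (x ∷ xs) ys = trans (ℤ∏.listSum-++ f (map (x ,_) ys) (cartesianProduct xs ys))
  (cong₂ ℤ._*_ (ℤ∏.listSum-map f (x ,_) ys) (listSum-cartesianProduct f xs ys))

-- The inversion sign is a product over unordered pairs of a symmetric function, hence multiplicative.
sign-∏< : ∀ {n} (w : Permutation′ n) → sign w ≡ ∏< (cross w)
sign-∏< {n} w = begin
  sign w
    ≡⟨ -1^length-filter {P = Inverted} inverted? (cartesianProduct (allFin n) (allFin n)) ⟩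
  ℤ∏.listSum (λ p → when (inverted? p) -1ℤ) (cartesianProduct (allFin n) (allFin n))
    ≡⟨ listSum-cartesianProduct (λ p → when (inverted? p) -1ℤ) (allFin n) (allFin n) ⟩
  ℤ∏.listSum (λ i → ℤ∏.listSum (λ j → when (inverted? (i , j)) -1ℤ) (allFin n)) (allFin n)
    ≡⟨ ℤ∏.listSum-tabulate (λ i → ℤ∏.listSum (λ j → when (inverted? (i , j)) -1ℤ) (allFin n)) id ⟩
  ∏ᶻ (λ i → ℤ∏.listSum (λ j → when (inverted? (i , j)) -1ℤ) (allFin n))
    ≡⟨ ∏ᶻ-cong (λ i → ℤ∏.listSum-tabulate (λ j → when (inverted? (i , j)) -1ℤ) id) ⟩
  ∏∏ (λ i j → when (inverted? (i , j)) -1ℤ)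
    ≡⟨ ∏∏-cong {n} agree ⟩
  ∏< (cross w) ∎
  where
  open ≡-Reasoning
  Inverted : Fin n × Fin n → Set
  Inverted p = proj₁ p Fin.< proj₂ p × w ⟨$⟩ʳ proj₂ p Fin.< w ⟨$⟩ʳ proj₁ p
  inverted? : ∀ p → Dec (Inverted p)
  inverted? p = (proj₁ p Fin.<? proj₂ p) ×-dec ((w ⟨$⟩ʳ proj₂ p) Fin.<? (w ⟨$⟩ʳ proj₁ p))
  agree : ∀ i j → when (inverted? (i , j)) -1ℤ ≡ when (i Fin.<? j) (cross w i j)
  agree i j = when-× (i Fin.<? j) ((w ⟨$⟩ʳ j) Fin.<? (w ⟨$⟩ʳ i)) λ i<j → sym (trans (cong (ℤ._* ord (w ⟨$⟩ʳ i) (w ⟨$⟩ʳ j)) (ord-< i<j)) (ℤ.*-identityˡ _))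

-- For each pair the order of the images under `v` enters twice and squares to 1; the second product
-- is then reindexed along `v`.
sign-∘ : ∀ {n} (v w : Permutation′ n) → sign (v ∘ₚ w) ≡ sign v ℤ.* sign w
sign-∘ {n} v w = begin
  sign (v ∘ₚ w)
    ≡⟨ sign-∏< (v ∘ₚ w) ⟩
  ∏< (cross (v ∘ₚ w))
    ≡⟨ ∏<-cong {n} (λ {i} {j} _ → step i j) ⟩
  ∏< (λ i j → cross v i j ℤ.* cross w (v ⟨$⟩ʳ i) (v ⟨$⟩ʳ j))
    ≡⟨ ∏<-* (cross v) (λ i j → cross w (v ⟨$⟩ʳ i) (v ⟨$⟩ʳ j)) ⟩
  ∏< (cross v) ℤ.* ∏< (λ i j → cross w (v ⟨$⟩ʳ i) (v ⟨$⟩ʳ j))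
    ≡⟨ cong (∏< (cross v) ℤ.*_) (∏<-permute (cross w) v (cross-sym w)) ⟩
  ∏< (cross v) ℤ.* ∏< (cross w)
    ≡⟨ cong₂ ℤ._*_ (sym (sign-∏< v)) (sym (sign-∏< w)) ⟩
  sign v ℤ.* sign w ∎
  where
  open ≡-Reasoning
  step : ∀ i j → cross (v ∘ₚ w) i j ≡ cross v i j ℤ.* cross w (v ⟨$⟩ʳ i) (v ⟨$⟩ʳ j)
  step i j = sym (trans (ℤ.*-assoc (ord i j) b (b ℤ.* c))
    (cong (ord i j ℤ.*_) (trans (sym (ℤ.*-assoc b b c)) (trans (cong (ℤ._* c) (ord² (v ⟨$⟩ʳ i) (v ⟨$⟩ʳ j))) (ℤ.*-identityˡ c)))))
    where b = ord (v ⟨$⟩ʳ i) (v ⟨$⟩ʳ j)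
          c = ord (w ⟨$⟩ʳ (v ⟨$⟩ʳ i)) (w ⟨$⟩ʳ (v ⟨$⟩ʳ j))

sign-cong : ∀ {n} (v w : Permutation′ n) → v Perm.≈ w → sign v ≡ sign w
sign-cong {n} v w e = trans (sign-∏< v) (trans (∏<-cong {n} {cross v} {cross w} (λ {i} {j} _ → cong₂ (λ a b → ord i j ℤ.* ord a b) (e i) (e j))) (sym (sign-∏< w)))

sign-id : ∀ {n} → sign (idₚ {n}) ≡ 1ℤ
sign-id {n} = trans (sign-∏< (idₚ {n})) (∏∏-1 {n} {λ i j → when (i Fin.<? j) (cross (idₚ {n}) i j)} λ i j → when-1 (i Fin.<? j) (λ _ → ord² i j))

sign-conj : ∀ {n} (g w : Permutation′ n) → sign (g ∘ₚ w ∘ₚ flip g) ≡ sign w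
sign-conj {n} g w = begin
  sign (g ∘ₚ w ∘ₚ flip g)           ≡⟨ sign-∘ g (w ∘ₚ flip g) ⟩
  sign g ℤ.* sign (w ∘ₚ flip g)     ≡⟨ cong (sign g ℤ.*_) (trans (sign-∘ w (flip g)) (ℤ.*-comm (sign w) (sign (flip g)))) ⟩
  sign g ℤ.* (sign (flip g) ℤ.* sign w) ≡⟨ sym (ℤ.*-assoc (sign g) (sign (flip g)) (sign w)) ⟩
  sign g ℤ.* sign (flip g) ℤ.* sign w   ≡⟨ cong (ℤ._* sign w) (trans (sym (sign-∘ g (flip g))) (trans (sign-cong (g ∘ₚ flip g) idₚ (λ _ → inverseˡₚ g)) (sign-id {n}))) ⟩
  1ℤ ℤ.* sign w                         ≡⟨ ℤ.*-identityˡ _ ⟩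
  sign w ∎
  where open ≡-Reasoning

transpose-ˡ : ∀ {n} (x y : Fin n) → transpose x y ⟨$⟩ʳ x ≡ y
transpose-ˡ x y rewrite dec-true (x Fin.≟ x) refl = refl

transpose-ʳ : ∀ {n} (x y : Fin n) → transpose x y ⟨$⟩ʳ y ≡ x
transpose-ʳ x y with y Fin.≟ x
... | yes e = e
... | no _ rewrite dec-true (y Fin.≟ y) refl = refl

transpose-≢ : ∀ {n} {x y k : Fin n} → k ≢ x → k ≢ y → transpose x y ⟨$⟩ʳ k ≡ k
transpose-≢ {x = x} {y} {k} p q rewrite dec-false (k Fin.≟ x) p | dec-false (k Fin.≟ y) q = refl

sign-transpose₀₁ : ∀ {n} → sign (transpose {suc (suc n)} fzero (fsuc fzero)) ≡ -1ℤ
sign-transpose₀₁ {n} = trans (sign-∏< τ) (cong₂ ℤ._*_ first rest)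
  where
  τ = transpose {suc (suc n)} fzero (fsuc fzero)
  ones : ∀ {m} {f : Fin m → ℤ} → (∀ i → f i ≡ 1ℤ) → ∏ᶻ f ≡ 1ℤ
  ones {m} e = trans (∏ᶻ-cong e) (ℤ∏.Tab.sum-replicate-zero m)
  first : ∏ᶻ (λ j → when (fzero {suc n} Fin.<? j) (cross τ fzero j)) ≡ -1ℤ
  first = cong (λ x → 1ℤ ℤ.* (-1ℤ ℤ.* x)) (ones {n} λ i → refl)
  rest : ∏ᶻ (λ (i : Fin (suc n)) → ∏ᶻ (λ j → when (fsuc i Fin.<? j) (cross τ (fsuc i) j))) ≡ 1ℤ
  rest = ones {suc n} λ i → ones λ j → entry₁ i j
    where
    entry₁ : ∀ (i : Fin (suc n)) j → when (fsuc i Fin.<? j) (cross τ (fsuc i) j) ≡ 1ℤ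
    entry₁ i fzero = refl
    entry₁ fzero (fsuc fzero) = refl
    entry₁ fzero (fsuc (fsuc j)) = refl
    entry₁ (fsuc i) (fsuc fzero) = refl
    entry₁ (fsuc i) (fsuc (fsuc j)) = when-1 (fsuc (fsuc i) Fin.<? fsuc (fsuc j)) λ _ → ord² {suc (suc n)} (fsuc (fsuc i)) (fsuc (fsuc j))

-- All transpositions are conjugate: `g` sends 0 to `x` and 1 to `y`, and for the swap of 0 and 1
-- the sign is computed directly.
sign-transpose : ∀ {n} {x y : Fin n} → x ≢ y → sign (transpose x y) ≡ -1ℤ
sign-transpose {suc zero} {fzero} {fzero} x≢y = contradiction refl x≢y
sign-transpose {suc (suc n)} {x} {y} x≢y =
  trans (sym (sign-conj g (transpose x y))) (trans (sign-cong (g ∘ₚ transpose x y ∘ₚ flip g) (transpose fzero (fsuc fzero)) same) (sign-transpose₀₁ {n}))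
  where
  g : Permutation′ (suc (suc n))
  g = insert fzero x (insert fzero (Fin.punchOut x≢y) idₚ)
  g₁ : g ⟨$⟩ʳ fsuc fzero ≡ y
  g₁ = trans (insert-punchIn fzero x (insert fzero (Fin.punchOut x≢y) idₚ) fzero) (Fin.punchIn-punchOut x≢y)
  same : ∀ i → (g ∘ₚ transpose x y ∘ₚ flip g) ⟨$⟩ʳ i ≡ transpose fzero (fsuc fzero) ⟨$⟩ʳ i
  same fzero = trans (cong (g ⟨$⟩ˡ_) (trans (transpose-ˡ x y) (sym g₁))) (inverseˡₚ g)
  same (fsuc fzero) = trans (cong (g ⟨$⟩ˡ_) (trans (cong (transpose x y ⟨$⟩ʳ_) g₁) (transpose-ʳ x y))) (inverseˡₚ g {fzero})
  same (fsuc (fsuc i)) = trans (cong (g ⟨$⟩ˡ_) (transpose-≢ {x = x} {y}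
      (λ e → case ⟨$⟩ʳ-injective g {fsuc (fsuc i)} {fzero} e of λ ())
      (λ e → case ⟨$⟩ʳ-injective g {fsuc (fsuc i)} {fsuc fzero} (trans e (sym g₁)) of λ ()))) (inverseˡₚ g)

-- Signed sums over drop-free permutations

abstract
  -- Descent along the relation; at each stage a finite search decides whether a smaller solution
  -- exists.
  minimal : ∀ {n} {_⊏_ : Rel (Fin n) 0ℓ} {Q : Fin n → Set} → WellFounded _⊏_ →
    (∀ x y → Dec (x ⊏ y)) → (∀ x → Dec (Q x)) → ∃ Q → ∃[ x ] Q x × (∀ y → y ⊏ x → ¬ Q y)
  minimal {n} {_⊏_} {Q} wf _⊏?_ Q? (x , q) = go x (wf x) q
    where
    go : ∀ x → Acc _⊏_ x → Q x → ∃[ x ] Q x × (∀ y → y ⊏ x → ¬ Q y)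
    go x (acc rs) q with Fin.any? (λ y → (y ⊏? x) ×-dec Q? y)
    ... | yes (y , y⊏x , qy) = go y (rs y⊏x) qy
    ... | no none = x , q , λ y y⊏x qy → none (y , y⊏x , qy)

module ℤ∑ = PermSum ℤ.+-0-commutativeMonoid

indicatorᶻ : {P : Set} → Dec P → ℤ
indicatorᶻ d = if does d then 1ℤ else 0ℤ

x+x≡0⇒x≡0 : ∀ x → x ℤ.+ x ≡ 0ℤ → x ≡ 0ℤ
x+x≡0⇒x≡0 (+ zero) e = refl
x+x≡0⇒x≡0 (+ suc n) ()
x+x≡0⇒x≡0 ℤ.-[1+ n ] ()

-- Used with `Fin n` as the positions of an arrangement of P, `_⊏_` as the order read off at these
-- positions, and `colour` as the segment of a position; `Preserves` is then membership in the Young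
-- subgroup.
module ColouredPoset {n} (_⊏_ : Rel (Fin n) 0ℓ) (_⊏?_ : ∀ x y → Dec (x ⊏ y))
  (⊏-irrefl : ∀ {x} → ¬ x ⊏ x) (⊏-trans : ∀ {x y z} → x ⊏ y → y ⊏ z → x ⊏ z) (colour : Fin n → ℕ) where

  isSPO : IsStrictPartialOrder _≡_ _⊏_
  isSPO = record
    { isEquivalence = Eq.isEquivalence ; irrefl = λ { refl → ⊏-irrefl } ; trans = ⊏-trans
    ; <-resp-≈ = (λ { refl p → p }) , (λ { refl p → p }) }

  Preserves : Permutation′ n → Set
  Preserves v = ∀ i → colour (v ⟨$⟩ʳ i) ≡ colour i

  NoDrop : Permutation′ n → Set
  NoDrop v = ∀ i → ¬ (v ⟨$⟩ʳ i) ⊏ i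

  noDrop? : ∀ v → Dec (NoDrop v)
  noDrop? v = Fin.all? λ i → ¬? ((v ⟨$⟩ʳ i) ⊏? i)

  Clash : Fin n → Fin n → Set
  Clash x y = x ≢ y × colour x ≡ colour y × ¬ x ⊏ y × ¬ y ⊏ x

  clash? : ∀ x y → Dec (Clash x y)
  clash? x y = ¬? (x Fin.≟ y) ×-dec (colour x ℕ.≟ colour y) ×-dec ¬? (x ⊏? y) ×-dec ¬? (y ⊏? x)

  NoClash : Set
  NoClash = ∀ x y → ¬ Clash x y

  noClash? : Dec NoClash
  noClash? = Fin.all? λ x → Fin.all? λ y → ¬? (clash? x y)

  Twins : Fin n → Fin n → Set
  Twins x y = x ≢ y × colour x ≡ colour y × (∀ t → colour t ≡ colour x → (t ⊏ x → t ⊏ y) × (t ⊏ y → t ⊏ x))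

  -- Choose `x` minimal among the elements having a clash, then `y` minimal among those clashing
  -- with `x`. An element of this colour below `x` clashes with nothing, so it is comparable with
  -- `y`, and it cannot lie above `y` without putting `y` below `x`. An element below `y` does not
  -- clash with `x`, and lying above `x` would put `x` below `y`.
  clash⇒twins : ∀ {x y} → Clash x y → ∃[ x ] ∃[ y ] Twins x y
  clash⇒twins {x₀} {y₀} c₀
    with x , (y₁ , c₁) , x-min ← minimal (spo-wellFounded isSPO) _⊏?_ (λ x → Fin.any? (clash? x)) (x₀ , y₀ , c₀)
    with y , (x≢y , xy , x⊏̸y , y⊏̸x) , y-min ← minimal (spo-wellFounded isSPO) _⊏?_ (clash? x) (y₁ , c₁)
    = x , y , x≢y , xy , λ t tx → below-x t tx , below-y t tx
    where
    below-x : ∀ t → colour t ≡ colour x → t ⊏ x → t ⊏ y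
    below-x t tx t⊏x with t Fin.≟ y | t ⊏? y | y ⊏? t
    ... | yes refl | _ | _ = contradiction t⊏x y⊏̸x
    ... | no _ | yes p | _ = p
    ... | no _ | no _ | yes q = contradiction (⊏-trans q t⊏x) y⊏̸x
    ... | no a | no b | no c = contradiction (y , a , trans tx xy , b , c) (x-min t t⊏x)
    below-y : ∀ t → colour t ≡ colour x → t ⊏ y → t ⊏ x
    below-y t tx t⊏y with t Fin.≟ x | t ⊏? x | x ⊏? t
    ... | yes refl | _ | _ = contradiction t⊏y x⊏̸y
    ... | no _ | yes p | _ = p
    ... | no _ | no _ | yes q = contradiction (⊏-trans q t⊏y) x⊏̸y
    ... | no a | no b | no c = contradiction (a ∘ sym , sym tx , c , b) (y-min t t⊏y)

  -- Within a chain a drop-free `v` can move `i` only upwards. By induction from the top `v` already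
  -- fixes `v i`, and injectivity then gives that `v i` is `i`.
  noClash⇒id : NoClash → ∀ v → Preserves v → NoDrop v → ∀ i → v ⟨$⟩ʳ i ≡ i
  noClash⇒id nc v pres nd i = go i (spo-noetherian isSPO i)
    where
    go : ∀ i → Acc (λ x y → y ⊏ x) i → v ⟨$⟩ʳ i ≡ i
    go i (acc rs) with (v ⟨$⟩ʳ i) Fin.≟ i | i ⊏? (v ⟨$⟩ʳ i)
    ... | yes e | _ = e
    ... | no _ | yes p = ⟨$⟩ʳ-injective v (go (v ⟨$⟩ʳ i) (rs p))
    ... | no a | no b = contradiction (a , pres i , nd i , b) (nc (v ⟨$⟩ʳ i) i)

  module _ (preserves? : ∀ v → Dec (Preserves v)) where

    signed : Permutation′ n → ℤ
    signed v = if does (preserves? v) then sign v else 0ℤ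

    -- Swapping the images of two elements with the same lower sets is a sign-reversing involution.
    twins-cancel : ∀ {x y} → Twins x y → ∀ v →
      signed v ℤ.* indicatorᶻ (noDrop? v) ℤ.+ signed (transpose x y ∘ₚ v) ℤ.* indicatorᶻ (noDrop? (transpose x y ∘ₚ v)) ≡ 0ℤ
    twins-cancel {x} {y} (x≢y , xy , same) v = begin
      signed v ℤ.* nd v ℤ.+ signed (τ ∘ₚ v) ℤ.* nd (τ ∘ₚ v)
        ≡⟨ cong (λ s → signed v ℤ.* nd v ℤ.+ s) second ⟩
      signed v ℤ.* nd v ℤ.+ ℤ.- signed v ℤ.* nd v
        ≡⟨ sym (ℤ.*-distribʳ-+ (nd v) (signed v) (ℤ.- signed v)) ⟩
      (signed v ℤ.+ ℤ.- signed v) ℤ.* nd v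
        ≡⟨ cong (ℤ._* nd v) (ℤ.+-inverseʳ (signed v)) ⟩
      0ℤ ∎
      where
      open ≡-Reasoning
      τ = transpose x y
      nd = indicatorᶻ ∘ noDrop?
      data View : Fin n → Set where
        at-x : View x
        at-y : View y
        off : ∀ {i} → τ ⟨$⟩ʳ i ≡ i → View i
      view : ∀ i → View i
      view i with i Fin.≟ x | i Fin.≟ y
      ... | yes refl | _ = at-x
      ... | no _ | yes refl = at-y
      ... | no a | no b = off (transpose-≢ a b)
      τ-colour : ∀ i → colour (τ ⟨$⟩ʳ i) ≡ colour i
      τ-colour i with view i
      ... | at-x = trans (cong colour (transpose-ˡ x y)) (sym xy)
      ... | at-y = trans (cong colour (transpose-ʳ x y)) xy
      ... | off e = cong colour e
      ττ : ∀ i → τ ⟨$⟩ʳ (τ ⟨$⟩ʳ i) ≡ i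
      ττ i with view i
      ... | at-x = trans (cong (τ ⟨$⟩ʳ_) (transpose-ˡ x y)) (transpose-ʳ x y)
      ... | at-y = trans (cong (τ ⟨$⟩ʳ_) (transpose-ʳ x y)) (transpose-ˡ x y)
      ... | off e = trans (cong (τ ⟨$⟩ʳ_) e) e
      pres→ : ∀ {v} → Preserves v → Preserves (τ ∘ₚ v)
      pres→ p i = trans (p (τ ⟨$⟩ʳ i)) (τ-colour i)
      pres← : ∀ {v} → Preserves (τ ∘ₚ v) → Preserves v
      pres← {v} p i = trans (cong (colour ∘ (v ⟨$⟩ʳ_)) (sym (ττ i))) (trans (p (τ ⟨$⟩ʳ i)) (τ-colour i))
      lower : ∀ i {t} → colour t ≡ colour i → t ⊏ i → t ⊏ (τ ⟨$⟩ʳ i)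
      lower i {t} c t⊏i with view i
      ... | at-x = subst (t ⊏_) (sym (transpose-ˡ x y)) (proj₁ (same t c) t⊏i)
      ... | at-y = subst (t ⊏_) (sym (transpose-ʳ x y)) (proj₂ (same t (trans c (sym xy))) t⊏i)
      ... | off e = subst (t ⊏_) (sym e) t⊏i
      nd→ : ∀ {v} → Preserves v → NoDrop v → NoDrop (τ ∘ₚ v)
      nd→ p d i ⊏i = d (τ ⟨$⟩ʳ i) (lower i (trans (p (τ ⟨$⟩ʳ i)) (τ-colour i)) ⊏i)
      nd← : ∀ {v} → Preserves v → NoDrop (τ ∘ₚ v) → NoDrop v
      nd← {v} p d i ⊏i = d (τ ⟨$⟩ʳ i) (subst (_⊏ (τ ⟨$⟩ʳ i)) (cong (v ⟨$⟩ʳ_) (sym (ττ i))) (lower i (p i) ⊏i))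
      sign-flip : sign (τ ∘ₚ v) ≡ ℤ.- sign v
      sign-flip = trans (sign-∘ τ v) (trans (cong (ℤ._* sign v) (sign-transpose x≢y)) (ℤ.-1*i≡-i (sign v)))
      flipped : signed (τ ∘ₚ v) ≡ ℤ.- signed v
      flipped with preserves? v | preserves? (τ ∘ₚ v)
      ... | yes _ | yes _ = sign-flip
      ... | no _ | no _ = refl
      ... | yes p | no ¬q = contradiction (pres→ {v} p) ¬q
      ... | no ¬p | yes q = contradiction (pres← {v} q) ¬p
      -- Twins share only lower elements of their own colour, so drop-freeness is compared for
      -- colour-preserving `v`; for all others both signed terms are zero.
      unchanged′ : Preserves v → nd (τ ∘ₚ v) ≡ nd v
      unchanged′ p = cong (λ b → if b then 1ℤ else 0ℤ) (does-⇔ (mk⇔ (nd← {v} p) (nd→ {v} p)) (noDrop? (τ ∘ₚ v)) (noDrop? v))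

      second : signed (τ ∘ₚ v) ℤ.* nd (τ ∘ₚ v) ≡ ℤ.- signed v ℤ.* nd v
      second with preserves? v in eq
      ... | yes p = cong₂ ℤ._*_ (trans flipped (cong (λ d → ℤ.- (if does d then sign v else 0ℤ)) eq)) (unchanged′ p)
      ... | no _ = cong (ℤ._* nd (τ ∘ₚ v)) (trans flipped (cong (λ d → ℤ.- (if does d then sign v else 0ℤ)) eq))

    -- Without clashes only the identity contributes. With twins, the sum added to its copy
    -- reindexed by the swap vanishes term by term; doubling replaces a choice of one permutation
    -- from each swapped pair, and ℤ has no 2-torsion.
    signed-sum : (d : Dec NoClash) → ℤ∑.∑ₚ (λ v → signed v ℤ.* indicatorᶻ (noDrop? v)) ≡ indicatorᶻ d
    signed-sum (yes nc) = trans (ℤ∑.∑ₚ-cong only-id) (single (size-Perms n))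
      where
      id? : ∀ v → Dec (v Perm.≈ idₚ)
      id? v = Fin.all? λ i → (v ⟨$⟩ʳ i) Fin.≟ i
      only-id : ∀ v → signed v ℤ.* indicatorᶻ (noDrop? v) ≡ (if does (id? v) then 1ℤ else 0ℤ)
      only-id v = on (id? v)
       where
       on : (d : Dec (v Perm.≈ idₚ)) → signed v ℤ.* indicatorᶻ (noDrop? v) ≡ (if does d then 1ℤ else 0ℤ)
       on (yes e) rewrite dec-true (preserves? v) (λ i → cong colour (e i))
                        | dec-true (noDrop? v) (λ i → ⊏-irrefl ∘ subst (_⊏ i) (e i))
                        = trans (ℤ.*-identityʳ _) (trans (sign-cong v idₚ e) (sign-id {n}))
       on (no ¬e) = off (preserves? v) (noDrop? v)
        where
        off : (p : Dec (Preserves v)) (q : Dec (NoDrop v)) → (if does p then sign v else 0ℤ) ℤ.* indicatorᶻ q ≡ 0ℤ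
        off (yes p) (yes q) = contradiction (noClash⇒id nc v p q) ¬e
        off (yes _) (no _) = ℤ.*-zeroʳ (sign v)
        off (no _) _ = refl
      single : ∀ {N} (h : HasSize (Perms n) N) → ℤ∑.∑ {Perms n} h (λ v → if does (id? v) then 1ℤ else 0ℤ) ≡ 1ℤ
      single h = trans (ℤ∑.∑-such-that {Perms n} {λ v → v Perm.≈ idₚ} h
          (size-one {Perms n such-that λ v → v Perm.≈ idₚ} (idₚ , λ _ → refl) (λ (v , e) i → sym (e i)))
          (λ e p i → trans (sym (e i)) (p i)) id? (λ _ → 1ℤ) (λ _ → refl)) refl
    signed-sum (no ¬nc) = x+x≡0⇒x≡0 (ℤ∑.∑ₚ term) (begin
        ℤ∑.∑ₚ term ℤ.+ ℤ∑.∑ₚ term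
          ≡⟨ cong (λ s → ℤ∑.∑ₚ term ℤ.+ s) (sym (ℤ∑.∑ₚ-reindex swap {term} (λ {v} {w} → term-cong {v} {w}))) ⟩
        ℤ∑.∑ₚ term ℤ.+ ℤ∑.∑ₚ (λ v → term (transpose x y ∘ₚ v))
          ≡⟨ sym (ℤ∑.∑-∙ {Perms n} (size-Perms n) term (λ v → term (transpose x y ∘ₚ v))) ⟩
        ℤ∑.∑ₚ (λ v → term v ℤ.+ term (transpose x y ∘ₚ v))
          ≡⟨ ℤ∑.∑ₚ-ε (twins-cancel tw) ⟩
        0ℤ ∎)
      where
      open ≡-Reasoning
      some-clash : ∃[ x ] ∃[ y ] Clash x y
      some-clash with Fin.any? (λ x → Fin.any? (clash? x))
      ... | yes c = c
      ... | no ¬c = contradiction (λ x y c → ¬c (x , y , c)) ¬nc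
      twins = clash⇒twins (proj₂ (proj₂ some-clash))
      x = proj₁ twins
      y = proj₁ (proj₂ twins)
      tw = proj₂ (proj₂ twins)
      term : Permutation′ n → ℤ
      term v = signed v ℤ.* indicatorᶻ (noDrop? v)
      term-cong : ∀ {v w} → v Perm.≈ w → term v ≡ term w
      term-cong {v} {w} e = cong₂ ℤ._*_
        (cong₂ (λ b s → if b then s else 0ℤ) (does-⇔ (mk⇔ (λ p i → trans (cong colour (sym (e i))) (p i)) (λ p i → trans (cong colour (e i)) (p i))) (preserves? v) (preserves? w)) (sign-cong v w e))
        (cong (λ b → if b then 1ℤ else 0ℤ) (does-⇔ (mk⇔ (λ p i → p i ∘ subst (_⊏ i) (sym (e i))) (λ p i → p i ∘ subst (_⊏ i) (e i))) (noDrop? v) (noDrop? w)))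
      swap : Perms n ≅ Perms n
      swap = injection+section {Perms n} {Perms n} (transpose x y ∘ₚ_) (flip (transpose x y) ∘ₚ_)
        (λ e i → e (transpose x y ⟨$⟩ʳ i))
        (λ {v} {w} e i → trans (cong (v ⟨$⟩ʳ_) (sym (inverseʳₚ (transpose x y) {i}))) (trans (e (transpose x y ⟨$⟩ˡ i)) (cong (w ⟨$⟩ʳ_) (inverseʳₚ (transpose x y) {i}))))
        (λ v i → cong (v ⟨$⟩ʳ_) (inverseˡₚ (transpose x y) {i}))

-- Bijections preserving a colouring

-- Bijections between corresponding fibres are assembled into one global bijection. `to-at` and
-- `from-at` allow an element to be treated in the fibre of any key equal to its own.
module Glue {A B : Setoid 0ℓ 0ℓ} {K : Set} (κ : ∣ A ∣ₛ → K) (μ : ∣ B ∣ₛ → K)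
  (κ-cong : ∀ {x y} → Setoid._≈_ A x y → κ x ≡ κ y) (μ-cong : ∀ {x y} → Setoid._≈_ B x y → μ x ≡ μ y)
  (ρ : ∀ k → (A such-that λ a → κ a ≡ k) ≅ (B such-that λ b → μ b ≡ k)) where

  private
    module A = Setoid A
    module B = Setoid B

  to : ∣ A ∣ₛ → ∣ B ∣ₛ
  to a = proj₁ (Inverse.to (ρ (κ a)) (a , refl))

  from : ∣ B ∣ₛ → ∣ A ∣ₛ
  from b = proj₁ (Inverse.from (ρ (μ b)) (b , refl))

  to-key : ∀ a → μ (to a) ≡ κ a
  to-key a = proj₂ (Inverse.to (ρ (κ a)) (a , refl))

  to-at : ∀ {k} a (p : κ a ≡ k) → to a B.≈ proj₁ (Inverse.to (ρ k) (a , p))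
  to-at a refl = B.refl

  from-at : ∀ {k} b (p : μ b ≡ k) → from b A.≈ proj₁ (Inverse.from (ρ k) (b , p))
  from-at b refl = A.refl

  glue : A ≅ B
  glue = record
    { to = to
    ; from = from
    ; to-cong = to-cong
    ; from-cong = from-cong
    ; inverse = (λ {b} {a} a≈ → B.trans (to-cong a≈) (to-from b)) , (λ {a} {b} b≈ → A.trans (from-cong b≈) (from-to a))
    }
    where
    to-cong : ∀ {x y} → x A.≈ y → to x B.≈ to y
    to-cong {x} {y} e = B.trans (Inverse.to-cong (ρ (κ x)) {x , refl} {y , sym (κ-cong e)} e) (B.sym (to-at y (sym (κ-cong e))))
    from-cong : ∀ {x y} → x B.≈ y → from x A.≈ from y
    from-cong {x} {y} e = A.trans (Inverse.from-cong (ρ (μ x)) {x , refl} {y , sym (μ-cong e)} e) (A.sym (from-at y (sym (μ-cong e))))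
    to-from : ∀ b → to (from b) B.≈ b
    to-from b = let (a , p) = Inverse.from (ρ (μ b)) (b , refl) in
      B.trans (to-at a p) (Inverse.inverseˡ (ρ (μ b)) {b , refl} {a , p} A.refl)
    from-to : ∀ a → from (to a) A.≈ a
    from-to a = let (b , p) = Inverse.to (ρ (κ a)) (a , refl) in
      A.trans (from-at b p) (Inverse.inverseʳ (ρ (κ a)) {a , refl} {b , p} B.refl)

Bijections : Setoid 0ℓ 0ℓ → Setoid 0ℓ 0ℓ → Setoid 0ℓ 0ℓ
Bijections A B = record
  { Carrier = A ≅ B
  ; _≈_ = λ f g → ∀ a → Setoid._≈_ B (Inverse.to f a) (Inverse.to g a)
  ; isEquivalence = record
    { refl = λ _ → Setoid.refl B
    ; sym = λ p a → Setoid.sym B (p a)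
    ; trans = λ p q a → Setoid.trans B (p a) (q a) } }

-- Once both fibres over each colour are numbered, a colour-preserving bijection is a family of
-- permutations, one of each `Fin (m i)`. It is used twice: for the arrangements inducing a given
-- colouring, and for the matchings of rows with cycles of equal length.
size-colour-bijections : ∀ {A B : Setoid 0ℓ 0ℓ} {ℓ} (κ : ∣ A ∣ₛ → Fin ℓ) (μ : ∣ B ∣ₛ → Fin ℓ) →
  (∀ {x y} → Setoid._≈_ A x y → κ x ≡ κ y) → (∀ {x y} → Setoid._≈_ B x y → μ x ≡ μ y) →
  (m : Fin ℓ → ℕ) →
  (∀ i → HasSize (A such-that λ a → κ a ≡ i) (m i)) → (∀ i → HasSize (B such-that λ b → μ b ≡ i) (m i)) →
  HasSize (Bijections A B such-that λ f → ∀ a → μ (Inverse.to f a) ≡ κ a) (∏ᴺ (λ i → m i !))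
size-colour-bijections {A} {B} {ℓ} κ μ κ-cong μ-cong m hA hB =
  size-≅ (injection+section {Πₛ (λ i → Perms (m i))} {Bijections A B such-that λ f → ∀ a → μ (Inverse.to f a) ≡ κ a}
    (λ π → G.glue π , G.to-key π)
    (λ (f , pres) i → restrict f pres i)
    (λ {π} {π′} e a → Inverse.to-cong (hB (κ a)) (e (κ a) (Inverse.from (hA (κ a)) (a , refl))))
    (λ {π} {π′} e i j → inj π π′ e i j)
    (λ (f , pres) a → sect f pres a))
  (size-Π (λ i → Perms (m i)) (λ i → m i !) (λ i → size-Perms (m i)))
  where
  module A = Setoid A
  module B = Setoid B
  ρ : (∀ i → Permutation′ (m i)) → ∀ i → (A such-that λ a → κ a ≡ i) ≅ (B such-that λ b → μ b ≡ i)
  ρ π i = ≅-trans (≅-sym (hA i)) (≅-trans (π i) (hB i))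
  module G π = Glue {A} {B} κ μ κ-cong μ-cong (ρ π)
  restrict : (f : A ≅ B) → (∀ a → μ (Inverse.to f a) ≡ κ a) → ∀ i → Permutation′ (m i)
  restrict f pres i = ≅-trans (hA i) (≅-trans (such-that-≅ f (λ a p → trans (pres a) p)
    (λ b p → trans (sym (pres (Inverse.from f b))) (trans (μ-cong (Inverse.inverseˡ f A.refl)) p))) (≅-sym (hB i)))
  inj : ∀ π π′ → (∀ a → G.to π a B.≈ G.to π′ a) → ∀ i j → π i ⟨$⟩ʳ j ≡ π′ i ⟨$⟩ʳ j
  inj π π′ e i j = let (a , p) = Inverse.to (hA i) j in begin
    π i ⟨$⟩ʳ j
      ≡⟨ cong (π i ⟨$⟩ʳ_) (sym (Inverse.inverseʳ (hA i) A.refl)) ⟩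
    π i ⟨$⟩ʳ (Inverse.from (hA i) (a , p))
      ≡⟨ sym (Inverse.inverseʳ (hB i) B.refl) ⟩
    Inverse.from (hB i) (Inverse.to (ρ π i) (a , p))
      ≡⟨ Inverse.from-cong (hB i) (B.trans (B.sym (G.to-at π a p)) (B.trans (e a) (G.to-at π′ a p))) ⟩
    Inverse.from (hB i) (Inverse.to (ρ π′ i) (a , p))
      ≡⟨ Inverse.inverseʳ (hB i) B.refl ⟩
    π′ i ⟨$⟩ʳ (Inverse.from (hA i) (a , p))
      ≡⟨ cong (π′ i ⟨$⟩ʳ_) (Inverse.inverseʳ (hA i) A.refl) ⟩
    π′ i ⟨$⟩ʳ j ∎
    where open ≡-Reasoning
  sect : ∀ f pres a → G.to (restrict f pres) a B.≈ Inverse.to f a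
  sect f pres a = B.trans (Inverse.inverseˡ (hB (κ a)) refl)
    (Inverse.to-cong f (Inverse.inverseˡ (hA (κ a)) refl))

-- Segments and proper colourings

∑-lookup : ∀ xs → ∑ᴺ (lookup xs) ≡ Data.Nat.ListAction.sum xs
∑-lookup [] = refl
∑-lookup (x ∷ xs) = cong (x ℕ.+_) (∑-lookup xs)

∏-lookup : (f : ℕ → ℕ) → ∀ xs → ∏ᴺ (f ∘ lookup xs) ≡ Data.Nat.ListAction.product (map f xs)
∏-lookup f [] = refl
∏-lookup f (x ∷ xs) = cong (f x ℕ.*_) (∏-lookup f xs)

toℕ-join : ∀ {m} {k : Fin (suc m) → ℕ} i j → toℕ (join-Σ {suc m} {k} (fsuc i , j)) ≡ k fzero ℕ.+ toℕ (join-Σ {m} {k ∘ fsuc} (i , j))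
toℕ-join {k = k} i j = Fin.toℕ-↑ʳ (k fzero) _

-- `join-Σ` numbers the boxes row by row, so the rows of the diagram become the segments cut off by
-- `segment`.
segment-join : ∀ xs i j → segment xs (toℕ (join-Σ {length xs} {lookup xs} (i , j))) ≡ toℕ i
segment-join (x ∷ xs) fzero j
  rewrite Fin.toℕ-↑ˡ j (∑ᴺ (lookup xs)) | dec-true (toℕ j ℕ.<? x) (Fin.toℕ<n j) = refl
segment-join (x ∷ xs) (fsuc i) j
  rewrite toℕ-join {k = lookup (x ∷ xs)} i j
        | dec-false (x ℕ.+ toℕ (join-Σ {length xs} {lookup xs} (i , j)) ℕ.<? x) (ℕ.m+n≮m x _)
        | ℕ.m+n∸m≡n x (toℕ (join-Σ {length xs} {lookup xs} (i , j)))
        = cong suc (segment-join xs i j)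

module Boxes {n} (mu : Partition n) where

  BoxOf : Set
  BoxOf = Σ[ i ∈ Fin (len mu) ] Fin (part mu i)

  ∑-part : ∑ᴺ (part mu) ≡ n
  ∑-part = trans (∑-lookup (parts mu)) (total mu)

  boxes : HasSize (setoid BoxOf) n
  boxes = ≡-size {setoid BoxOf} ∑-part (size-Σ (part mu))

  row : Fin n → Fin (len mu)
  row i = proj₁ (Inverse.to boxes i)

  segment-row : ∀ i → segment (parts mu) (toℕ i) ≡ toℕ (row i)
  segment-row = at ∑-part
    where
    at : ∀ {n} (e : ∑ᴺ (part mu) ≡ n) (i : Fin n) →
      segment (parts mu) (toℕ i) ≡ toℕ (proj₁ (Inverse.to (≡-size {setoid BoxOf} e (size-Σ (part mu))) i))
    at refl i = trans (cong (segment (parts mu) ∘ toℕ) (sym (join-split {k = part mu} i)))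
      (let (k , j) = split-Σ {k = part mu} i in segment-join (parts mu) k j)

  same-segment : ∀ {i j} → segment (parts mu) (toℕ i) ≡ segment (parts mu) (toℕ j) → row i ≡ row j
  same-segment {i} {j} e = Fin.toℕ-injective (trans (sym (segment-row i)) (trans e (segment-row j)))

  same-row : ∀ {i j} → row i ≡ row j → segment (parts mu) (toℕ i) ≡ segment (parts mu) (toℕ j)
  same-row {i} {j} e = trans (segment-row i) (trans (cong toℕ e) (sym (segment-row j)))

  size-row : ∀ k → HasSize (setoid (Fin n) such-that λ i → row i ≡ k) (part mu k)
  size-row k = size-≅ (≅-trans fibre (such-that-≅ (≅-sym boxes)
      (λ b p → trans (cong proj₁ (Inverse.inverseˡ boxes {b} refl)) p) (λ i p → p))) ≅-refl
    where
    fibre : setoid (Fin (part mu k)) ≅ (setoid BoxOf such-that λ b → proj₁ b ≡ k)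
    fibre = injection+section {setoid (Fin (part mu k))} {setoid BoxOf such-that λ b → proj₁ b ≡ k}
      (λ j → (k , j) , refl) (λ { ((_ , j) , refl) → j }) (cong (k ,_)) (λ { refl → refl }) (λ { (_ , refl) → refl })

hasSize? : ∀ {S k} → HasSize S k → ∀ m → Dec (HasSize S m)
hasSize? {S} {k} h m = map′ (λ e → ≡-size {S} e h) (size-unique h) (k ℕ.≟ m)

size-→ : ∀ {A : Set} {n} → HasSize (setoid A) n → ∀ ℓ → HasSize (A →-setoid Fin ℓ) (∏ᴺ {n} λ _ → ℓ)
size-→ {A} {n} h ℓ = size-≅ (injection+section {Πₛ {n} (λ _ → setoid (Fin ℓ))} {A →-setoid Fin ℓ}
    (λ f → f ∘ Inverse.from h) (λ f → f ∘ Inverse.to h) (λ e a → e (Inverse.from h a))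
    (λ {f} {g} e i → trans (cong f (sym (Inverse.inverseʳ h refl))) (trans (e (Inverse.to h i)) (cong g (Inverse.inverseʳ h refl))))
    (λ f a → cong f (Inverse.inverseˡ h refl)))
  (size-Π {n} (λ _ → setoid (Fin ℓ)) (λ _ → ℓ) (λ _ → ≅-refl))

module PosetFacts {n} (P : FinitePoset n) where
  open FinitePoset P public
  private module DPO = IsDecPartialOrder isDecPartialOrder

  elem : Fin n → Carrier
  elem = Inverse.to size

  index : Carrier → Fin n
  index = Inverse.from size

  elem-index : ∀ x → elem (index x) ≡ x
  elem-index x = Inverse.inverseˡ size refl

  index-elem : ∀ i → index (elem i) ≡ i
  index-elem i = Inverse.inverseʳ size refl

  elem-injective : ∀ {i j} → elem i ≡ elem j → i ≡ j
  elem-injective {i} {j} e = trans (sym (index-elem i)) (trans (cong index e) (index-elem j))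

  _≟_ : (x y : Carrier) → Dec (x ≡ y)
  _≟_ = DPO._≟_

  _≤?_ : (x y : Carrier) → Dec (x ≤ y)
  _≤?_ = DPO._≤?_

  _<?_ : (x y : Carrier) → Dec (x < y)
  x <? y = (x ≤? y) ×-dec ¬? (x ≟ y)

  <-irrefl : ∀ {x} → ¬ x < x
  <-irrefl (_ , x≢x) = x≢x refl

  <-trans : ∀ {x y z} → x < y → y < z → x < z
  <-trans (x≤y , x≢y) (y≤z , y≢z) = DPO.trans x≤y y≤z , λ { refl → x≢y (DPO.antisym x≤y y≤z) }

  Incomparable : Rel Carrier 0ℓ
  Incomparable = Adj (inc P)

  incomparable? : ∀ x y → Dec (Incomparable x y)
  incomparable? x y = ¬? (x ≤? y) ×-dec ¬? (y ≤? x)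

  ≮⇒incomparable : ∀ {x y} → x ≢ y → ¬ x < y → ¬ y < x → Incomparable x y
  ≮⇒incomparable x≢y p q = (λ x≤y → p (x≤y , x≢y)) , (λ y≤x → q (y≤x , x≢y ∘ sym))

module Colourings {n} (P : FinitePoset n) (mu : Partition n) where
  open PosetFacts P
  open Boxes mu

  Proper : (Carrier → Fin (len mu)) → Set
  Proper κ = (∀ {u v} → Incomparable u v → κ u ≢ κ v) ×
    (∀ i → HasSize (setoid Carrier such-that λ v → κ v ≡ i) (part mu i))

  proper? : ∀ κ → Dec (Proper κ)
  proper? κ = map′ (λ f {u} {v} → f u v) (λ f u v → f {u} {v})
      (all-finite? size (λ { refl p → p }) λ u → all-finite? size (λ { refl p → p }) λ v →
        incomparable? u v →-dec ¬? (κ u Fin.≟ κ v))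
    ×-dec Fin.all? λ i → hasSize? (size-such-that {setoid Carrier} size (λ { refl p → p }) (λ v → κ v Fin.≟ i)) (part mu i)

  proper-resp : ∀ {κ μ} → (∀ x → κ x ≡ μ x) → Proper κ → Proper μ
  proper-resp e (p , q) = (λ {u} {v} a b → p a (trans (e u) (trans b (sym (e v))))) ,
    λ i → size-≅ (such-that-⇔ (λ v r → trans (sym (e v)) r) (λ v r → trans (e v) r)) (q i)

  count : ℕ
  count = ∑ᴺ λ i → [ proper? (Inverse.to (size-→ size (len mu)) i) ]?

  size-colourings : HasSize (ProperColourings (inc P) mu) count
  size-colourings = size-such-that {Carrier →-setoid Fin (len mu)} (size-→ size (len mu)) (λ {x} {y} → proper-resp {x} {y}) proper?

  -- The arrangement `g` puts the element numbered `g i` at position `i`; the order of P is pulled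
  -- back to positions and the colours are the segments.
  module Arr (g : Permutation′ n) = ColouredPoset (λ i j → elem (g ⟨$⟩ʳ i) < elem (g ⟨$⟩ʳ j)) (λ i j → elem (g ⟨$⟩ʳ i) <? elem (g ⟨$⟩ʳ j)) <-irrefl <-trans (λ i → segment (parts mu) (toℕ i))

  Chains : Permutation′ n → Set
  Chains g = Arr.NoClash g

  chains-resp : ∀ {g h} → g Perm.≈ h → Chains g → Chains h
  chains-resp e c x y (x≢y , xy , p , q) = c x y (x≢y , xy ,
    (λ r → p (subst (λ (a , b) → elem a < elem b) (cong₂ _,_ (e x) (e y)) r)) ,
    (λ r → q (subst (λ (a , b) → elem a < elem b) (cong₂ _,_ (e y) (e x)) r)))

  colouring : Permutation′ n → Carrier → Fin (len mu)
  colouring g x = row (g ⟨$⟩ˡ index x)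

  place : Permutation′ n → setoid (Fin n) ≅ setoid Carrier
  place g = ≅-trans g size

  chains⇒proper : ∀ g → Chains g → Proper (colouring g)
  chains⇒proper g c = (λ {u} {v} uv e → c (g ⟨$⟩ˡ index u) (g ⟨$⟩ˡ index v)
      ((λ q → irrefl (inc P) (subst (Incomparable u) (sym (trans (sym (back u)) (trans (cong (elem ∘ (g ⟨$⟩ʳ_)) q) (back v)))) uv))
      , same-row e
      , (λ r → proj₁ uv (proj₁ (subst (λ (a , b) → a < b) (cong₂ _,_ (back u) (back v)) r)))
      , (λ r → proj₂ uv (proj₁ (subst (λ (a , b) → a < b) (cong₂ _,_ (back v) (back u)) r)))))
    , λ i → size-≅ (such-that-≅ (place g) (λ j p → trans (cong row (trans (cong (g ⟨$⟩ˡ_) (index-elem _)) (inverseˡₚ g))) p) (λ x p → p)) (size-row i)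
    where
    back : ∀ x → elem (g ⟨$⟩ʳ (g ⟨$⟩ˡ index x)) ≡ x
    back x = trans (cong elem (inverseʳₚ g)) (elem-index x)

  proper⇒chains : ∀ g (κ : Carrier → Fin (len mu)) → (∀ {u v} → Incomparable u v → κ u ≢ κ v) → (∀ x → colouring g x ≡ κ x) → Chains g
  proper⇒chains g κ proper e x y (x≢y , xy , p , q) =
    proper (≮⇒incomparable (x≢y ∘ ⟨$⟩ʳ-injective g ∘ elem-injective) p q)
      (trans (sym (at x)) (trans (same-segment xy) (at y)))
    where
    at : ∀ i → row i ≡ κ (elem (g ⟨$⟩ʳ i))
    at i = trans (cong row (sym (trans (cong (g ⟨$⟩ˡ_) (index-elem _)) (inverseˡₚ g)))) (e (elem (g ⟨$⟩ʳ i)))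

  -- If all segments of an arrangement are chains, colouring elements by their segment is proper. A
  -- given proper colouring arises by ordering each colour class inside its segment, hence from ∏
  -- μ_i! arrangements, the order of the Young subgroup.
  size-chains : HasSize (Perms n such-that Chains) (count ℕ.* youngOrder mu)
  size-chains = size-uniform-fibres {ProperColourings (inc P) mu} {Perms n such-that Chains}
    (λ (g , c) → colouring g , chains⇒proper g c)
    (λ {(g , _)} {(h , _)} e x → cong row (flip-cong g h e (index x)))
    size-colourings (youngOrder mu) λ (κ , proper , sizes) →
      size-≅ (≅-sym (fibre κ proper)) (≡-size {ColouredBijections κ} (∏-lookup _! (parts mu))
        (size-colour-bijections {setoid (Fin n)} {setoid Carrier} row κ (cong row) (cong κ) (part mu) size-row sizes))
    where
    flip-cong : ∀ (g h : Permutation′ n) → g Perm.≈ h → flip g Perm.≈ flip h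
    flip-cong g h e i = ⟨$⟩ʳ-injective h (trans (sym (e (g ⟨$⟩ˡ i))) (trans (inverseʳₚ g) (sym (inverseʳₚ h))))
    ColouredBijections : (Carrier → Fin (len mu)) → Setoid 0ℓ 0ℓ
    ColouredBijections κ = Bijections (setoid (Fin n)) (setoid Carrier) such-that λ f → ∀ a → κ (Inverse.to f a) ≡ row a
    fibre : ∀ κ → (∀ {u v} → Incomparable u v → κ u ≢ κ v) →
      ((Perms n such-that Chains) such-that λ (g , _) → ∀ x → colouring g x ≡ κ x) ≅ ColouredBijections κ
    fibre κ proper = injection+section {(Perms n such-that Chains) such-that λ (g , _) → ∀ x → colouring g x ≡ κ x} {ColouredBijections κ}
      (λ ((g , _) , e) → place g , λ i → trans (sym (e (elem (g ⟨$⟩ʳ i)))) (cong row (trans (cong (g ⟨$⟩ˡ_) (index-elem _)) (inverseˡₚ g))))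
      (λ (f , e) → let e′ = λ x → trans (sym (e _)) (cong κ (trans (Inverse.inverseˡ f refl) (elem-index x)))
                   in (≅-trans f (≅-sym size) , proper⇒chains (≅-trans f (≅-sym size)) κ proper e′) , e′)
      (λ e i → cong elem (e i))
      (λ e i → elem-injective (e i))
      (λ (f , _) i → elem-index _)

-- Evaluation of induced sign characters

sum-homomorphism : ∀ (M N : CommutativeMonoid 0ℓ 0ℓ) (h : CommutativeMonoid.Carrier M → CommutativeMonoid.Carrier N) →
  let module M = CommutativeMonoid M ; module N = CommutativeMonoid N in
  h M.ε N.≈ N.ε → (∀ x y → h (x M.∙ y) N.≈ (h x N.∙ h y)) →
  ∀ {n} (f : Fin n → M.Carrier) → h (Sum.sum M f) N.≈ Sum.sum N (h ∘ f)
sum-homomorphism M N h h-ε h-∙ {zero} f = h-ε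
sum-homomorphism M N h h-ε h-∙ {suc n} f = N.trans (h-∙ _ _) (N.∙-cong N.refl (sum-homomorphism M N h h-ε h-∙ (f ∘ fsuc)))
  where module N = CommutativeMonoid N

module ℚ∑ = PermSum ℚ.+-0-commutativeMonoid

ι : ℤ → ℚ
ι i = i / 1

toℚᵘ-/ : ∀ i m .{{_ : NonZero m}} → ℚ.toℚᵘ (i / m) ℚᵘ.≃ i ℚᵘ./ m
toℚᵘ-/ i (suc m) = ℚ.toℚᵘ-fromℚᵘ (ℚᵘ.mkℚᵘ i m)

/-*-/ : ∀ i m j n .{{_ : NonZero m}} .{{_ : NonZero n}} .{{_ : NonZero (m ℕ.* n)}} →
  (i / m) ℚ.* (j / n) ≡ (i ℤ.* j) / (m ℕ.* n)
/-*-/ i m@(suc _) j n@(suc _) = ℚ.toℚᵘ-injective (ℚᵘ.≃-trans (ℚ.toℚᵘ-homo-* (i / m) (j / n))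
  (ℚᵘ.≃-trans (ℚᵘ.*-cong (toℚᵘ-/ i m) (toℚᵘ-/ j n)) (ℚᵘ.≃-sym (toℚᵘ-/ (i ℤ.* j) (m ℕ.* n)))))

/-≡ : ∀ {i m j n} .{{_ : NonZero m}} .{{_ : NonZero n}} → i ℤ.* + n ≡ j ℤ.* + m → i / m ≡ j / n
/-≡ {i} {m@(suc _)} {j} {n@(suc _)} e = ℚ.fromℚᵘ-cong {ℚᵘ.mkℚᵘ i _} {ℚᵘ.mkℚᵘ j _} (ℚᵘ.*≡* e)

ι-+ : ∀ i j → ι (i ℤ.+ j) ≡ ι i ℚ.+ ι j
ι-+ i j = sym (ℚ.toℚᵘ-injective (ℚᵘ.≃-trans (ℚ.toℚᵘ-homo-+ (ι i) (ι j))
  (ℚᵘ.≃-trans (ℚᵘ.+-cong (toℚᵘ-/ i 1) (toℚᵘ-/ j 1))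
  (ℚᵘ.≃-trans (ℚᵘ.*≡* (cong (ℤ._* 1ℤ) (cong₂ ℤ._+_ (ℤ.*-identityʳ i) (ℤ.*-identityʳ j)))) (ℚᵘ.≃-sym (toℚᵘ-/ (i ℤ.+ j) 1))))))

ι-* : ∀ i j → ι (i ℤ.* j) ≡ ι i ℚ.* ι j
ι-* i j = sym (/-*-/ i 1 j 1)

ι-∑ : ∀ {n} (f : Permutation′ n → ℤ) → ι (ℤ∑.∑ₚ f) ≡ ℚ∑.∑ₚ (ι ∘ f)
ι-∑ {n} f = sum-homomorphism ℤ.+-0-commutativeMonoid ℚ.+-0-commutativeMonoid ι refl ι-+ (f ∘ Inverse.to (size-Perms n))

∑-*ˡ : ∀ {n} c (f : Permutation′ n → ℚ) → c ℚ.* ℚ∑.∑ₚ f ≡ ℚ∑.∑ₚ (λ w → c ℚ.* f w)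
∑-*ˡ {n} c f = sum-homomorphism ℚ.+-0-commutativeMonoid ℚ.+-0-commutativeMonoid (c ℚ.*_) (ℚ.*-zeroʳ c) (ℚ.*-distribˡ-+ c) (f ∘ Inverse.to (size-Perms n))

∑ᶻ-*ʳ : ∀ {n} c (f : Permutation′ n → ℤ) → ℤ∑.∑ₚ f ℤ.* c ≡ ℤ∑.∑ₚ (λ w → f w ℤ.* c)
∑ᶻ-*ʳ {n} c f = sum-homomorphism ℤ.+-0-commutativeMonoid ℤ.+-0-commutativeMonoid (ℤ._* c) (ℤ.*-zeroˡ c) (λ x y → ℤ.*-distribʳ-+ c x y) (f ∘ Inverse.to (size-Perms n))

+-∑ : ∀ {n} (f : Fin n → ℕ) → + (∑ᴺ f) ≡ ℤ∑.Tab.sum (+_ ∘ f)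
+-∑ = sum-homomorphism ℕ.+-0-commutativeMonoid ℤ.+-0-commutativeMonoid +_ refl (λ _ _ → refl)

conjugate : ∀ {n} → Permutation′ n → Perms n ≅ Perms n
conjugate {n} g = injection+section {Perms n} {Perms n} (λ v → flip g ∘ₚ v ∘ₚ g) (λ w → g ∘ₚ w ∘ₚ flip g)
  (λ e i → cong (g ⟨$⟩ʳ_) (e (g ⟨$⟩ˡ i)))
  (λ {v} {w} e i → trans (cong (v ⟨$⟩ʳ_) (sym (inverseˡₚ g))) (trans (⟨$⟩ʳ-injective g (e (g ⟨$⟩ʳ i))) (cong (w ⟨$⟩ʳ_) (inverseˡₚ g))))
  (λ w i → trans (inverseʳₚ g) (cong (w ⟨$⟩ʳ_) (inverseʳₚ g)))

sign° : ∀ {n} → Partition n → Permutation′ n → ℤ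
sign° mu v = if does (inYoung? mu v) then sign v else 0ℤ

-- The sum in Frobenius' formula before division by the order of the Young subgroup, kept in ℤ so
-- that the sign cancellation takes place among integers.
numerator : ∀ {n} → Partition n → Permutation′ n → ℤ
numerator mu w = ℤ∑.∑ₚ λ g → sign° mu (g ∘ₚ w ∘ₚ flip g)

inYoung-resp : ∀ {n} (mu : Partition n) {v w : Permutation′ n} → v Perm.≈ w → InYoung mu v → InYoung mu w
inYoung-resp mu e p i = trans (cong (λ j → segment (parts mu) (toℕ j)) (sym (e i))) (p i)

sign°-cong : ∀ {n} (mu : Partition n) {v w : Permutation′ n} → v Perm.≈ w → sign° mu v ≡ sign° mu w
sign°-cong mu {v} {w} e = cong₂ (λ b s → if b then s else 0ℤ)
  (does-⇔ (mk⇔ (inYoung-resp mu {v} {w} e) (inYoung-resp mu {w} {v} (sym ∘ e))) (inYoung? mu v) (inYoung? mu w))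
  (sign-cong v w e)

ε-numerator : ∀ {n} (mu : Partition n) (w : Permutation′ n) →
  ε mu w ≡ ι (numerator mu w) ℚ.* (_/_ 1ℤ (youngOrder mu) {{youngOrder≢0 mu}})
ε-numerator {n} mu w = trans (ℚ./-cong {q₁ = youngOrder mu} {q₂ = youngOrder mu} (ℤ∑.listSum-allPermutations n) refl)
  (sym (trans (/-*-/ (numerator mu w) 1 1ℤ (youngOrder mu)) (ℚ./-cong {p₁ = numerator mu w ℤ.* 1ℤ} {q₁ = 1 ℕ.* youngOrder mu} {p₂ = numerator mu w} {q₂ = youngOrder mu} (ℤ.*-identityʳ _) (ℕ.*-identityˡ _))))
  where
  instance
    y≢0 : NonZero (youngOrder mu)
    y≢0 = youngOrder≢0 mu
    1y≢0 : NonZero (1 ℕ.* youngOrder mu)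
    1y≢0 = ℕ.m*n≢0 1 (youngOrder mu)

module Evaluation {n} (P : FinitePoset n) where
  open PosetFacts P

  NoDrop : Permutation′ n → Set
  NoDrop w = ∀ i → ¬ elem (w ⟨$⟩ʳ i) < elem i

  noDrop? : ∀ w → Dec (NoDrop w)
  noDrop? w = Fin.all? λ i → ¬? (elem (w ⟨$⟩ʳ i) <? elem i)

  noDrop-resp : ∀ {v w} → v Perm.≈ w → NoDrop v → NoDrop w
  noDrop-resp e d i = d i ∘ subst (λ j → elem j < elem i) (sym (e i))

  free : Permutation′ n → ℤ
  free w = indicatorᶻ (noDrop? w)

  free-cong : ∀ {v w} → v Perm.≈ w → free v ≡ free w
  free-cong {v} {w} e = cong (λ b → if b then 1ℤ else 0ℤ) (does-⇔ (mk⇔ (noDrop-resp {v} {w} e) (noDrop-resp {w} {v} (sym ∘ e))) (noDrop? v) (noDrop? w))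

  evaluate : (Permutation′ n → ℚ) → ℚ
  evaluate θ = ℚ∑.∑ₚ λ w → θ w ℚ.* ι (free w)

  evaluate-cong : ∀ {θ φ} → (∀ w → θ w ≡ φ w) → evaluate θ ≡ evaluate φ
  evaluate-cong e = ℚ∑.∑ₚ-cong λ w → cong (ℚ._* ι (free w)) (e w)

  evaluate-linear : ∀ a → evaluate (λ w → linear (λ mu → ε mu w) a) ≡ linear (λ mu → evaluate (ε mu)) a
  evaluate-linear [] = ℚ∑.∑ₚ-ε λ w → ℚ.*-zeroˡ (ι (free w))
  evaluate-linear ((q , mu) ∷ a) = begin
    evaluate (λ w → q ℚ.* ε mu w ℚ.+ linear (λ mu → ε mu w) a)
      ≡⟨ ℚ∑.∑ₚ-cong (λ w → trans (ℚ.*-distribʳ-+ (ι (free w)) (q ℚ.* ε mu w) (linear (λ mu → ε mu w) a))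
           (cong (ℚ._+ linear (λ mu → ε mu w) a ℚ.* ι (free w)) (ℚ.*-assoc q (ε mu w) (ι (free w))))) ⟩
    ℚ∑.∑ₚ (λ w → q ℚ.* (ε mu w ℚ.* ι (free w)) ℚ.+ linear (λ mu → ε mu w) a ℚ.* ι (free w))
      ≡⟨ ℚ∑.∑-∙ {Perms n} (size-Perms n) (λ w → q ℚ.* (ε mu w ℚ.* ι (free w))) (λ w → linear (λ mu → ε mu w) a ℚ.* ι (free w)) ⟩
    ℚ∑.∑ₚ (λ w → q ℚ.* (ε mu w ℚ.* ι (free w))) ℚ.+ evaluate (λ w → linear (λ mu → ε mu w) a)
      ≡⟨ cong₂ ℚ._+_ (sym (∑-*ˡ q (λ w → ε mu w ℚ.* ι (free w)))) (evaluate-linear a) ⟩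
    q ℚ.* evaluate (ε mu) ℚ.+ linear (λ mu → evaluate (ε mu)) a ∎
    where open ≡-Reasoning

  module _ (mu : Partition n) where
    open Colourings P mu

    -- After conjugating by g, the inner sum counts drop-free permutations preserving the segments, with signs,
    -- for the arrangement g of the poset.
    sum-numerator : ℤ∑.∑ₚ (λ w → numerator mu w ℤ.* free w) ≡ + (count ℕ.* youngOrder mu)
    sum-numerator = begin
      ℤ∑.∑ₚ (λ w → numerator mu w ℤ.* free w)
        ≡⟨ ℤ∑.∑ₚ-cong (λ w → ∑ᶻ-*ʳ (free w) (λ g → sign° mu (g ∘ₚ w ∘ₚ flip g))) ⟩
      ℤ∑.∑ₚ (λ w → ℤ∑.∑ₚ (λ g → sign° mu (g ∘ₚ w ∘ₚ flip g) ℤ.* free w))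
        ≡⟨ ℤ∑.∑-swap {Perms n} {Perms n} (size-Perms n) (size-Perms n) (λ w g → sign° mu (g ∘ₚ w ∘ₚ flip g) ℤ.* free w) ⟩
      ℤ∑.∑ₚ (λ g → ℤ∑.∑ₚ (λ w → sign° mu (g ∘ₚ w ∘ₚ flip g) ℤ.* free w))
        ≡⟨ ℤ∑.∑ₚ-cong inner ⟩
      ℤ∑.∑ₚ (λ g → indicatorᶻ (Arr.noClash? g))
        ≡⟨ ℤ∑.∑ₚ-cong (λ g → as-ℕ (Arr.noClash? g)) ⟩
      ℤ∑.∑ₚ (λ g → + [ Arr.noClash? g ]?)
        ≡⟨ sym (+-∑ (λ i → [ Arr.noClash? (Inverse.to (size-Perms n) i) ]?)) ⟩
      + (∑ᴺ (λ i → [ Arr.noClash? (Inverse.to (size-Perms n) i) ]?))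
        ≡⟨ cong +_ (size-unique (size-such-that {Perms n} (size-Perms n) (λ {g} {h} → chains-resp {g} {h}) Arr.noClash?) size-chains) ⟩
      + (count ℕ.* youngOrder mu) ∎
      where
      open ≡-Reasoning
      as-ℕ : ∀ {A : Set} (d : Dec A) → indicatorᶻ d ≡ + [ d ]?
      as-ℕ (yes _) = refl
      as-ℕ (no _) = refl
      term : Permutation′ n → Permutation′ n → ℤ
      term g w = sign° mu (g ∘ₚ w ∘ₚ flip g) ℤ.* free w
      relabel : ∀ g v → free (flip g ∘ₚ v ∘ₚ g) ≡ indicatorᶻ (Arr.noDrop? g v)
      relabel g v = cong (λ b → if b then 1ℤ else 0ℤ) (does-⇔ (mk⇔
        (λ d i → subst (λ j → ¬ elem (g ⟨$⟩ʳ (v ⟨$⟩ʳ j)) < elem (g ⟨$⟩ʳ i)) (inverseˡₚ g) (d (g ⟨$⟩ʳ i)))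
        (λ d i → subst (λ j → ¬ elem (g ⟨$⟩ʳ (v ⟨$⟩ʳ (g ⟨$⟩ˡ i))) < elem j) (inverseʳₚ g) (d (g ⟨$⟩ˡ i))))
        (noDrop? (flip g ∘ₚ v ∘ₚ g)) (Arr.noDrop? g v))
      inner : ∀ g → ℤ∑.∑ₚ (term g) ≡ indicatorᶻ (Arr.noClash? g)
      inner g = begin
        ℤ∑.∑ₚ (term g)
          ≡⟨ sym (ℤ∑.∑ₚ-reindex (conjugate g) {term g} (λ {v} {w} e →
               cong₂ ℤ._*_ (sign°-cong mu {g ∘ₚ v ∘ₚ flip g} {g ∘ₚ w ∘ₚ flip g} (λ i → cong (g ⟨$⟩ˡ_) (e (g ⟨$⟩ʳ i)))) (free-cong {v} {w} e))) ⟩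
        ℤ∑.∑ₚ (λ v → term g (flip g ∘ₚ v ∘ₚ g))
          ≡⟨ ℤ∑.∑ₚ-cong (λ v → cong₂ ℤ._*_
               (sign°-cong mu {g ∘ₚ (flip g ∘ₚ v ∘ₚ g) ∘ₚ flip g} {v} (λ i → trans (inverseˡₚ g) (cong (v ⟨$⟩ʳ_) (inverseˡₚ g)))) (relabel g v)) ⟩
        ℤ∑.∑ₚ (λ v → Arr.signed g (inYoung? mu) v ℤ.* indicatorᶻ (Arr.noDrop? g v))
          ≡⟨ Arr.signed-sum g (inYoung? mu) (Arr.noClash? g) ⟩
        indicatorᶻ (Arr.noClash? g) ∎

    -- The factor `youngOrder mu`, which `sum-numerator` collects from the arrangements of each
    -- colouring, cancels against the denominator in Frobenius' formula.
    evaluate-ε : evaluate (ε mu) ≡ + count / 1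
    evaluate-ε = begin
      evaluate (ε mu)
        ≡⟨ ℚ∑.∑ₚ-cong pull ⟩
      ℚ∑.∑ₚ (λ w → r ℚ.* ι (numerator mu w ℤ.* free w))
        ≡⟨ sym (∑-*ˡ r (λ w → ι (numerator mu w ℤ.* free w))) ⟩
      r ℚ.* ℚ∑.∑ₚ (λ w → ι (numerator mu w ℤ.* free w))
        ≡⟨ cong (r ℚ.*_) (trans (sym (ι-∑ (λ w → numerator mu w ℤ.* free w))) (cong ι sum-numerator)) ⟩
      r ℚ.* ι (+ (count ℕ.* youngOrder mu))
        ≡⟨ /-*-/ 1ℤ (youngOrder mu) (+ (count ℕ.* youngOrder mu)) 1 ⟩
      (1ℤ ℤ.* + (count ℕ.* youngOrder mu)) / (youngOrder mu ℕ.* 1)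
        ≡⟨ /-≡ {1ℤ ℤ.* + (count ℕ.* youngOrder mu)} {youngOrder mu ℕ.* 1} {+ count} {1} (trans (ℤ.*-identityʳ (1ℤ ℤ.* + (count ℕ.* youngOrder mu))) (trans (ℤ.*-identityˡ (+ (count ℕ.* youngOrder mu))) (trans (ℤ.pos-* count (youngOrder mu)) (cong (λ y → + count ℤ.* + y) (sym (ℕ.*-identityʳ (youngOrder mu))))))) ⟩
      + count / 1 ∎
      where
      open ≡-Reasoning
      instance
        y≢0 : NonZero (youngOrder mu)
        y≢0 = youngOrder≢0 mu
        y1≢0 : NonZero (youngOrder mu ℕ.* 1)
        y1≢0 = ℕ.m*n≢0 (youngOrder mu) 1
      r = 1ℤ / youngOrder mu
      pull : ∀ w → ε mu w ℚ.* ι (free w) ≡ r ℚ.* ι (numerator mu w ℤ.* free w)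
      pull w = begin
        ε mu w ℚ.* ι (free w)                     ≡⟨ cong (ℚ._* ι (free w)) (trans (ε-numerator mu w) (ℚ.*-comm (ι (numerator mu w)) r)) ⟩
        r ℚ.* ι (numerator mu w) ℚ.* ι (free w)   ≡⟨ ℚ.*-assoc r (ι (numerator mu w)) (ι (free w)) ⟩
        r ℚ.* (ι (numerator mu w) ℚ.* ι (free w)) ≡⟨ cong (r ℚ.*_) (sym (ι-* (numerator mu w) (free w))) ⟩
        r ℚ.* ι (numerator mu w ℤ.* free w) ∎

  linear-cong : ∀ {f g : Partition n → ℚ} → (∀ mu → f mu ≡ g mu) → ∀ a → linear f a ≡ linear g a
  linear-cong e [] = refl
  linear-cong e ((q , mu) ∷ a) = cong₂ ℚ._+_ (cong (q ℚ.*_) (e mu)) (linear-cong e a)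

  -- The right-hand side does not mention the expansion, so all expansions of `θ` give the same
  -- value.
  evaluation-unique : ∀ {θ} a → a IsExpansionOf θ → linear (λ mu → + Colourings.count P mu / 1) a ≡ evaluate θ
  evaluation-unique a e = trans (sym (linear-cong evaluate-ε a)) (trans (sym (evaluate-linear a)) (sym (evaluate-cong e)))

-- Cycles of a permutation

lookup-injective : ∀ {A : Set} {l : List A} → Unique l → ∀ i j → lookup l i ≡ lookup l j → i ≡ j
lookup-injective (_ ∷ _) fzero fzero e = refl
lookup-injective (x∉ ∷ u) fzero (fsuc j) e = contradiction e (All.lookup x∉ (∈-lookup j))
lookup-injective (x∉ ∷ u) (fsuc i) fzero e = contradiction (sym e) (All.lookup x∉ (∈-lookup i))
lookup-injective (_ ∷ u) (fsuc i) (fsuc j) e = cong fsuc (lookup-injective u i j e)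

size-list : ∀ {A : Set} {P : A → Set} (l : List A) → Unique l → (∀ {x} → x ∈ₗ l → P x) → (∀ {x} → P x → x ∈ₗ l) →
  HasSize (setoid A such-that P) (length l)
size-list {A} {P} l u sound complete = injection+section {setoid (Fin (length l))} {setoid A such-that P}
  (λ i → lookup l i , sound (∈-lookup i)) (λ (x , p) → Any.index (complete p))
  (λ { refl → refl }) (λ {i} {j} e → lookup-injective u i j e) (λ (x , p) → sym (lookup-index (complete p)))

size-filter : ∀ {n} {P : Fin n → Set} (P? : ∀ i → Dec (P i)) →
  HasSize (setoid (Fin n) such-that P) (length (filter P? (allFin n)))
size-filter {n} P? = size-list (filter P? (allFin n)) (Unique.filter⁺ P? (Unique.allFin⁺ n))
  (λ x∈ → proj₂ (∈-filter⁻ P? {xs = allFin n} x∈)) (λ {x} p → ∈-filter⁺ P? (∈-allFin x) p)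

multiplicity-map : {A : Set} (k : ℕ) (f : A → ℕ) (l : List A) →
  multiplicity k (map f l) ≡ length (filter (λ x → k ℕ.≟ f x) l)
multiplicity-map k f [] = refl
multiplicity-map k f (x ∷ l) with does (k ℕ.≟ f x)
... | true = cong suc (multiplicity-map k f l)
... | false = multiplicity-map k f l

size-multiplicity : ∀ {A : Set} {P : A → Set} (l : List A) → Unique l → (∀ {x} → x ∈ₗ l → P x) → (∀ {x} → P x → x ∈ₗ l) →
  (f : A → ℕ) (k : ℕ) → HasSize (setoid A such-that λ x → P x × f x ≡ k) (multiplicity k (map f l))
size-multiplicity l u sound complete f k = ≡-size {setoid _ such-that _} (sym (multiplicity-map k f l))
  (size-list (filter (λ x → k ℕ.≟ f x) l) (Unique.filter⁺ (λ x → k ℕ.≟ f x) u)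
    (λ x∈ → let (a , b) = ∈-filter⁻ (λ x → k ℕ.≟ f x) {xs = l} x∈ in sound a , sym b)
    (λ (p , e) → ∈-filter⁺ (λ x → k ℕ.≟ f x) (complete p) (sym e)))

size-parts : ∀ (xs : List ℕ) k → HasSize (setoid (Fin (length xs)) such-that λ i → lookup xs i ≡ k) (multiplicity k xs)
size-parts xs k = ≡-size {setoid (Fin (length xs)) such-that λ i → lookup xs i ≡ k}
  (cong (multiplicity k) (trans (List.map-tabulate id (lookup xs)) (List.tabulate-lookup xs)))
  (size-≅ (such-that-⇔ {setoid (Fin (length xs))} (λ _ → proj₂) (λ _ p → tt , p))
    (size-multiplicity {P = λ _ → ⊤} (allFin (length xs)) (Unique.allFin⁺ (length xs)) (λ _ → tt) (λ {i} _ → ∈-allFin i) (lookup xs) k))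

iterate-suc : {A : Set} (f : A → A) (x : A) (k : ℕ) → iterate f x (suc k) ≡ f (iterate f x k)
iterate-suc f x zero = refl
iterate-suc f x (suc k) = iterate-suc f (f x) k

iterate-+ : {A : Set} (f : A → A) (x : A) (a b : ℕ) → iterate f x (a ℕ.+ b) ≡ iterate f (iterate f x a) b
iterate-+ f x zero b = refl
iterate-+ f x (suc a) b = iterate-+ f (f x) a b

module Cycles {n} (w : Permutation′ n) where

  pow : Fin n → ℕ → Fin n
  pow = iterate (w ⟨$⟩ʳ_)

  pow-injective : ∀ k {x y} → pow x k ≡ pow y k → x ≡ y
  pow-injective zero e = e
  pow-injective (suc k) e = ⟨$⟩ʳ-injective w (pow-injective k e)

  pow-cancel : ∀ {x a b} → a ℕ.≤ b → pow x a ≡ pow x b → pow x (b ∸ a) ≡ x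
  pow-cancel {x} {a} {b} a≤b e = pow-injective a (trans (sym (iterate-+ (w ⟨$⟩ʳ_) x (b ∸ a) a)) (trans (cong (pow x) (ℕ.m∸n+n≡m a≤b)) (sym e)))

  -- Among the powers with exponents 0 to `n` two agree at `x`, and cancelling the smaller exponent
  -- leaves a positive one, at most `n`.
  returns : ∀ x → ∃[ k ] pow x (suc (toℕ {n} k)) ≡ x
  returns x with i , j , i<j , e ← Fin.pigeonhole (ℕ.n<1+n n) (λ (i : Fin (suc n)) → pow x (toℕ i))
    with toℕ j ∸ toℕ i in eq | pow-cancel {x} {toℕ i} {toℕ j} (ℕ.<⇒≤ i<j) e
  ... | zero | _ = contradiction (ℕ.m∸n≡0⇒m≤n eq) (ℕ.<⇒≱ i<j)
  ... | suc d | r = fromℕ< d<n , trans (cong (pow x ∘ suc) (Fin.toℕ-fromℕ< d<n)) r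
    where
    d<n : d ℕ.< n
    d<n = ℕ.≤-trans (ℕ.≤-reflexive (sym eq)) (ℕ.≤-trans (ℕ.m∸n≤m (toℕ j) (toℕ i)) (ℕ.s≤s⁻¹ (Fin.toℕ<n j)))

  first-return : ∀ x → ∃[ k ] pow x (suc (toℕ {n} k)) ≡ x × (∀ (j : Fin n) → j Fin.< k → ¬ pow x (suc (toℕ j)) ≡ x)
  first-return x = minimal FinInd.<-wellFounded Fin._<?_ (λ k → pow x (suc (toℕ k)) Fin.≟ x) (returns x)

  period : Fin n → ℕ
  period x = suc (toℕ (proj₁ (first-return x)))

  period≤n : ∀ x → period x ℕ.≤ n
  period≤n x = Fin.toℕ<n (proj₁ (first-return x))

  pow-period : ∀ x → pow x (period x) ≡ x
  pow-period x = proj₁ (proj₂ (first-return x))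

  pow-distinct : ∀ x {a b} → a ℕ.< b → b ℕ.< period x → pow x a ≢ pow x b
  pow-distinct x {a} {b} a<b b<p e with b ∸ a in eq | pow-cancel {x} (ℕ.<⇒≤ a<b) e
  ... | zero | _ = contradiction (ℕ.m∸n≡0⇒m≤n eq) (ℕ.<⇒≱ a<b)
  ... | suc d | r = proj₂ (proj₂ (first-return x)) (fromℕ< d<n)
      (subst (ℕ._< toℕ (proj₁ (first-return x))) (sym (Fin.toℕ-fromℕ< d<n)) d<k)
      (trans (cong (pow x ∘ suc) (Fin.toℕ-fromℕ< d<n)) r)
    where
    d<k : d ℕ.< toℕ (proj₁ (first-return x))
    d<k = ℕ.≤-trans (ℕ.≤-reflexive (sym eq)) (ℕ.≤-trans (ℕ.m∸n≤m b a) (ℕ.s≤s⁻¹ b<p))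
    d<n : d ℕ.< n
    d<n = ℕ.<-trans d<k (Fin.toℕ<n _)

  pow-injectiveʳ : ∀ x {a b} → a ℕ.< period x → b ℕ.< period x → pow x a ≡ pow x b → a ≡ b
  pow-injectiveʳ x {a} {b} a< b< e with ℕ.<-cmp a b
  ... | tri≈ _ q _ = q
  ... | tri< a<b _ _ = contradiction e (pow-distinct x a<b b<)
  ... | tri> _ _ b<a = contradiction (sym e) (pow-distinct x b<a a<)

  reduce : ∀ x k → ∃[ j ] j ℕ.< period x × pow x j ≡ pow x k
  reduce x zero = 0 , s≤s z≤n , refl
  reduce x (suc k) with reduce x k
  ... | j , j<p , e with suc j ℕ.≟ period x
  ... | yes q = 0 , s≤s z≤n , trans (sym (pow-period x)) (trans (cong (pow x) (sym q)) step)
    where step = trans (iterate-suc (w ⟨$⟩ʳ_) x j) (trans (cong (w ⟨$⟩ʳ_) e) (sym (iterate-suc (w ⟨$⟩ʳ_) x k)))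
  ... | no ¬q = suc j , ℕ.≤∧≢⇒< j<p ¬q , trans (iterate-suc (w ⟨$⟩ʳ_) x j) (trans (cong (w ⟨$⟩ʳ_) e) (sym (iterate-suc (w ⟨$⟩ʳ_) x k)))

  infix 4 _∼_
  _∼_ : Rel (Fin n) 0ℓ
  _∼_ = SameCycle w

  -- `SameCycle` admits only exponents below `n`; reduction modulo the period brings any exponent
  -- into that range.
  reach : ∀ x {y} k → pow x k ≡ y → x ∼ y
  reach x k e with j , j<p , q ← reduce x k = fromℕ< j<n , trans (cong (pow x) (Fin.toℕ-fromℕ< j<n)) (trans q e)
    where j<n = ℕ.≤-trans j<p (period≤n x)

  ∼-refl : ∀ {x} → x ∼ x
  ∼-refl {x} = reach x 0 refl

  ∼-trans : ∀ {x y z} → x ∼ y → y ∼ z → x ∼ z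
  ∼-trans {x} (k , refl) (l , refl) = reach x (toℕ k ℕ.+ toℕ l) (iterate-+ (w ⟨$⟩ʳ_) x (toℕ k) (toℕ l))

  ∼-sym : ∀ {x y} → x ∼ y → y ∼ x
  ∼-sym {x} (k , refl) with j , j<p , e ← reduce x (toℕ k) =
    reach _ (period x ∸ j) (trans (cong (λ y → pow y (period x ∸ j)) (sym e))
      (trans (sym (iterate-+ (w ⟨$⟩ʳ_) x j (period x ∸ j))) (trans (cong (pow x) (ℕ.m+[n∸m]≡n (ℕ.<⇒≤ j<p))) (pow-period x))))

  size-cycle : ∀ x → HasSize (setoid (Fin n) such-that λ y → x ∼ y) (period x)
  size-cycle x = injection+section {setoid (Fin (period x))} {setoid (Fin n) such-that λ y → x ∼ y}
    (λ j → pow x (toℕ j) , reach x (toℕ j) refl)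
    (λ (y , k , _) → fromℕ< (proj₁ (proj₂ (reduce x (toℕ k)))))
    (λ { refl → refl })
    (λ {i} {j} e → Fin.toℕ-injective (pow-injectiveʳ x (Fin.toℕ<n i) (Fin.toℕ<n j) e))
    (λ { (y , k , refl) → trans (cong (pow x) (Fin.toℕ-fromℕ< (proj₁ (proj₂ (reduce x (toℕ k)))))) (proj₂ (proj₂ (reduce x (toℕ k)))) })

  cycleSize : Fin n → ℕ
  cycleSize x = length (filter (sameCycle? w x) (allFin n))

  cycleSize-period : ∀ x → cycleSize x ≡ period x
  cycleSize-period x = size-unique (size-filter (sameCycle? w x)) (size-cycle x)

  size-cycle′ : ∀ x → HasSize (setoid (Fin n) such-that λ y → x ∼ y) (cycleSize x)
  size-cycle′ x = size-filter (sameCycle? w x)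

  cycleSize-cong : ∀ {x y} → x ∼ y → cycleSize x ≡ cycleSize y
  cycleSize-cong {x} {y} x∼y = size-unique (size-cycle′ x)
    (size-≅ (such-that-⇔ (λ _ → ∼-trans x∼y) (λ _ → ∼-trans (∼-sym x∼y))) (size-cycle′ y))

  Least : Fin n → Set
  Least i = ∀ j → i ∼ j → i Fin.≤ j

  least? : ∀ i → Dec (Least i)
  least? i = Fin.all? (λ j → sameCycle? w i j →-dec (i Fin.≤? j))

  least-unique : ∀ {x y} → Least x → Least y → x ∼ y → x ≡ y
  least-unique lx ly x∼y = Fin.≤-antisym (lx _ x∼y) (ly _ (∼-sym x∼y))

  representative : ∀ x → ∃[ r ] x ∼ r × Least r
  representative x = least (minimal FinInd.<-wellFounded Fin._<?_ (sameCycle? w x) (x , ∼-refl))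
    where
    least : ∃[ r ] x ∼ r × (∀ y → y Fin.< r → ¬ x ∼ y) → ∃[ r ] x ∼ r × Least r
    least (r , x∼r , m) = r , x∼r , λ j r∼j → ℕ.≮⇒≥ λ j<r → m j j<r (∼-trans x∼r r∼j)

  Reps : Setoid 0ℓ 0ℓ
  Reps = setoid (Fin n) such-that Least

  rep : Fin n → ∣ Reps ∣ₛ
  rep x = let (r , _ , l) = representative x in r , l

  rep-∼ : ∀ x → x ∼ proj₁ (rep x)
  rep-∼ x = proj₁ (proj₂ (representative x))

  rep-≡ : ∀ {x y} → x ∼ y → proj₁ (rep x) ≡ proj₁ (rep y)
  rep-≡ {x} {y} e = least-unique (proj₂ (rep x)) (proj₂ (rep y)) (∼-trans (∼-sym (rep-∼ x)) (∼-trans e (rep-∼ y)))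

  reps : List (Fin n)
  reps = filter least? (allFin n)

  size-Reps : HasSize Reps (length reps)
  size-Reps = size-filter least?

  size-rep-fibre : ∀ (r : ∣ Reps ∣ₛ) → HasSize (setoid (Fin n) such-that λ x → proj₁ (rep x) ≡ proj₁ r) (cycleSize (proj₁ r))
  size-rep-fibre (r , l) = size-≅ (such-that-⇔
    (λ x r∼x → least-unique (proj₂ (rep x)) l (∼-sym (∼-trans r∼x (rep-∼ x))))
    (λ x e → ∼-sym (subst (x ∼_) e (rep-∼ x)))) (size-cycle′ r)

  -- The fibres of `rep` are the cycles, so counting `Fin n` by fibres adds up their lengths.
  sum-cycleLengths : Data.Nat.ListAction.sum (cycleLengths w) ≡ n
  sum-cycleLengths = trans (trans (sym (∑-lookup (cycleLengths w))) (tab reps))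
    (size-unique (size-fibres {Reps} {setoid (Fin n)} rep (λ { refl → refl }) size-Reps (cycleSize ∘ proj₁) size-rep-fibre) ≅-refl)
    where
    tab : ∀ l → ∑ᴺ (lookup (map cycleSize l)) ≡ ∑ᴺ (cycleSize ∘ lookup l)
    tab [] = refl
    tab (x ∷ l) = cong (cycleSize x ℕ.+_) (tab l)

  size-cycles-of-length : ∀ k → HasSize (setoid (Fin n) such-that λ r → Least r × cycleSize r ≡ k) (multiplicity k (cycleLengths w))
  size-cycles-of-length = size-multiplicity reps (Unique.filter⁺ least? (Unique.allFin⁺ n))
    (λ x∈ → proj₂ (∈-filter⁻ least? {xs = allFin n} x∈)) (λ {x} p → ∈-filter⁺ least? (∈-allFin x) p) cycleSize

  cycleLengths-positive : All NonZero (cycleLengths w)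
  cycleLengths-positive = AllP.map⁺ (All.universal (λ i → subst NonZero (sym (cycleSize-period i)) _) reps)

hasType : ∀ {n} (w : Permutation′ n) → ∃[ lam ] HasCycleType {n} lam w
hasType {n} w = record
  { parts = sort (cycleLengths w)
  ; positive = ↭P.All-resp-↭ (↭-sym (sort-↭ (cycleLengths w))) cycleLengths-positive
  ; decreasing = sort-↗ (cycleLengths w)
  ; total = trans (sum-↭ (sort-↭ (cycleLengths w))) sum-cycleLengths
  } , λ k → ↭P.↭-length (↭P.filter-↭ (toℕ k ℕ.≟_) (↭-sym (sort-↭ (cycleLengths w))))
  where open Cycles w

-- Diagrams and the cycles of a permutation

same-row-≡ : ∀ {m} {k : Fin m → ℕ} {i} {j j′ : Fin (k i)} → _≡_ {A = Σ[ i ∈ Fin m ] Fin (k i)} (i , j) (i , j′) → j ≡ j′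
same-row-≡ refl = refl

Next : ∀ {m} → Fin m → Fin m → Set
Next {m} = Arc (cycleGraph m)

next : ∀ {m} (j : Fin m) → ∃[ j′ ] Next j j′
next {m} j with suc (toℕ j) ℕ.<? m
... | yes p = fromℕ< p , inj₁ (Fin.toℕ-fromℕ< p)
next {suc m} j | no ¬p = fzero , inj₂ (ℕ.≤-antisym (Fin.toℕ<n j) (ℕ.≮⇒≥ ¬p) , refl)

next-functional : ∀ {m} {j a b : Fin m} → Next j a → Next j b → a ≡ b
next-functional (inj₁ p) (inj₁ q) = Fin.toℕ-injective (trans p (sym q))
next-functional (inj₂ (_ , p)) (inj₂ (_ , q)) = Fin.toℕ-injective (trans p (sym q))
next-functional {a = a} (inj₁ p) (inj₂ (q , _)) = contradiction (Fin.toℕ<n a) (ℕ.≤⇒≯ (ℕ.≤-reflexive (sym (trans p q))))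
next-functional {b = b} (inj₂ (q , _)) (inj₁ p) = contradiction (Fin.toℕ<n b) (ℕ.≤⇒≯ (ℕ.≤-reflexive (sym (trans p q))))

module Isomorphisms {n} (lam : Partition n) where
  open Boxes lam

  start : ∀ i → ∃[ j ] toℕ {part lam i} j ≡ 0
  start i = zeroth (All.lookup (positive lam) (∈-lookup i))
    where
    zeroth : ∀ {m} → NonZero m → ∃[ j ] toℕ {m} j ≡ 0
    zeroth {suc m} _ = fzero , refl

  first : ∀ i → Fin (part lam i)
  first i = proj₁ (start i)

  Follows : Permutation′ n → (BoxOf → Fin n) → Set
  Follows w U = ∀ i {j j′} → Next j j′ → U (i , j′) ≡ w ⟨$⟩ʳ U (i , j)

  -- Identifications of the diagram, its rows read cyclically, with the cycles of `w`. There are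
  -- `z lam` of them if `w` has type `lam` and none otherwise (`count-Isos`), which is how `z`
  -- enters the count of tableaux.
  Isos : Permutation′ n → Setoid 0ℓ 0ℓ
  Isos w = (BoxOf →-setoid Fin n) such-that λ U → Bijective _≡_ _≡_ U × Follows w U

  Isos-cong : ∀ {v w} → v Perm.≈ w → ∣ Isos v ∣ₛ → ∣ Isos w ∣ₛ
  Isos-cong e (U , b , f) = U , b , λ i s → trans (f i s) (e _)

  Isos-conj : ∀ {w} (g : Permutation′ n) → ∣ Isos (g ∘ₚ w ∘ₚ flip g) ∣ₛ → ∣ Isos w ∣ₛ
  Isos-conj g (U , (inj , surj) , f) = (λ b → g ⟨$⟩ʳ U b) ,
    ((λ e → inj (⟨$⟩ʳ-injective g e)) , (λ y → let (b , e) = surj (g ⟨$⟩ˡ y) in b , λ { refl → trans (cong (g ⟨$⟩ʳ_) (e refl)) (inverseʳₚ g) })) ,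
    λ i s → trans (cong (g ⟨$⟩ʳ_) (f i s)) (inverseʳₚ g)

  -- Both isomorphisms start from the same diagram, so their quotient conjugates v into w.
  Isos-conjugate : ∀ {v w} → ∣ Isos v ∣ₛ → ∣ Isos w ∣ₛ → ∃[ g ] (g ∘ₚ w ∘ₚ flip g) Perm.≈ v
  Isos-conjugate {v} {w} (U , bU , fU) (U′ , bU′ , fU′) = g , λ x →
      let ((i , j) , e) = surjective bU x
          (j′ , s) = next j
      in begin
        g ⟨$⟩ˡ (w ⟨$⟩ʳ (g ⟨$⟩ʳ x))         ≡⟨ cong (λ x → g ⟨$⟩ˡ (w ⟨$⟩ʳ (g ⟨$⟩ʳ x))) (sym e) ⟩
        g ⟨$⟩ˡ (w ⟨$⟩ʳ (g ⟨$⟩ʳ U (i , j))) ≡⟨ cong (λ x → g ⟨$⟩ˡ (w ⟨$⟩ʳ x)) (g-at (i , j)) ⟩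
        g ⟨$⟩ˡ (w ⟨$⟩ʳ U′ (i , j))         ≡⟨ cong (g ⟨$⟩ˡ_) (sym (fU′ i s)) ⟩
        g ⟨$⟩ˡ U′ (i , j′)                 ≡⟨ cong (g ⟨$⟩ˡ_) (sym (g-at (i , j′))) ⟩
        g ⟨$⟩ˡ (g ⟨$⟩ʳ U (i , j′))         ≡⟨ inverseˡₚ g ⟩
        U (i , j′)                         ≡⟨ fU i s ⟩
        v ⟨$⟩ʳ U (i , j)                   ≡⟨ cong (v ⟨$⟩ʳ_) e ⟩
        v ⟨$⟩ʳ x ∎
    where
    open ≡-Reasoning
    surjective : ∀ {A : Set} {f : A → Fin n} → Bijective _≡_ _≡_ f → ∀ y → ∃[ x ] f x ≡ y
    surjective (_ , s) y = proj₁ (s y) , proj₂ (s y) refl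
    g : Permutation′ n
    g = permutation (λ x → U′ (proj₁ (surjective bU x))) (λ x → U (proj₁ (surjective bU′ x)))
      (λ y → trans (cong U′ (proj₁ bU (proj₂ (surjective bU (U (proj₁ (surjective bU′ y))))))) (proj₂ (surjective bU′ y)))
      (λ y → trans (cong U (proj₁ bU′ (proj₂ (surjective bU′ (U′ (proj₁ (surjective bU y))))))) (proj₂ (surjective bU y)))
    g-at : ∀ b → g ⟨$⟩ʳ U b ≡ U′ b
    g-at b = cong U′ (proj₁ bU (proj₂ (surjective bU (U b))))

  module _ (w : Permutation′ n) where
    open Cycles w

    follows-pow : ∀ {U} → Follows w U → ∀ i k {j} → toℕ j ≡ k → U (i , j) ≡ pow (U (i , first i)) k
    follows-pow {U} f i zero e = cong (λ j → U (i , j)) (Fin.toℕ-injective (trans e (sym (proj₂ (start i)))))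
    follows-pow {U} f i (suc k) {j} e =
      trans (f i {fromℕ< k<} {j} (inj₁ (trans e (cong suc (sym (Fin.toℕ-fromℕ< k<))))))
      (trans (cong (w ⟨$⟩ʳ_) (follows-pow f i k (Fin.toℕ-fromℕ< k<))) (sym (iterate-suc (w ⟨$⟩ʳ_) (U (i , first i)) k)))
      where
      k< : k ℕ.< part lam i
      k< = ℕ.<-trans (ℕ.≤-reflexive (sym e)) (Fin.toℕ<n j)

    pow-in-row : ∀ {U} → Follows w U → ∀ i k → ∃[ j ] U (i , j) ≡ pow (U (i , first i)) k
    pow-in-row f i zero = first i , refl
    pow-in-row {U} f i (suc k) = let (j , e) = pow-in-row f i k ; (j′ , s) = next j in
      j′ , trans (f i s) (trans (cong (w ⟨$⟩ʳ_) e) (sym (iterate-suc (w ⟨$⟩ʳ_) (U (i , first i)) k)))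

    row-∼ : ∀ {U} → Follows w U → ∀ i j → U (i , first i) ∼ U (i , j)
    row-∼ {U} f i j = reach (U (i , first i)) (toℕ j) (sym (follows-pow f i (toℕ j) refl))

    size-row-cycle : ((U , _) : ∣ Isos w ∣ₛ) → ∀ i → cycleSize (U (i , first i)) ≡ part lam i
    size-row-cycle (U , (inj , _) , f) i = size-unique (size-cycle′ (U (i , first i))) (injection+section
      {setoid (Fin (part lam i))} {setoid (Fin n) such-that λ y → U (i , first i) ∼ y}
      (λ j → U (i , j) , row-∼ f i j) (λ (y , k , _) → proj₁ (pow-in-row f i (toℕ k)))
      (λ { refl → refl }) (λ e → same-row-≡ (inj e)) (λ { (y , k , refl) → proj₂ (pow-in-row f i (toℕ k)) }))

    record StartingPoints (u : Fin (len lam) → Fin n) : Set where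
      field
        sizes : ∀ i → cycleSize (u i) ≡ part lam i
        apart : ∀ {i i′} → u i ∼ u i′ → i ≡ i′
        cover : ∀ x → ∃[ i ] u i ∼ x

    -- An identification is determined by the first entries of its rows. Conversely, one point on
    -- every cycle, assigned to a row of the right length, extends along the powers of `w`; the rows
    -- close up because their lengths are the periods.
    unroll : ∀ u → StartingPoints u → ∣ Isos w ∣ₛ
    unroll u sp = U , (inj , surj) , follows
      where
      open StartingPoints sp
      periods : ∀ i → part lam i ≡ period (u i)
      periods i = trans (sym (sizes i)) (cycleSize-period (u i))
      U : BoxOf → Fin n
      U (i , j) = pow (u i) (toℕ j)
      U-∼ : ∀ i j → u i ∼ U (i , j)
      U-∼ i j = reach (u i) (toℕ j) refl
      inj : ∀ {b b′} → U b ≡ U b′ → b ≡ b′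
      inj {i , j} {i′ , j′} e = at (apart {i} {i′} (∼-trans (U-∼ i j) (subst (_∼ u i′) (sym e) (∼-sym (U-∼ i′ j′))))) j j′ e
        where
        at : ∀ {i i′} → i ≡ i′ → ∀ j j′ → U (i , j) ≡ U (i′ , j′) → _≡_ {A = BoxOf} (i , j) (i′ , j′)
        at {i} refl j j′ e = cong (i ,_) (Fin.toℕ-injective (pow-injectiveʳ (u i) (subst (toℕ j ℕ.<_) (periods i) (Fin.toℕ<n j)) (subst (toℕ j′ ℕ.<_) (periods i) (Fin.toℕ<n j′)) e))
      surj : ∀ y → ∃[ b ] (∀ {b′} → b′ ≡ b → U b′ ≡ y)
      surj y =
        let (i , k , e) = cover y
            (j , j<p , e′) = reduce (u i) (toℕ k)
            j< = subst (j ℕ.<_) (sym (periods i)) j<p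
        in (i , fromℕ< j<) , λ { refl → trans (cong (pow (u i)) (Fin.toℕ-fromℕ< j<)) (trans e′ e) }
      follows : Follows w U
      follows i {j} (inj₁ e) = trans (cong (pow (u i)) e) (iterate-suc (w ⟨$⟩ʳ_) (u i) (toℕ j))
      follows i {j} {j′} (inj₂ (e , e′)) = begin
        pow (u i) (toℕ j′)       ≡⟨ cong (pow (u i)) e′ ⟩
        u i                      ≡⟨ sym (pow-period (u i)) ⟩
        pow (u i) (period (u i)) ≡⟨ cong (pow (u i)) (sym (trans e (periods i))) ⟩
        pow (u i) (suc (toℕ j))  ≡⟨ iterate-suc (w ⟨$⟩ʳ_) (u i) (toℕ j) ⟩
        w ⟨$⟩ʳ pow (u i) (toℕ j) ∎
        where open ≡-Reasoning

    iso-matching : ∣ Isos w ∣ₛ → setoid (Fin (len lam)) ≅ Reps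
    iso-matching (U , (inj , surj) , f) = injection+section {setoid (Fin (len lam))} {Reps}
      (λ i → rep (U (i , first i)))
      (λ (r , _) → proj₁ (proj₁ (surj r)))
      (λ { refl → refl })
      (λ {i} {i′} e → same-row-index i i′ (∼-trans (rep-∼ _) (subst (_∼ U (i′ , first i′)) (sym e) (∼-sym (rep-∼ _)))))
      (λ (r , l) → least-unique (proj₂ (rep _)) l (∼-trans (∼-sym (rep-∼ _)) (subst (U (_ , first _) ∼_) (proj₂ (surj r) refl) (row-∼ f _ _))))
      where
      same-row-index : ∀ i i′ → U (i , first i) ∼ U (i′ , first i′) → i ≡ i′
      same-row-index i i′ (k , e) = cong proj₁ (inj (trans (proj₂ (pow-in-row f i (toℕ k))) e))

    iso-matching-size : ∀ U i → cycleSize (proj₁ (Inverse.to (iso-matching U) i)) ≡ part lam i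
    iso-matching-size U i = trans (cycleSize-cong (∼-sym (rep-∼ _))) (size-row-cycle U i)

    iso⇒type : ∣ Isos w ∣ₛ → HasCycleType lam w
    iso⇒type U k = size-unique (size-cycles-of-length (toℕ k)) (size-≅ (≅-trans
      (such-that-≅ {Q = λ r → cycleSize (proj₁ r) ≡ toℕ k} σ (λ i e → trans (iso-matching-size U i) e)
        (λ r e → trans (sym (iso-matching-size U (Inverse.from σ r))) (trans (cong cycleSize (Inverse.inverseˡ σ {r} {Inverse.from σ r} refl)) e)))
      such-that-×) (size-parts (parts lam) (toℕ k)))
      where σ = iso-matching U

    -- Lengths 1, ..., n become colours 0, ..., n - 1, the indexing by which `z` multiplies the
    -- factorials of the multiplicities.
    colourOf : ∀ k → k ℕ.≤ n → NonZero k → Fin n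
    colourOf (suc k) k≤n _ = fromℕ< k≤n

    suc-colourOf : ∀ k p q → suc (toℕ (colourOf k p q)) ≡ k
    suc-colourOf (suc k) p _ = cong suc (Fin.toℕ-fromℕ< p)

    part≤n : ∀ i → part lam i ℕ.≤ n
    part≤n i = subst (part lam i ℕ.≤_) ∑-part (bound (part lam) i)
      where
      bound : ∀ {m} (f : Fin m → ℕ) i → f i ℕ.≤ ∑ᴺ f
      bound f fzero = ℕ.m≤m+n _ _
      bound f (fsuc i) = ℕ.≤-trans (bound (f ∘ fsuc) i) (ℕ.m≤n+m _ _)

    rowColour : Fin (len lam) → Fin n
    rowColour i = colourOf (part lam i) (part≤n i) (All.lookup (positive lam) (∈-lookup i))

    suc-rowColour : ∀ i → suc (toℕ (rowColour i)) ≡ part lam i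
    suc-rowColour i = suc-colourOf (part lam i) (part≤n i) (All.lookup (positive lam) (∈-lookup i))

    cycleColour : Fin n → Fin n
    cycleColour x = proj₁ (first-return x)

    suc-cycleColour : ∀ x → suc (toℕ (cycleColour x)) ≡ cycleSize x
    suc-cycleColour x = sym (cycleSize-period x)

    Matchings : Setoid 0ℓ 0ℓ
    Matchings = Bijections (setoid (Fin (len lam))) Reps such-that λ σ → ∀ i → cycleColour (proj₁ (Inverse.to σ i)) ≡ rowColour i

    symmetries : ℕ
    symmetries = ∏ᴺ {n} (λ k → multiplicity (suc (toℕ k)) (parts lam) !)

    size-Matchings : HasCycleType lam w → HasSize Matchings symmetries
    size-Matchings t = size-colour-bijections {setoid (Fin (len lam))} {Reps} rowColour (cycleColour ∘ proj₁) (cong rowColour) (cong cycleColour)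
      (λ k → multiplicity (suc (toℕ k)) (parts lam))
      (λ k → size-≅ (such-that-⇔ {setoid (Fin (len lam))}
          (λ i e → Fin.toℕ-injective (ℕ.suc-injective (trans (suc-rowColour i) e)))
          (λ i e → trans (sym (suc-rowColour i)) (cong (suc ∘ toℕ) e))) (size-parts (parts lam) (suc (toℕ k))))
      (λ k → ≡-size {Reps such-that λ r → cycleColour (proj₁ r) ≡ k} (t (fsuc k)) (size-≅ (≅-trans (≅-sym such-that-×) (such-that-⇔ {Reps}
          (λ (x , _) e → Fin.toℕ-injective (ℕ.suc-injective (trans (suc-cycleColour x) e)))
          (λ (x , _) e → trans (sym (suc-cycleColour x)) (cong (suc ∘ toℕ) e)))) (size-cycles-of-length (suc (toℕ k)))))

    -- Every row chooses a cycle of its length, counted by the factorials of the multiplicities;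
    -- then a starting point is chosen on each cycle, counted by the product of the parts.
    size-Isos : HasCycleType lam w → HasSize (Isos w) (symmetries ℕ.* ∏ᴺ (part lam))
    size-Isos t = size-uniform-fibres {Matchings} {Isos w}
      (λ U → iso-matching U , λ i → Fin.toℕ-injective (ℕ.suc-injective (trans (suc-cycleColour _) (trans (iso-matching-size U i) (sym (suc-rowColour i))))))
      (λ {U} {V} e i → rep-≡ (subst (proj₁ U (i , first i) ∼_) (e (i , first i)) ∼-refl))
      (size-Matchings t) (∏ᴺ (part lam)) fibre
      where
      fibre : (σ : ∣ Matchings ∣ₛ) → HasSize (Isos w such-that λ U → ∀ i → proj₁ (rep (proj₁ U (i , first i))) ≡ proj₁ (Inverse.to (proj₁ σ) i)) (∏ᴺ (part lam))
      fibre (σ , col) = size-≅ (≅-sym (injection+section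
        {Isos w such-that λ U → ∀ i → proj₁ (rep (proj₁ U (i , first i))) ≡ r i} {Πₛ λ i → setoid (Fin n) such-that λ x → r i ∼ x}
        (λ ((U , _) , e) i → U (i , first i) , ∼-sym (subst (U (i , first i) ∼_) (e i) (rep-∼ _)))
        (λ u → unroll (proj₁ ∘ u) (starting u) , λ i →
          least-unique (proj₂ (rep _)) (proj₂ (Inverse.to σ i)) (∼-trans (∼-sym (rep-∼ _)) (∼-trans (∼-sym (reach (proj₁ (u i)) (toℕ (first i)) refl)) (∼-sym (proj₂ (u i))))))
        (λ e i → e (i , first i))
        (λ {((U , _ , f) , _)} {((V , _ , g) , _)} e (i , j) → trans (follows-pow f i (toℕ j) refl) (trans (cong (λ x → pow x (toℕ j)) (e i)) (sym (follows-pow g i (toℕ j) refl))))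
        (λ u i → cong (pow (proj₁ (u i))) (proj₂ (start i)))))
        (size-Π (λ i → setoid (Fin n) such-that λ x → r i ∼ x) (part lam)
          (λ i → ≡-size {setoid (Fin n) such-that λ x → r i ∼ x} (r-size i) (size-cycle′ (r i))))
        where
        r : Fin (len lam) → Fin n
        r i = proj₁ (Inverse.to σ i)
        r-size : ∀ i → cycleSize (r i) ≡ part lam i
        r-size i = trans (sym (suc-cycleColour (r i))) (trans (cong (suc ∘ toℕ) (col i)) (suc-rowColour i))
        σ-injective : ∀ i i′ → r i ≡ r i′ → i ≡ i′
        σ-injective i i′ e = trans (sym (Inverse.inverseʳ σ {i} {Inverse.to σ i} refl)) (trans (Inverse.from-cong σ {Inverse.to σ i} {Inverse.to σ i′} e) (Inverse.inverseʳ σ {i′} {Inverse.to σ i′} refl))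
        starting : (u : ∀ i → Σ[ x ∈ Fin n ] r i ∼ x) → StartingPoints (proj₁ ∘ u)
        starting u = record
          { sizes = λ i → trans (cycleSize-cong (∼-sym (proj₂ (u i)))) (r-size i)
          ; apart = λ {i} {i′} e → σ-injective i i′ (least-unique (proj₂ (Inverse.to σ i)) (proj₂ (Inverse.to σ i′)) (∼-trans (proj₂ (u i)) (∼-trans e (∼-sym (proj₂ (u i′))))))
          ; cover = λ x → let i = Inverse.from σ (rep x) in
              i , ∼-trans (∼-sym (proj₂ (u i))) (∼-trans (subst (r i ∼_) (Inverse.inverseˡ σ {rep x} refl) ∼-refl) (∼-sym (rep-∼ x)))
          }

  z-product : ∀ w → symmetries w ℕ.* ∏ᴺ (part lam) ≡ z lam
  z-product w = trans (ℕ.*-comm (symmetries w) _) (cong₂ ℕ._*_ (trans (∏-lookup id (parts lam)) (cong Data.Nat.ListAction.product (List.map-id (parts lam)))) (upTo-∏ n id))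
    where
    m! : ℕ → ℕ
    m! k = multiplicity (suc k) (parts lam) !
    upTo-∏ : ∀ n (f : ℕ → ℕ) → ∏ᴺ {n} (λ k → m! (f (toℕ k))) ≡ Data.Nat.ListAction.product (map m! (applyUpTo f n))
    upTo-∏ zero f = refl
    upTo-∏ (suc n) f = cong (m! (f 0) ℕ.*_) (upTo-∏ n (f ∘ suc))

  count-Isos : ∀ w (d : Dec (HasCycleType lam w)) → HasSize (Isos w) (if does d then z lam else 0)
  count-Isos w (yes t) = ≡-size {Isos w} (z-product w) (size-Isos w t)
  count-Isos w (no ¬t) = size-empty {Isos w} (¬t ∘ iso⇒type w)

  z≢0 : NonZero (z lam)
  z≢0 = ℕ.m*n≢0 _ _ {{product≢0 (positive lam)}} {{product≢0 (AllP.map⁺ (All.universal (λ k → (multiplicity (suc k) (parts lam)) ℕ.!≢0) (upTo n)))}}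

  -- An identification is extracted from the count: `z lam` is nonzero, so the enumeration has a
  -- first member.
  type⇒iso : ∀ w → HasCycleType lam w → ∣ Isos w ∣ₛ
  type⇒iso w t = inhabitant z≢0 (count-Isos w (yes t))
    where
    inhabitant : ∀ {m} → NonZero m → HasSize (Isos w) m → ∣ Isos w ∣ₛ
    inhabitant {suc m} _ h = Inverse.to h fzero

-- Expansion of class functions

∑-mono : ∀ {n} {f g : Fin n → ℕ} → (∀ i → f i ℕ.≤ g i) → ∑ᴺ f ℕ.≤ ∑ᴺ g
∑-mono {zero} le = z≤n
∑-mono {suc n} le = ℕ.+-mono-≤ (le fzero) (∑-mono (le ∘ fsuc))

∑-tight : ∀ {n} {f g : Fin n → ℕ} → (∀ i → f i ℕ.≤ g i) → ∑ᴺ g ℕ.≤ ∑ᴺ f → ∀ i → g i ℕ.≤ f i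
∑-tight {suc n} {f} {g} le ge fzero = ℕ.+-cancelʳ-≤ (∑ᴺ (f ∘ fsuc)) _ _
  (ℕ.≤-trans (ℕ.+-monoʳ-≤ (g fzero) (∑-mono (le ∘ fsuc))) ge)
∑-tight {suc n} {f} {g} le ge (fsuc i) = ∑-tight (le ∘ fsuc) (ℕ.+-cancelˡ-≤ (f fzero) _ _
  (ℕ.≤-trans (ℕ.+-monoˡ-≤ (∑ᴺ (g ∘ fsuc)) (le fzero)) ge)) i

pairs : ∀ {n} {R : Rel (Fin n) 0ℓ} → (∀ i j → Dec (R i j)) → ℕ
pairs R? = ∑ᴺ λ i → ∑ᴺ λ j → [ R? i j ]?

[]?-mono : {P Q : Set} (d : Dec P) (e : Dec Q) → (P → Q) → [ d ]? ℕ.≤ [ e ]?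
[]?-mono (yes p) (yes q) f = ℕ.≤-refl
[]?-mono (yes p) (no ¬q) f = contradiction (f p) ¬q
[]?-mono (no _) e f = z≤n

[]?-tight : {P Q : Set} (d : Dec P) (e : Dec Q) → [ e ]? ℕ.≤ [ d ]? → Q → P
[]?-tight (yes p) e le q = p
[]?-tight (no _) (yes _) () q
[]?-tight (no _) (no ¬q) le q = contradiction q ¬q

module _ {n} {R S : Rel (Fin n) 0ℓ} (R? : ∀ i j → Dec (R i j)) (S? : ∀ i j → Dec (S i j)) where

  pairs-mono : (∀ {i j} → R i j → S i j) → pairs R? ℕ.≤ pairs S?
  pairs-mono f = ∑-mono λ i → ∑-mono λ j → []?-mono (R? i j) (S? i j) f

  -- If the termwise larger of two sums is not larger in total, all terms agree; applied to rows and
  -- then to entries, this turns equal counts into equal relations.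
  pairs-tight : (∀ {i j} → R i j → S i j) → pairs S? ℕ.≤ pairs R? → ∀ {i j} → S i j → R i j
  pairs-tight f ge {i} {j} = []?-tight (R? i j) (S? i j)
    (∑-tight (λ j → []?-mono (R? i j) (S? i j) f) (∑-tight (λ i → ∑-mono λ j → []?-mono (R? i j) (S? i j) f) ge i) j)

pairs-conj : ∀ {n} {R S : Rel (Fin n) 0ℓ} (R? : ∀ i j → Dec (R i j)) (S? : ∀ i j → Dec (S i j)) (g : Permutation′ n) →
  (∀ i j → R i j → S (g ⟨$⟩ʳ i) (g ⟨$⟩ʳ j)) → (∀ i j → S (g ⟨$⟩ʳ i) (g ⟨$⟩ʳ j) → R i j) → pairs R? ≡ pairs S?
pairs-conj {n} R? S? g f f′ = begin
  pairs R?
    ≡⟨ ∑-congᴺ (λ i → ∑-congᴺ λ j → cong (λ b → if b then 1 else 0) (does-⇔ (mk⇔ (f i j) (f′ i j)) (R? i j) (S? (g ⟨$⟩ʳ i) (g ⟨$⟩ʳ j)))) ⟩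
  ∑ᴺ (λ i → ∑ᴺ λ j → [ S? (g ⟨$⟩ʳ i) (g ⟨$⟩ʳ j) ]?)
    ≡⟨ ∑-congᴺ (λ i → sym (ℕ∑.sum-permute (λ j → [ S? (g ⟨$⟩ʳ i) j ]?) g)) ⟩
  ∑ᴺ (λ i → ∑ᴺ λ j → [ S? (g ⟨$⟩ʳ i) j ]?)
    ≡⟨ sym (ℕ∑.sum-permute (λ i → ∑ᴺ λ j → [ S? i j ]?) g) ⟩
  pairs S? ∎
  where open ≡-Reasoning

-- The measure of the elimination. For a permutation of cycle type λ it is the sum of the squares of
-- the parts, so it drops when cycles are properly refined.
cyclePairs : ∀ {n} → Permutation′ n → ℕ
cyclePairs w = pairs (sameCycle? w)

sameCycle-conj : ∀ {n} {v w : Permutation′ n} (g : Permutation′ n) → (g ∘ₚ w ∘ₚ flip g) Perm.≈ v →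
  ∀ i j → (SameCycle v i j → SameCycle w (g ⟨$⟩ʳ i) (g ⟨$⟩ʳ j)) × (SameCycle w (g ⟨$⟩ʳ i) (g ⟨$⟩ʳ j) → SameCycle v i j)
sameCycle-conj {n} {v} {w} g e i j =
  (λ (k , p) → k , trans (sym (at (toℕ k))) (cong (g ⟨$⟩ʳ_) p)) ,
  (λ (k , p) → k , ⟨$⟩ʳ-injective g (trans (at (toℕ k)) p))
  where
  at : ∀ k → g ⟨$⟩ʳ iterate (v ⟨$⟩ʳ_) i k ≡ iterate (w ⟨$⟩ʳ_) (g ⟨$⟩ʳ i) k
  at zero = refl
  at (suc k) = trans (cong (g ⟨$⟩ʳ_) (trans (iterate-suc (v ⟨$⟩ʳ_) i k) (sym (e (iterate (v ⟨$⟩ʳ_) i k)))))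
    (trans (inverseʳₚ g) (trans (cong (w ⟨$⟩ʳ_) (at k)) (sym (iterate-suc (w ⟨$⟩ʳ_) (g ⟨$⟩ʳ i) k))))

cyclePairs-conj : ∀ {n} {v w : Permutation′ n} (g : Permutation′ n) → (g ∘ₚ w ∘ₚ flip g) Perm.≈ v → cyclePairs v ≡ cyclePairs w
cyclePairs-conj {v = v} {w} g e = pairs-conj (sameCycle? v) (sameCycle? w) g
  (λ i j → proj₁ (sameCycle-conj {v = v} {w} g e i j)) (λ i j → proj₂ (sameCycle-conj {v = v} {w} g e i j))

IsClassFunction : ∀ {n} {A : Set} → (Permutation′ n → A) → Set
IsClassFunction {n} f = ∀ {v w} (g : Permutation′ n) → (g ∘ₚ w ∘ₚ flip g) Perm.≈ v → f v ≡ f w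

class-cong : ∀ {n} {A : Set} {f : Permutation′ n → A} → IsClassFunction f → ∀ {v w} → v Perm.≈ w → f v ≡ f w
class-cong f-class {v} {w} e = f-class {v} {w} idₚ (sym ∘ e)

-- Conjugating `w` only translates the summation variable.
numerator-class : ∀ {n} (mu : Partition n) → IsClassFunction (numerator mu)
numerator-class {n} mu {v} {w} g e =
  trans (ℤ∑.∑ₚ-cong λ h → sign°-cong mu {h ∘ₚ v ∘ₚ flip h} {(h ∘ₚ g) ∘ₚ w ∘ₚ flip (h ∘ₚ g)} λ i → cong (h ⟨$⟩ˡ_) (sym (e (h ⟨$⟩ʳ i))))
    (ℤ∑.∑ₚ-reindex translate {λ h → sign° mu (h ∘ₚ w ∘ₚ flip h)} λ {h} {h′} e′ → sign°-cong mu {h ∘ₚ w ∘ₚ flip h} {h′ ∘ₚ w ∘ₚ flip h′}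
      λ i → ⟨$⟩ʳ-injective h′ (trans (sym (e′ (h ⟨$⟩ˡ (w ⟨$⟩ʳ (h ⟨$⟩ʳ i))))) (trans (inverseʳₚ h) (trans (cong (w ⟨$⟩ʳ_) (e′ i)) (sym (inverseʳₚ h′))))))
  where
  translate : Perms n ≅ Perms n
  translate = injection+section {Perms n} {Perms n} (_∘ₚ g) (_∘ₚ flip g) (λ e i → cong (g ⟨$⟩ʳ_) (e i))
    (λ e i → ⟨$⟩ʳ-injective g (e i)) (λ h i → inverseʳₚ g)

sign≢0 : ∀ {n} (w : Permutation′ n) → sign w ≢ 0ℤ
sign≢0 {n} w e = contradiction (trans (sym (sign-id {n})) (trans (sym (sign-cong (w ∘ₚ flip w) idₚ λ _ → inverseˡₚ w))
  (trans (sign-∘ w (flip w)) (trans (cong (ℤ._* sign (flip w)) e) (ℤ.*-zeroˡ (sign (flip w))))))) λ ()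

-- Triangularity of the induced sign characters

module Triangularity {n} (mu : Partition n) where
  open Boxes mu
  open Isomorphisms mu

  Conjugates : Permutation′ n → Permutation′ n → Set
  Conjugates w g = InYoung mu (g ∘ₚ w ∘ₚ flip g)

  conjugates? : ∀ w g → Dec (Conjugates w g)
  conjugates? w g = inYoung? mu (g ∘ₚ w ∘ₚ flip g)

  conjugates-resp : ∀ {w g h} → g Perm.≈ h → Conjugates w g → Conjugates w h
  conjugates-resp {w} {g} {h} e = inYoung-resp mu {g ∘ₚ w ∘ₚ flip g} {h ∘ₚ w ∘ₚ flip h}
    λ i → ⟨$⟩ʳ-injective h (trans (sym (e (g ⟨$⟩ˡ (w ⟨$⟩ʳ (g ⟨$⟩ʳ i))))) (trans (inverseʳₚ g) (trans (cong (w ⟨$⟩ʳ_) (e i)) (sym (inverseʳₚ h)))))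

  numerator≢0⇒conjugate : ∀ w → numerator mu w ≢ 0ℤ → ∃ (Conjugates w)
  numerator≢0⇒conjugate w ≢0 = decide (any-finite? {Perms n} (size-Perms n) (λ {g} {h} → conjugates-resp {w} {g} {h}) (conjugates? w))
    where
    off : ∀ {P : Set} {x : ℤ} (d : Dec P) → ¬ P → (if does d then x else 0ℤ) ≡ 0ℤ
    off (yes p) ¬p = contradiction p ¬p
    off (no _) _ = refl
    decide : Dec (∃ (Conjugates w)) → ∃ (Conjugates w)
    decide (yes c) = c
    decide (no ¬c) = contradiction (ℤ∑.∑ₚ-ε λ g → off {x = sign (g ∘ₚ w ∘ₚ flip g)} (conjugates? w g) (λ p → ¬c (g , p))) ≢0

  -- The sign is invariant under conjugation, so all nonzero terms equal `sign w` and nothing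
  -- cancels: the sum is `sign w` times the number of conjugators into the Young subgroup.
  conjugate⇒numerator≢0 : ∀ w → ∃ (Conjugates w) → numerator mu w ≢ 0ℤ
  conjugate⇒numerator≢0 w c e = [ sign≢0 w , (λ N≡0 → nonempty (ℤ.+-injective N≡0) size-conj (proj₁ c , proj₂ c)) ]′
      (ℤ.i*j≡0⇒i≡0∨j≡0 (sign w) (trans (sym factor) e))
    where
    size-conj = size-such-that {Perms n} (size-Perms n) (λ {g} {h} → conjugates-resp {w} {g} {h}) (conjugates? w)
    N = ∑ᴺ λ i → [ conjugates? w (Inverse.to (size-Perms n) i) ]?
    nonempty : ∀ {N} → N ≡ 0 → HasSize (Perms n such-that Conjugates w) N → ¬ ∣ Perms n such-that Conjugates w ∣ₛ
    nonempty refl h x = case Inverse.from h x of λ ()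
    term : ∀ g → sign° mu (g ∘ₚ w ∘ₚ flip g) ≡ sign w ℤ.* + [ conjugates? w g ]?
    term g = on (conjugates? w g)
      where
      on : ∀ {P : Set} (d : Dec P) → (if does d then sign (g ∘ₚ w ∘ₚ flip g) else 0ℤ) ≡ sign w ℤ.* + [ d ]?
      on (yes _) = trans (sign-conj g w) (sym (ℤ.*-identityʳ (sign w)))
      on (no _) = sym (ℤ.*-zeroʳ (sign w))
    factor : numerator mu w ≡ sign w ℤ.* + N
    factor = trans (ℤ∑.∑ₚ-cong term) (sym (trans (cong (sign w ℤ.*_) (+-∑ (λ i → [ conjugates? w (Inverse.to (size-Perms n) i) ]?)))
      (sum-homomorphism ℤ.+-0-commutativeMonoid ℤ.+-0-commutativeMonoid (sign w ℤ.*_) (ℤ.*-zeroʳ (sign w)) (ℤ.*-distribˡ-+ (sign w)) (λ i → + [ conjugates? w (Inverse.to (size-Perms n) i) ]?))))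

  rowPairs : ℕ
  rowPairs = pairs (λ i j → row i Fin.≟ row j)

  young⇒same-row : ∀ {v} → InYoung mu v → ∀ {i j} → SameCycle v i j → row i ≡ row j
  young⇒same-row {v} y {i} (k , refl) = along i (toℕ k)
    where
    along : ∀ i k → row i ≡ row (iterate (v ⟨$⟩ʳ_) i k)
    along i zero = refl
    along i (suc k) = trans (sym (same-segment (y i))) (along (v ⟨$⟩ʳ i) k)

  young-pairs : ∀ {v} → InYoung mu v → cyclePairs v ℕ.≤ rowPairs
  young-pairs {v} y = pairs-mono (sameCycle? v) (λ i j → row i Fin.≟ row j) (young⇒same-row {v} y)

  -- The cycles of `v` lie inside segments. If they account for all pairs within segments, they are
  -- the segments, and the first position of each segment serves as a starting point.
  tight⇒iso : ∀ v → InYoung mu v → rowPairs ℕ.≤ cyclePairs v → ∣ Isos v ∣ₛ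
  tight⇒iso v y tight = unroll v u record
    { sizes = λ i → size-unique (size-cycle′ (u i)) (size-≅ (such-that-⇔
        (λ x e → same-cycle (trans (row-u i) (sym e))) (λ x c → trans (sym (young⇒same-row {v} y c)) (row-u i))) (size-row i))
    ; apart = λ {i} {i′} c → trans (sym (row-u i)) (trans (young⇒same-row {v} y c) (row-u i′))
    ; cover = λ x → row x , same-cycle (row-u (row x))
    }
    where
    open Cycles v
    u : Fin (len mu) → Fin n
    u i = Inverse.from boxes (i , first i)
    row-u : ∀ i → row (u i) ≡ i
    row-u i = cong proj₁ (Inverse.inverseˡ boxes {i , first i} refl)
    same-cycle : ∀ {i j} → row i ≡ row j → SameCycle v i j
    same-cycle = pairs-tight (sameCycle? v) (λ i j → row i Fin.≟ row j) (young⇒same-row {v} y) tight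

  module _ {g : Permutation′ n} (t : HasCycleType mu g) where

    private
      g-iso : ∣ Isos g ∣ₛ
      g-iso = type⇒iso g t
      U = proj₁ g-iso
      inj = proj₁ (proj₁ (proj₂ g-iso))
      surj : ∀ y → ∃[ b ] U b ≡ y
      surj y = let (b , e) = proj₂ (proj₁ (proj₂ g-iso)) y in b , e refl
      follows = proj₂ (proj₂ g-iso)

    -- Lists the entries of an identification of the diagram with the cycles of `g`, row by row.
    -- Each cycle then occupies a segment, so the conjugate `g′` lies in the Young subgroup and
    -- attains the maximal number of pairs.
    arrangement : Permutation′ n
    arrangement = permutation (U ∘ Inverse.to boxes) (λ y → Inverse.from boxes (proj₁ (surj y)))
      (λ y → trans (cong U (Inverse.inverseˡ boxes refl)) (proj₂ (surj y)))
      (λ x → trans (cong (Inverse.from boxes) (inj (proj₂ (surj (U (Inverse.to boxes x)))))) (Inverse.inverseʳ boxes refl))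

    private
      g′ = arrangement ∘ₚ g ∘ₚ flip arrangement

    g′-next : ∀ i {j j′} → Next j j′ → g′ ⟨$⟩ʳ (Inverse.from boxes (i , j)) ≡ Inverse.from boxes (i , j′)
    g′-next i {j} {j′} s = ⟨$⟩ʳ-injective arrangement (trans (inverseʳₚ arrangement)
      (trans (cong (λ b → g ⟨$⟩ʳ U b) (Inverse.inverseˡ boxes {i , j} refl)) (trans (sym (follows i s)) (cong U (sym (Inverse.inverseˡ boxes {i , j′} refl))))))

    arrangement-young : Conjugates g arrangement
    arrangement-young x = let (i , j) = Inverse.to boxes x ; (j′ , s) = next j in
      same-row {g′ ⟨$⟩ʳ x} {x} (trans (cong row (trans (cong (g′ ⟨$⟩ʳ_) (sym (Inverse.inverseʳ boxes {x} refl))) (g′-next i s)))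
        (cong proj₁ (Inverse.inverseˡ boxes {i , j′} refl)))

    g′-iso : ∣ Isos g′ ∣ₛ
    g′-iso = Inverse.from boxes , ((λ {b} {b′} e → trans (sym (Inverse.inverseˡ boxes refl)) (trans (cong (Inverse.to boxes) e) (Inverse.inverseˡ boxes refl))) ,
      (λ x → Inverse.to boxes x , λ { refl → Inverse.inverseʳ boxes refl })) , λ i s → sym (g′-next i s)

    rowPairs≡cyclePairs : rowPairs ≡ cyclePairs g
    rowPairs≡cyclePairs = trans (ℕ.≤-antisym
        (pairs-mono (λ i j → row i Fin.≟ row j) (sameCycle? g′) joined)
        (young-pairs {g′} arrangement-young))
      (cyclePairs-conj {v = g′} {g} arrangement (λ _ → refl))
      where
      open Cycles g′
      at : ∀ {i i′} j j′ → i ≡ i′ → Inverse.from boxes (i , j) ∼ Inverse.from boxes (i′ , j′)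
      at {i} j j′ refl = ∼-trans (∼-sym (row-∼ g′ (proj₂ (proj₂ g′-iso)) i j)) (row-∼ g′ (proj₂ (proj₂ g′-iso)) i j′)
      joined : ∀ {x y} → row x ≡ row y → SameCycle g′ x y
      joined {x} {y} e = subst (_∼ y) (Inverse.inverseʳ boxes {x} refl) (subst (Inverse.from boxes (Inverse.to boxes x) ∼_) (Inverse.inverseʳ boxes {y} refl)
        (at (proj₂ (Inverse.to boxes x)) (proj₂ (Inverse.to boxes y)) e))

    numerator-self : numerator mu g ≢ 0ℤ
    numerator-self = conjugate⇒numerator≢0 g (arrangement , arrangement-young)

    numerator≢0⇒pairs : ∀ w → numerator mu w ≢ 0ℤ → cyclePairs w ℕ.≤ cyclePairs g
    numerator≢0⇒pairs w ≢0 = let (h , y) = numerator≢0⇒conjugate w ≢0 in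
      subst (ℕ._≤ cyclePairs g) (cyclePairs-conj {v = h ∘ₚ w ∘ₚ flip h} {w} h (λ _ → refl))
        (subst (cyclePairs (h ∘ₚ w ∘ₚ flip h) ℕ.≤_) rowPairs≡cyclePairs (young-pairs {h ∘ₚ w ∘ₚ flip h} y))

    -- Some conjugate of `w` lies in the Young subgroup, and with this many pairs its cycles must be
    -- the segments. Both `w` and `g` are then identified with the same diagram, which makes them
    -- conjugate.
    numerator≢0⇒conjugate-self : ∀ w → numerator mu w ≢ 0ℤ → cyclePairs w ≡ cyclePairs g → ∃[ h ] (h ∘ₚ g ∘ₚ flip h) Perm.≈ w
    numerator≢0⇒conjugate-self w ≢0 e = let (h , y) = numerator≢0⇒conjugate w ≢0 ; v = h ∘ₚ w ∘ₚ flip h in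
      Isos-conjugate {w} {g} (Isos-conj {w} h (tight⇒iso v y (ℕ.≤-reflexive (trans rowPairs≡cyclePairs (trans (sym e) (sym (cyclePairs-conj {v = v} {w} h (λ _ → refl)))))))) g-iso

type-conj : ∀ {n} (lam : Partition n) {v w : Permutation′ n} (g : Permutation′ n) →
  (g ∘ₚ w ∘ₚ flip g) Perm.≈ v → HasCycleType lam v → HasCycleType lam w
type-conj lam {v} {w} g e t = iso⇒type w (Isos-conj {w} g (Isos-cong {v} {g ∘ₚ w ∘ₚ flip g} (sym ∘ e) (type⇒iso v t)))
  where open Isomorphisms lam

conj-sym : ∀ {n} {v w : Permutation′ n} (g : Permutation′ n) → (g ∘ₚ w ∘ₚ flip g) Perm.≈ v → (flip g ∘ₚ v ∘ₚ flip (flip g)) Perm.≈ w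
conj-sym {v = v} {w} g e i = trans (cong (g ⟨$⟩ʳ_) (sym (e (g ⟨$⟩ˡ i)))) (trans (inverseʳₚ g) (cong (w ⟨$⟩ʳ_) (inverseʳₚ g)))

ψ-class : ∀ {n} (lam : Partition n) → IsClassFunction (ψ lam)
ψ-class lam {v} {w} g e = cong (λ b → if b then (+ z lam) / 1 else 0ℚ)
  (does-⇔ (mk⇔ (type-conj lam {v} {w} g e) (type-conj lam {w} {v} (flip g) (conj-sym {v = v} {w} g e))) (hasCycleType? lam v) (hasCycleType? lam w))

ι-injective : ∀ x → ι x ≡ 0ℚ → x ≡ 0ℤ
ι-injective x e = trans (sym (ℤ.*-identityʳ x)) (unwrap (ℚ./-injective-≃ (ℚᵘ.mkℚᵘ x 0) (ℚᵘ.mkℚᵘ 0ℤ 0) e))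
  where
  unwrap : ℚᵘ.mkℚᵘ x 0 ℚᵘ.≃ ℚᵘ.mkℚᵘ 0ℤ 0 → x ℤ.* 1ℤ ≡ 0ℤ
  unwrap (ℚᵘ.*≡* p) = p

module _ {n} (mu : Partition n) where

  private
    instance
      y≢0 : NonZero (youngOrder mu)
      y≢0 = youngOrder≢0 mu

  ε-cong : ∀ v w → numerator mu v ≡ numerator mu w → ε mu v ≡ ε mu w
  ε-cong v w e = trans (ε-numerator mu v) (trans (cong (λ x → ι x ℚ.* (1ℤ / youngOrder mu)) e) (sym (ε-numerator mu w)))

  ε≢0⇒numerator≢0 : ∀ w → ε mu w ≢ 0ℚ → numerator mu w ≢ 0ℤ
  ε≢0⇒numerator≢0 w ≢0 e = ≢0 (trans (ε-numerator mu w) (trans (cong (λ x → ι x ℚ.* (1ℤ / youngOrder mu)) e) (ℚ.*-zeroˡ (1ℤ / youngOrder mu))))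

  numerator≢0⇒ε≢0 : ∀ w → numerator mu w ≢ 0ℤ → ε mu w ≢ 0ℚ
  numerator≢0⇒ε≢0 w ≢0 e = ≢0 (ι-injective _ (begin
    ι (numerator mu w)                    ≡⟨ sym (ℚ.*-identityʳ _) ⟩
    ι (numerator mu w) ℚ.* 1ℚ             ≡⟨ cong (ι (numerator mu w) ℚ.*_) (sym unit) ⟩
    ι (numerator mu w) ℚ.* (r ℚ.* y)      ≡⟨ sym (ℚ.*-assoc (ι (numerator mu w)) r y) ⟩
    ι (numerator mu w) ℚ.* r ℚ.* y        ≡⟨ cong (ℚ._* y) (trans (sym (ε-numerator mu w)) e) ⟩
    0ℚ ℚ.* y                              ≡⟨ ℚ.*-zeroˡ y ⟩
    0ℚ ∎))
    where
    open ≡-Reasoning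
    r = 1ℤ / youngOrder mu
    y = ι (+ youngOrder mu)
    instance
      y1≢0 : NonZero (youngOrder mu ℕ.* 1)
      y1≢0 = ℕ.m*n≢0 (youngOrder mu) 1
    unit : r ℚ.* y ≡ 1ℚ
    unit = trans (/-*-/ 1ℤ (youngOrder mu) (+ youngOrder mu) 1)
      (/-≡ {1ℤ ℤ.* + youngOrder mu} {youngOrder mu ℕ.* 1} {1ℤ} {1} (trans (ℤ.*-identityʳ _) (cong (λ m → 1ℤ ℤ.* + m) (sym (ℕ.*-identityʳ (youngOrder mu))))))

module _ {n : ℕ} where

  InSpan : (Permutation′ n → ℚ) → Set
  InSpan θ = ∃[ a ] a IsExpansionOf θ

  span-+ : ∀ {θ φ q} mu → InSpan θ → (∀ w → φ w ≡ q ℚ.* ε mu w ℚ.+ θ w) → InSpan φ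
  span-+ {q = q} mu (a , e) s = (q , mu) ∷ a , λ w → trans (s w) (cong (q ℚ.* ε mu w ℚ.+_) (e w))

  allPerms : List (Permutation′ n)
  allPerms = tabulate (Inverse.to (size-Perms n))

  allPerms-complete : ∀ w → Any (w Perm.≈_) allPerms
  allPerms-complete w = AnyP.tabulate⁺ (Inverse.from (size-Perms n) w) (λ i → sym (Inverse.inverseˡ (size-Perms n) {w} refl i))

  -- The values still to be matched: those on permutations with fewer cycle pairs,
  -- and those in the listed permutations with exactly m cycle pairs.
  Pending : ℕ → List (Permutation′ n) → Permutation′ n → Set
  Pending m gs w = cyclePairs w ℕ.< m ⊎ (cyclePairs w ≡ m × Any (w Perm.≈_) gs)

  -- For `g` at level `m`, with type `mu`, the multiple of `ε mu` that kills the value at `g` is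
  -- subtracted. This alters `θ` only where `ε mu` is nonzero: at permutations with fewer pairs,
  -- which are still pending, and at conjugates of `g`, where the difference vanishes with its value
  -- at `g`. When the list is used up, the level below starts with all permutations.
  eliminate : ∀ m gs θ → IsClassFunction θ → (∀ w → θ w ≡ 0ℚ ⊎ Pending m gs w) → InSpan θ
  eliminate zero [] θ cl supp = [] , λ w → [ id , (λ { (inj₁ ()) ; (inj₂ (_ , ())) }) ]′ (supp w)
  eliminate (suc m) [] θ cl supp = eliminate m allPerms θ cl λ w → [ inj₁ , lower w ]′ (supp w)
    where
    lower : ∀ w → Pending (suc m) [] w → θ w ≡ 0ℚ ⊎ Pending m allPerms w
    lower w (inj₁ (s≤s le)) with ℕ.m≤n⇒m<n∨m≡n le
    ... | inj₁ lt = inj₂ (inj₁ lt)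
    ... | inj₂ eq = inj₂ (inj₂ (eq , allPerms-complete w))
    lower w (inj₂ (_ , ()))
  eliminate m (g ∷ gs) θ cl supp = step (cyclePairs g ℕ.≟ m)
    where
    skip : cyclePairs g ≢ m → ∀ w → Pending m (g ∷ gs) w → θ w ≡ 0ℚ ⊎ Pending m gs w
    skip q≢m w (inj₁ lt) = inj₂ (inj₁ lt)
    skip q≢m w (inj₂ (eq , here w≈g)) = contradiction (trans (sym (cyclePairs-conj {v = w} {g} idₚ (sym ∘ w≈g))) eq) q≢m
    skip q≢m w (inj₂ (eq , there w∈)) = inj₂ (inj₂ (eq , w∈))
    mu : Partition n
    mu = proj₁ (hasType g)
    t : HasCycleType mu g
    t = proj₂ (hasType g)
    open Triangularity mu
    instance
      ε≢0 : ℚ.NonZero (ε mu g)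
      ε≢0 = ℚ.≢-nonZero (numerator≢0⇒ε≢0 mu g (numerator-self {g} t))
    c : ℚ
    c = θ g ℚ.* (ℚ.1/ ε mu g)
    θ′ : Permutation′ n → ℚ
    θ′ w = θ w ℚ.- c ℚ.* ε mu w
    restore : ∀ x y → y ℚ.+ (x ℚ.- y) ≡ x
    restore x y = trans (ℚ.+-comm y (x ℚ.- y)) (trans (ℚ.+-assoc x (ℚ.- y) y) (trans (cong (x ℚ.+_) (ℚ.+-inverseˡ y)) (ℚ.+-identityʳ x)))
    cl′ : IsClassFunction θ′
    cl′ {v} {w} h e = cong₂ (λ x y → x ℚ.- c ℚ.* y) (cl {v} {w} h e) (ε-cong mu v w (numerator-class mu {v} {w} h e))
    cancelled : ∀ w → θ w ≡ θ g → ε mu w ≡ ε mu g → θ′ w ≡ 0ℚ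
    cancelled w p q = trans (cong₂ (λ x y → x ℚ.- c ℚ.* y) p q) (trans (cong (λ y → θ g ℚ.- y)
      (trans (ℚ.*-assoc (θ g) (ℚ.1/ ε mu g) (ε mu g)) (trans (cong (θ g ℚ.*_) (ℚ.*-inverseˡ (ε mu g))) (ℚ.*-identityʳ (θ g))))) (ℚ.+-inverseʳ (θ g)))
    unchanged : ∀ w → ε mu w ≡ 0ℚ → θ′ w ≡ θ w
    unchanged w e = trans (cong (λ y → θ w ℚ.- c ℚ.* y) e) (trans (cong (λ y → θ w ℚ.- y) (ℚ.*-zeroʳ c)) (ℚ.+-identityʳ (θ w)))
    supp-unchanged : ∀ w → ε mu w ≡ 0ℚ → θ w ≡ 0ℚ ⊎ Pending m (g ∷ gs) w → θ′ w ≡ 0ℚ ⊎ Pending m gs w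
    supp-unchanged w e (inj₁ z) = inj₁ (trans (unchanged w e) z)
    supp-unchanged w e (inj₂ (inj₁ lt)) = inj₂ (inj₁ lt)
    supp-unchanged w e (inj₂ (inj₂ (_ , here w≈g))) = contradiction
      (trans (ε-cong mu g w (class-cong {f = numerator mu} (λ {v} {w} → numerator-class mu {v} {w}) {g} {w} (sym ∘ w≈g))) e) (numerator≢0⇒ε≢0 mu g (numerator-self {g} t))
    supp-unchanged w e (inj₂ (inj₂ (eq , there w∈))) = inj₂ (inj₂ (eq , w∈))
    supp′ : cyclePairs g ≡ m → ∀ w → θ′ w ≡ 0ℚ ⊎ Pending m gs w
    supp′ q≡m w = decide (ε mu w ℚ.≟ 0ℚ)
      where
      decide : Dec (ε mu w ≡ 0ℚ) → θ′ w ≡ 0ℚ ⊎ Pending m gs w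
      decide (yes e) = supp-unchanged w e (supp w)
      decide (no ≢0) = [ (λ lt → inj₂ (inj₁ (subst (cyclePairs w ℕ.<_) q≡m lt))) , (λ eq →
          let (h , conj) = numerator≢0⇒conjugate-self {g} t w (ε≢0⇒numerator≢0 mu w ≢0) eq in
          inj₁ (cancelled w (cl {w} {g} h conj) (ε-cong mu w g (numerator-class mu {w} {g} h conj)))) ]′
        (ℕ.m≤n⇒m<n∨m≡n (numerator≢0⇒pairs {g} t w (ε≢0⇒numerator≢0 mu w ≢0)))
    step : Dec (cyclePairs g ≡ m) → InSpan θ
    step (no q≢m) = eliminate m gs θ cl λ w → [ inj₁ , skip q≢m w ]′ (supp w)
    step (yes q≡m) = span-+ {θ = θ′} {q = c} mu (eliminate m gs θ′ cl′ (supp′ q≡m)) (λ w → sym (restore (θ w) (c ℚ.* ε mu w)))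

  expansion-exists : ∀ θ → IsClassFunction θ → InSpan θ
  -- There are `n * n` ordered pairs, written in the form left by two uses of `∑-const`. At the
  -- level one above this bound every permutation is pending.
  expansion-exists θ cl = eliminate (suc (n ℕ.* (n ℕ.* 1))) [] θ cl λ w → inj₂ (inj₁ (s≤s (bound w)))
    where
    ≤1 : ∀ {P : Set} (d : Dec P) → [ d ]? ℕ.≤ 1
    ≤1 (yes _) = ℕ.≤-refl
    ≤1 (no _) = z≤n
    bound : ∀ w → cyclePairs w ℕ.≤ n ℕ.* (n ℕ.* 1)
    bound w = ℕ.≤-trans (∑-mono λ i → ℕ.≤-trans (∑-mono λ j → ≤1 (sameCycle? w i j)) (ℕ.≤-reflexive (∑-const n 1))) (ℕ.≤-reflexive (∑-const n (n ℕ.* 1)))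

trace-evaluation : ∀ {n} (P : FinitePoset n) (θ : Permutation′ n → ℚ) → IsClassFunction θ → θ ⟦ inc P ⟧≔ Evaluation.evaluate P θ
trace-evaluation P θ cl = record
  { c = Colourings.count P
  ; c-counts = Colourings.size-colourings P
  ; expansion = expansion-exists θ cl
  ; evaluation = Evaluation.evaluation-unique P
  }

-- Cyclic tableaux and cyclic covers

abstract
  injective⇒surjective : ∀ {n} {f : Fin n → Fin n} → Injective _≡_ _≡_ f → ∀ y → ∃[ x ] f x ≡ y
  injective⇒surjective {suc n} {f} inj y with Fin.any? (λ x → f x Fin.≟ y)
  ... | yes e = e
  ... | no ∄ = contradiction (Fin.injective⇒≤ {f = λ x → Fin.punchOut {i = y} {f x} (λ e → ∄ (x , sym e))}
        (λ {a} {b} e → inj (Fin.punchOut-injective (λ e → ∄ (a , sym e)) (λ e → ∄ (b , sym e)) e))) ℕ.1+n≰n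

next-injective : ∀ {m} {a b c : Fin m} → Next a c → Next b c → a ≡ b
next-injective (inj₁ p) (inj₁ q) = Fin.toℕ-injective (ℕ.suc-injective (trans (sym p) q))
next-injective (inj₂ (p , _)) (inj₂ (q , _)) = Fin.toℕ-injective (ℕ.suc-injective (trans p (sym q)))
next-injective (inj₁ p) (inj₂ (_ , q)) = contradiction (trans (sym p) q) λ ()
next-injective (inj₂ (_ , q)) (inj₁ p) = contradiction (trans (sym p) q) λ ()

next? : ∀ {m} (a b : Fin m) → Dec (Next a b)
next? {m} a b = (toℕ b ℕ.≟ suc (toℕ a)) ⊎-dec ((suc (toℕ a) ℕ.≟ m) ×-dec (toℕ b ℕ.≟ 0))

does⇒ : {A : Set} (d : Dec A) → T (does d) → A
does⇒ (yes a) _ = a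

⇒does : {A : Set} (d : Dec A) → A → T (does d)
⇒does (yes _) _ = tt
⇒does (no ¬a) a = ¬a a

T-irrelevant : ∀ {b} (p q : T b) → p ≡ q
T-irrelevant {true} _ _ = refl

T-≡ : ∀ {b c} → (T b → T c) → (T c → T b) → b ≡ c
T-≡ {true} {true} _ _ = refl
T-≡ {false} {false} _ _ = refl
T-≡ {true} {false} f _ = ⊥-elim (f tt)
T-≡ {false} {true} _ g = ⊥-elim (g tt)

T-Σ-≡ : {V : Set} {I : V → Bool} {x y : Σ[ v ∈ V ] v ∈ I} → proj₁ x ≡ proj₁ y → x ≡ y
T-Σ-≡ {x = v , p} {.v , q} refl = cong (v ,_) (T-irrelevant p q)

module CyclicTableaux {n} (P : FinitePoset n) (lam : Partition n) where
  open PosetFacts P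
  open Evaluation P using (NoDrop; noDrop?; free; evaluate)
  open Boxes lam
  open Isomorphisms lam

  -- Row-semistrictness and the wrap-around condition in one: `Next` is the arc relation of the
  -- cycle graph, the form shared with cyclic covers.
  CyclicRows : Tableau P lam → Set
  CyclicRows U = ∀ i {j j′} → Next j j′ → ¬ entry P lam U i j′ < entry P lam U i j

  cyclic⇒ : ∀ U → CyclicallyRowSemistrict P lam U → CyclicRows U
  cyclic⇒ U (semi , wrap) i {j} {j′} (inj₁ e) = semi i j j′ e
  cyclic⇒ U (semi , wrap) i {j} {j′} (inj₂ (l , f)) = wrap i j′ j f l

  ⇒cyclic : ∀ U → CyclicRows U → CyclicallyRowSemistrict P lam U
  ⇒cyclic U c = (λ i j j′ e → c i (inj₁ e)) , (λ i f l p q → c i (inj₂ (q , p)))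

  Cyclic : Setoid 0ℓ 0ℓ
  Cyclic = Tableaux P lam such-that CyclicallyRowSemistrict P lam

  box : (U : Tableau P lam) → ∀ x → ∃[ b ] proj₁ U b ≡ x
  box (U , _ , surj) x = let (b , e) = surj x in b , e refl

  nextBox : BoxOf → BoxOf
  nextBox (i , j) = i , proj₁ (next j)

  nextBox-injective : ∀ {b c} → nextBox b ≡ nextBox c → b ≡ c
  nextBox-injective {i , j} {i′ , j′} e = at (cong proj₁ e) e
    where
    at : ∀ {i i′} {j : Fin (part lam i)} {j′ : Fin (part lam i′)} → i ≡ i′ → nextBox (i , j) ≡ nextBox (i′ , j′) → _≡_ {A = BoxOf} (i , j) (i′ , j′)
    at {i} {j = j} {j′} refl e = cong (i ,_) (next-injective (proj₂ (next j)) (subst (Next j′) (sym (same-row-≡ e)) (proj₂ (next j′))))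

  successor : Tableau P lam → Fin n → Fin n
  successor U x = index (proj₁ U (nextBox (proj₁ (box U (elem x)))))

  successor-at : ∀ U b → successor U (index (proj₁ U b)) ≡ index (proj₁ U (nextBox b))
  successor-at U b = cong (index ∘ proj₁ U ∘ nextBox) (proj₁ (proj₂ U) (trans (proj₂ (box U (elem (index (proj₁ U b))))) (elem-index _)))

  index-injective : ∀ {x y} → index x ≡ index y → x ≡ y
  index-injective e = trans (sym (elem-index _)) (trans (cong elem e) (elem-index _))

  successor-injective : ∀ U → Injective _≡_ _≡_ (successor U)
  successor-injective U {x} {y} e = elem-injective (trans (sym (proj₂ (box U (elem x)))) (trans (cong (proj₁ U) (nextBox-injective (proj₁ (proj₂ U) (index-injective e)))) (proj₂ (box U (elem y)))))

  -- Carries each entry to the next one of its row, read cyclically, so its cycles are the rows of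
  -- the tableau.
  rotation : Tableau P lam → Permutation′ n
  rotation U = permutation (successor U) (λ y → proj₁ (pre y)) (λ y → proj₂ (pre y)) (λ x → successor-injective U (proj₂ (pre (successor U x))))
    where pre = injective⇒surjective (successor-injective U)

  weight : Permutation′ n → ℕ
  weight w = if does (noDrop? w) then (if does (hasCycleType? lam w) then z lam else 0) else 0

  Fibre : Permutation′ n → Setoid 0ℓ 0ℓ
  Fibre w = Cyclic such-that λ (U , _) → rotation U Perm.≈ w

  cyclic⇒noDrop : ∀ w → ∣ Fibre w ∣ₛ → NoDrop w
  cyclic⇒noDrop w ((U , c) , e) x lt = let (b , q) = box U (elem x) in
    cyclic⇒ U c (proj₁ b) (proj₂ (next (proj₂ b))) (subst (λ (s , t) → s < t) (cong₂ _,_ (trans (cong elem (sym (e x))) (elem-index _)) (sym q)) lt)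

  -- A tableau with rotation `w` is an identification of the diagram with the cycles of `w`. The
  -- cyclic condition on it says that `w` has no drop.
  Fibre≅Isos : ∀ w → NoDrop w → Isos w ≅ Fibre w
  Fibre≅Isos w nd = injection+section {Isos w} {Fibre w}
    (λ (V , bij , f) → ((elem ∘ V , toBij bij) , ⇒cyclic (elem ∘ V , toBij bij) λ i {j} {j′} s lt →
        nd (V (i , j)) (subst (λ x → elem x < elem (V (i , j))) (f i s) lt)) ,
        λ x → let (b , q) = box (elem ∘ V , toBij bij) (elem x) in trans (index-elem _) (trans (f (proj₁ b) (proj₂ (next (proj₂ b)))) (cong (w ⟨$⟩ʳ_) (elem-injective q))))
    (λ ((U , c) , e) → index ∘ proj₁ U , fromBij (proj₂ U) , λ i {j} {j′} s →
        trans (cong (λ k → index (proj₁ U (i , k))) (next-functional s (proj₂ (next j)))) (trans (sym (successor-at U (i , j))) (e (index (proj₁ U (i , j))))))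
    (λ e b → cong elem (e b))
    (λ e b → elem-injective (e b))
    (λ ((U , _) , _) b → elem-index _)
    where
    toBij : ∀ {V : BoxOf → Fin n} → Bijective _≡_ _≡_ V → Bijective _≡_ _≡_ (elem ∘ V)
    toBij (inj , surj) = (λ e → inj (elem-injective e)) , λ y → proj₁ (surj (index y)) , λ { refl → trans (cong elem (proj₂ (surj (index y)) refl)) (elem-index y) }
    fromBij : ∀ {U : BoxOf → Carrier} → Bijective _≡_ _≡_ U → Bijective _≡_ _≡_ (index ∘ U)
    fromBij (inj , surj) = (λ e → inj (index-injective e)) , λ y → proj₁ (surj (elem y)) , λ { refl → trans (cong index (proj₂ (surj (elem y)) refl)) (index-elem y) }

  size-Fibre : ∀ w → HasSize (Fibre w) (weight w)
  size-Fibre w = on (noDrop? w)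
    where
    on : (d : Dec (NoDrop w)) → HasSize (Fibre w) (if does d then (if does (hasCycleType? lam w) then z lam else 0) else 0)
    on (yes nd) = size-≅ (Fibre≅Isos w nd) (count-Isos w (hasCycleType? lam w))
    on (no ¬nd) = size-empty {Fibre w} (¬nd ∘ cyclic⇒noDrop w)

  N : ℕ
  N = ∑ᴺ (weight ∘ Inverse.to (size-Perms n))

  size-Cyclic : HasSize Cyclic N
  size-Cyclic = size-fibres {Perms n} {Cyclic} (λ (U , _) → rotation U)
    (λ {(U , _)} {(V , _)} e x → rotation-cong U V e x) (size-Perms n) weight size-Fibre
    where
    rotation-cong : ∀ U V → (∀ b → proj₁ U b ≡ proj₁ V b) → ∀ x → successor U x ≡ successor V x
    rotation-cong U V e x = trans (cong index (e _)) (cong (index ∘ proj₁ V ∘ nextBox)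
      (proj₁ (proj₂ V) (trans (sym (e _)) (trans (proj₂ (box U (elem x))) (sym (proj₂ (box V (elem x))))))))

  -- At a drop-free `w` the value of `ψ lam` is the number of cyclic tableaux with rotation `w`, so
  -- the sum is the one by which `size-Cyclic` counts them.
  evaluate-ψ : evaluate (ψ lam) ≡ + N / 1
  evaluate-ψ = trans (ℚ∑.∑ₚ-cong (λ w → term w (noDrop? w) (hasCycleType? lam w)))
    (trans (sym (ι-∑ (λ w → + weight w))) (cong ι (sym (+-∑ (weight ∘ Inverse.to (size-Perms n))))))
    where
    term : ∀ w (d : Dec (NoDrop w)) (e : Dec (HasCycleType lam w)) →
      (if does e then (+ z lam) / 1 else 0ℚ) ℚ.* ι (indicatorᶻ d) ≡ ι (+ (if does d then (if does e then z lam else 0) else 0))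
    term w (yes _) (yes _) = ℚ.*-identityʳ (ι (+ z lam))
    term w (yes _) (no _) = refl
    term w (no _) (yes _) = ℚ.*-zeroʳ (ι (+ z lam))
    term w (no _) (no _) = refl

  -- There are as many boxes as elements, so the numberings of both turn `U` into an injective
  -- self-map of `Fin n`.
  boxes-surjective : ∀ {U : BoxOf → Carrier} → Injective _≡_ _≡_ U → Bijective _≡_ _≡_ U
  boxes-surjective {U} inj = inj , λ y →
    let (x , e) = injective⇒surjective {f = index ∘ U ∘ Inverse.to boxes} (λ e → boxes-injective (inj (index-injective e))) (index y) in
    Inverse.to boxes x , λ { refl → index-injective e }
    where
    boxes-injective : ∀ {x y} → Inverse.to boxes x ≡ Inverse.to boxes y → x ≡ y
    boxes-injective {x} {y} e = trans (sym (Inverse.inverseʳ boxes {x} refl)) (trans (cong (Inverse.from boxes) e) (Inverse.inverseʳ boxes {y} refl))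

  module FromCover (X : CyclicCover (ngr P) lam) where
    private
      module I i = DigraphIso (iso X i)

    vertex : BoxOf → Carrier
    vertex (i , k) = cycleVertex X i k

    vertex∈ : ∀ i k → vertex (i , k) ∈ vertices (H X i)
    vertex∈ i k = proj₂ (I.to i k)

    locate : ∀ i {v} → v ∈ vertices (H X i) → ∃[ k ] vertex (i , k) ≡ v
    locate i {v} p = Inverse.from (I.bijection i) (v , p) , cong proj₁ (Inverse.inverseˡ (I.bijection i) refl)

    arc⇒next : ∀ i {u v} → T (arcs (H X i) u v) → ∃[ k ] ∃[ k′ ] vertex (i , k) ≡ u × vertex (i , k′) ≡ v × Next k k′
    arc⇒next i a = let (p , q) = ends (H X i) a ; (k , e) = locate i p ; (k′ , e′) = locate i q in
      k , k′ , e , e′ , Equivalence.from (I.preserves i k k′) (subst (λ (u , v) → T (arcs (H X i) u v)) (sym (cong₂ _,_ e e′)) a)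

    next⇒arc : ∀ i {k k′} → Next k k′ → T (arcs (H X i) (vertex (i , k)) (vertex (i , k′)))
    next⇒arc i {k} {k′} = Equivalence.to (I.preserves i k k′)

    vertex-injective : Injective _≡_ _≡_ vertex
    vertex-injective {i , k} {i′ , k′} e = by-row (i Fin.≟ i′) k k′ e
      where
      by-row : ∀ {i i′} → Dec (i ≡ i′) → ∀ k k′ → vertex (i , k) ≡ vertex (i′ , k′) → _≡_ {A = BoxOf} (i , k) (i′ , k′)
      by-row {i} (yes refl) k k′ e = cong (i ,_) (trans (sym (Inverse.inverseʳ (I.bijection i) refl)) (trans (cong (Inverse.from (I.bijection i)) (T-Σ-≡ e)) (Inverse.inverseʳ (I.bijection i) refl)))
      by-row {i} {i′} (no i≢i′) k k′ e = ⊥-elim (CyclicCover.disjoint X i≢i′ (vertex∈ i k) (subst (_∈ vertices (H X i′)) (sym e) (vertex∈ i′ k′)))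

    tableau : ∣ Cyclic ∣ₛ
    tableau = (vertex , boxes-surjective vertex-injective) , ⇒cyclic (vertex , boxes-surjective vertex-injective) λ i s → arcs⊆ (H X i) (next⇒arc i s)

  module ToCover (U : Tableau P lam) (cyclic : CyclicRows U) where
    private
      inj = proj₁ (proj₂ U)

    InRow : Fin (len lam) → Carrier → Set
    InRow i v = ∃[ k ] entry P lam U i k ≡ v

    inRow? : ∀ i v → Dec (InRow i v)
    inRow? i v = Fin.any? λ k → entry P lam U i k ≟ v

    Joined : Fin (len lam) → Carrier → Carrier → Set
    Joined i u v = ∃[ k ] ∃[ k′ ] entry P lam U i k ≡ u × entry P lam U i k′ ≡ v × Next k k′

    joined? : ∀ i u v → Dec (Joined i u v)
    joined? i u v = Fin.any? λ k → Fin.any? λ k′ → (entry P lam U i k ≟ u) ×-dec (entry P lam U i k′ ≟ v) ×-dec next? k k′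

    position : ∀ {i} {k k′ : Fin (part lam i)} → entry P lam U i k ≡ entry P lam U i k′ → k ≡ k′
    position e = same-row-≡ (inj e)

    rowCycle : Fin (len lam) → Subdigraph (ngr P)
    rowCycle i = record
      { vertices = λ v → does (inRow? i v)
      ; arcs = λ u v → does (joined? i u v)
      ; arcs⊆ = λ {u} {v} a → let (k , k′ , e , e′ , s) = does⇒ (joined? i u v) a in
          subst (λ (u , v) → ¬ v < u) (cong₂ _,_ e e′) (cyclic i s)
      ; ends = λ {u} {v} a → let (k , k′ , e , e′ , s) = does⇒ (joined? i u v) a in
          ⇒does (inRow? i u) (k , e) , ⇒does (inRow? i v) (k′ , e′)
      }

    cover : CyclicCover (ngr P) lam
    cover = record
      { H = rowCycle
      ; disjoint = λ {i} {j} {v} i≢j p q →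
          let (k , e) = does⇒ (inRow? i v) p ; (k′ , e′) = does⇒ (inRow? j v) q in
          i≢j (cong proj₁ (inj {i , k} {j , k′} (trans e (sym e′))))
      ; iso = λ i → record
        { bijection = injection+section {setoid (Fin (part lam i))} {setoid (Σ[ v ∈ Carrier ] v ∈ vertices (rowCycle i))}
            (λ k → entry P lam U i k , ⇒does (inRow? i (entry P lam U i k)) (k , refl))
            (λ (v , p) → proj₁ (does⇒ (inRow? i v) p))
            (λ { refl → refl }) (λ e → position (cong proj₁ e)) (λ (v , p) → T-Σ-≡ (proj₂ (does⇒ (inRow? i v) p)))
        ; preserves = λ k k′ → mk⇔
            (λ s → ⇒does (joined? i (entry P lam U i k) (entry P lam U i k′)) (k , k′ , refl , refl , s))
            (λ a → let (l , l′ , e , e′ , s) = does⇒ (joined? i (entry P lam U i k) (entry P lam U i k′)) a in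
              subst (λ (k , k′) → Next k k′) (cong₂ _,_ (position e) (position e′)) s)
        }
      }

  -- As the isomorphisms with the cycle graphs are part of a cover, the sequence of cycle vertices
  -- determines its vertex sets and its arcs; this gives injectivity.
  covers≅cyclic : CyclicCovers (ngr P) lam ≅ Cyclic
  covers≅cyclic = injection+section {CyclicCovers (ngr P) lam} {Cyclic}
    FromCover.tableau (λ (U , c) → ToCover.cover U (cyclic⇒ U c))
    (λ (_ , _ , r) (i , k) → r i k)
    (λ {X} {Y} e → (λ i v → T-≡ (vertices⊆ X Y e i) (vertices⊆ Y X (sym ∘ e) i))
                 , (λ i u v → T-≡ (arcs⊆′ X Y e i) (arcs⊆′ Y X (sym ∘ e) i))
                 , (λ i k → e (i , k)))
    (λ _ _ → refl)
    where
    vertices⊆ : ∀ X Y → (∀ b → FromCover.vertex X b ≡ FromCover.vertex Y b) → ∀ i {v} → v ∈ vertices (H X i) → v ∈ vertices (H Y i)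
    vertices⊆ X Y e i p = let (k , q) = FromCover.locate X i p in
      subst (_∈ vertices (H Y i)) (trans (sym (e (i , k))) q) (FromCover.vertex∈ Y i k)
    arcs⊆′ : ∀ X Y → (∀ b → FromCover.vertex X b ≡ FromCover.vertex Y b) → ∀ i {u v} → T (arcs (H X i) u v) → T (arcs (H Y i) u v)
    arcs⊆′ X Y e i a = let (k , k′ , p , q , s) = FromCover.arc⇒next X i a in
      subst (λ (u , v) → T (arcs (H Y i) u v)) (cong₂ _,_ (trans (sym (e (i , k))) p) (trans (sym (e (i , k′))) q)) (FromCover.next⇒arc Y i s)

-- Cyclic and record-free words

module _ {V : Set} (R : Rel V 0ℓ) where

  Path : V → List V → Set
  Path v [] = ⊤
  Path v (x ∷ a) = R v x × Path x a

path? : ∀ {V : Set} {R : Rel V 0ℓ} → (∀ x y → Dec (R x y)) → ∀ v a → Dec (Path R v a)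
path? R? v [] = yes tt
path? R? v (x ∷ a) = R? v x ×-dec path? R? x a

module _ {V : Set} where

  lastOf : V → List V → V
  lastOf v [] = v
  lastOf v (x ∷ a) = lastOf x a

  dropLast : List V → List V
  dropLast [] = []
  dropLast (x ∷ []) = []
  dropLast (x ∷ y ∷ a) = x ∷ dropLast (y ∷ a)

  lastOf-∷ʳ : ∀ v a z → lastOf v (a ∷ʳ z) ≡ z
  lastOf-∷ʳ v [] z = refl
  lastOf-∷ʳ v (x ∷ a) z = lastOf-∷ʳ x a z

  dropLast-∷ʳ : ∀ a z → dropLast (a ∷ʳ z) ≡ a
  dropLast-∷ʳ [] z = refl
  dropLast-∷ʳ (x ∷ []) z = refl
  dropLast-∷ʳ (x ∷ y ∷ a) z = cong (x ∷_) (dropLast-∷ʳ (y ∷ a) z)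

  dropLast-lastOf : ∀ v x a → dropLast (x ∷ a) ∷ʳ lastOf v (x ∷ a) ≡ x ∷ a
  dropLast-lastOf v x [] = refl
  dropLast-lastOf v x (y ∷ a) = cong (x ∷_) (dropLast-lastOf v y a)

  path-∷ʳ⁺ : ∀ {R : Rel V 0ℓ} v a {z} → Path R v a → R (lastOf v a) z → Path R v (a ∷ʳ z)
  path-∷ʳ⁺ v [] p r = r , tt
  path-∷ʳ⁺ v (x ∷ a) (q , p) r = q , path-∷ʳ⁺ x a p r

  path-∷ʳ⁻ : ∀ {R : Rel V 0ℓ} v a {z} → Path R v (a ∷ʳ z) → Path R v a × R (lastOf v a) z
  path-∷ʳ⁻ v [] (r , _) = tt , r
  path-∷ʳ⁻ v (x ∷ a) (q , p) = let (p′ , r) = path-∷ʳ⁻ x a p in (q , p′) , r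

module Words {n} (P : FinitePoset n) where
  open PosetFacts P

  infix 4 _≯_
  _≯_ : Rel Carrier 0ℓ
  x ≯ y = ¬ y < x

  Word : Set
  Word = List Carrier

  occurrences : Carrier → Word → ℕ
  occurrences x [] = 0
  occurrences x (y ∷ a) = [ x ≟ y ]? ℕ.+ occurrences x a

  occurrences-++ : ∀ x a b → occurrences x (a ++ b) ≡ occurrences x a ℕ.+ occurrences x b
  occurrences-++ x [] b = refl
  occurrences-++ x (y ∷ a) b = trans (cong ([ x ≟ y ]? ℕ.+_) (occurrences-++ x a b)) (sym (ℕ.+-assoc [ x ≟ y ]? _ _))

  occurrences-insert : ∀ x a r b → occurrences x (a ++ r ∷ b) ≡ [ x ≟ r ]? ℕ.+ occurrences x (a ++ b)
  occurrences-insert x a r b = begin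
    occurrences x (a ++ r ∷ b)                            ≡⟨ occurrences-++ x a (r ∷ b) ⟩
    occurrences x a ℕ.+ ([ x ≟ r ]? ℕ.+ occurrences x b)  ≡⟨ sym (ℕ.+-assoc (occurrences x a) _ _) ⟩
    occurrences x a ℕ.+ [ x ≟ r ]? ℕ.+ occurrences x b    ≡⟨ cong (ℕ._+ occurrences x b) (ℕ.+-comm (occurrences x a) _) ⟩
    [ x ≟ r ]? ℕ.+ occurrences x a ℕ.+ occurrences x b    ≡⟨ ℕ.+-assoc [ x ≟ r ]? _ _ ⟩
    [ x ≟ r ]? ℕ.+ (occurrences x a ℕ.+ occurrences x b)  ≡⟨ cong ([ x ≟ r ]? ℕ.+_) (sym (occurrences-++ x a b)) ⟩
    [ x ≟ r ]? ℕ.+ occurrences x (a ++ b) ∎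
    where open ≡-Reasoning

  -- A multiset of letters as data with decidable equality. The length is recorded too, because it
  -- bounds the enumeration of words and the number of levels in the induction.
  Key : Set
  Key = ℕ × Vec ℕ n

  key : Word → Key
  key a = length a , Vec.tabulate (λ i → occurrences (elem i) a)

  key-≡ : ∀ a b → length a ≡ length b → (∀ x → occurrences x a ≡ occurrences x b) → key a ≡ key b
  key-≡ a b p q = cong₂ _,_ p (VecP.tabulate-cong (q ∘ elem))

  key-occurrences : ∀ {a b} → key a ≡ key b → ∀ x → occurrences x a ≡ occurrences x b
  key-occurrences {a} {b} e x = subst (λ x → occurrences x a ≡ occurrences x b) (elem-index x)
    (trans (sym (VecP.lookup∘tabulate (λ i → occurrences (elem i) a) (index x)))
    (trans (cong (λ k → Vec.lookup (proj₂ k) (index x)) e) (VecP.lookup∘tabulate (λ i → occurrences (elem i) b) (index x))))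

  -- `prev` collects the letters already read. The first letter of a row enters only through `prev`,
  -- so it never counts as a record itself.
  NoRecord : Word → Word → Set
  NoRecord prev [] = ⊤
  NoRecord prev (x ∷ a) = ¬ All (_< x) prev × NoRecord (x ∷ prev) a

  record FirstRecord (prev a : Word) : Set where
    constructor firstRecord
    field
      before : Word
      rec : Carrier
      after : Word
      split : a ≡ before ++ rec ∷ after
      none-before : NoRecord prev before
      above-prev : All (_< rec) prev
      above-before : All (_< rec) before

  scan : ∀ prev a → NoRecord prev a ⊎ FirstRecord prev a
  scan prev [] = inj₁ tt
  scan prev (x ∷ a) = step (All.all? (_<? x) prev) (scan (x ∷ prev) a)
    where
    step : Dec (All (_< x) prev) → NoRecord (x ∷ prev) a ⊎ FirstRecord (x ∷ prev) a → NoRecord prev (x ∷ a) ⊎ FirstRecord prev (x ∷ a)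
    step (yes p) _ = inj₂ (firstRecord [] x a refl tt p [])
    step (no ¬p) (inj₁ q) = inj₁ (¬p , q)
    step (no ¬p) (inj₂ (firstRecord b r c e q (x<r ∷ p) p′)) = inj₂ (firstRecord (x ∷ b) r c (cong (x ∷_) e) (¬p , q) p (x<r ∷ p′))

  noRecord-firstRecord : ∀ {prev a} → NoRecord prev a → ¬ FirstRecord prev a
  noRecord-firstRecord {a = []} _ (firstRecord [] _ _ () _ _ _)
  noRecord-firstRecord {a = []} _ (firstRecord (_ ∷ _) _ _ () _ _ _)
  noRecord-firstRecord {a = x ∷ a} (¬p , q) (firstRecord [] .x .a refl _ p _) = ¬p p
  noRecord-firstRecord {a = x ∷ a} (¬p , q) (firstRecord (.x ∷ b) r c refl (_ , nb) p (x<r ∷ p′)) =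
    noRecord-firstRecord q (firstRecord b r c refl nb (x<r ∷ p) p′)

  firstRecord-unique : ∀ {prev a} (f g : FirstRecord prev a) →
    FirstRecord.before f ≡ FirstRecord.before g × FirstRecord.rec f ≡ FirstRecord.rec g × FirstRecord.after f ≡ FirstRecord.after g
  firstRecord-unique {a = []} (firstRecord [] _ _ () _ _ _)
  firstRecord-unique {a = []} (firstRecord (_ ∷ _) _ _ () _ _ _)
  firstRecord-unique {a = x ∷ a} (firstRecord [] .x .a refl _ _ _) (firstRecord [] .x .a refl _ _ _) = refl , refl , refl
  firstRecord-unique {a = x ∷ a} (firstRecord [] .x .a refl _ p _) (firstRecord (.x ∷ _) _ _ refl (¬p , _) _ _) = contradiction p ¬p
  firstRecord-unique {a = x ∷ a} (firstRecord (.x ∷ _) _ _ refl (¬p , _) _ _) (firstRecord [] .x .a refl _ p _) = contradiction p ¬p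
  firstRecord-unique {prev} {x ∷ a} (firstRecord (y ∷ b) r c e (_ , nb) p (y<r ∷ q)) (firstRecord (y′ ∷ b′) r′ c′ e′ (_ , nb′) p′ (y′<r′ ∷ q′))
    with refl , e₁ ← List.∷-injective e | refl , e₁′ ← List.∷-injective e′ =
    let (u , v , w) = firstRecord-unique {x ∷ prev} {a} (firstRecord b r c e₁ nb (y<r ∷ p) q) (firstRecord b′ r′ c′ e₁′ nb′ (y′<r′ ∷ p′) q′)
    in cong (x ∷_) u , v , w

  -- Undoes the removal of a first record from a semistrict word: the letters before the record lie
  -- below it, while the letter after it does not.
  insertBelow : Carrier → Word → Word
  insertBelow r [] = r ∷ []
  insertBelow r (x ∷ a) = if does (x <? r) then x ∷ insertBelow r a else r ∷ x ∷ a

  HeadNotBelow : Carrier → Word → Set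
  HeadNotBelow r [] = ⊤
  HeadNotBelow r (x ∷ _) = ¬ x < r

  insertBelow-++ : ∀ r a {b} → All (_< r) a → HeadNotBelow r b → insertBelow r (a ++ b) ≡ a ++ r ∷ b
  insertBelow-++ r [] {[]} _ _ = refl
  insertBelow-++ r [] {x ∷ b} _ h rewrite dec-false (x <? r) h = refl
  insertBelow-++ r (x ∷ a) (p ∷ ps) h rewrite dec-true (x <? r) p = cong (x ∷_) (insertBelow-++ r a ps h)

  record Cut (r : Carrier) (b : Word) : Set where
    constructor mkCut
    field
      low : Word
      high : Word
      joined : b ≡ low ++ high
      all-low : All (_< r) low
      head-high : HeadNotBelow r high

  cut : ∀ r b → Cut r b
  cut r [] = mkCut [] [] refl [] tt
  cut r (x ∷ b) = step (x <? r) (cut r b)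
    where
    step : Dec (x < r) → Cut r b → Cut r (x ∷ b)
    step (yes p) (mkCut l h e q q′) = mkCut (x ∷ l) h (cong (x ∷_) e) (p ∷ q) q′
    step (no ¬p) _ = mkCut [] (x ∷ b) refl [] ¬p

  insertBelow-cut : ∀ {r b} (c : Cut r b) → insertBelow r b ≡ Cut.low c ++ r ∷ Cut.high c
  insertBelow-cut {r} (mkCut l h refl q q′) = insertBelow-++ r l q q′

  path-insert : ∀ v a {r b} → Path _≯_ v (a ++ b) → v < r → All (_< r) a → HeadNotBelow r b → Path _≯_ v (a ++ r ∷ b)
  path-insert v [] {r} {[]} _ v<r _ _ = (λ r<v → <-irrefl (<-trans v<r r<v)) , tt
  path-insert v [] {r} {x ∷ b} (_ , p) v<r _ h = (λ r<v → <-irrefl (<-trans v<r r<v)) , h , p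
  path-insert v (x ∷ a) (q , p) v<r (x<r ∷ ps) h = q , path-insert x a p x<r ps h

  -- If the letter after `r` were below the letter before `r`, it would be below `r`, contrary to
  -- semistrictness.
  path-remove : ∀ v a {r b} → Path _≯_ v (a ++ r ∷ b) → v < r → All (_< r) a → Path _≯_ v (a ++ b)
  path-remove v [] {r} {[]} _ _ _ = tt
  path-remove v [] {r} {x ∷ b} (_ , r≯x , p) v<r _ = (λ x<v → r≯x (<-trans x<v v<r)) , p
  path-remove v (x ∷ a) (q , p) v<r (x<r ∷ ps) = q , path-remove x a p x<r ps

  path-head : ∀ v a {r b} → Path _≯_ v (a ++ r ∷ b) → HeadNotBelow r b
  path-head v [] {b = []} _ = tt
  path-head v [] {b = x ∷ b} (_ , h , _) = h
  path-head v (x ∷ a) (_ , p) = path-head x a p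

  module Marked (v : Carrier) (K : Key) where

    Pair : Set
    Pair = Word × Word

    -- Only the joint content of chain and word is fixed, so both moves stay inside content `K`, and
    -- each level is finite.
    E : ℕ → Pair → Set
    E k (s , a) = length s ≡ k × key (s ++ a) ≡ K × Path _<_ v s × Path _≯_ v a

    -- The condition under which the last letter of the word can join the chain at the top. For the
    -- empty chain it is the failure of the cyclic condition.
    X : Pair → Set
    X (s , a) = lastOf v s < lastOf v a

    Below : Word → Carrier → Set
    Below [] r = ⊤
    Below (t ∷ _) r = r < t

    below? : ∀ s r → Dec (Below s r)
    below? [] r = yes tt
    below? (t ∷ _) r = r <? t

    -- The condition under which the first record can join the chain at the bottom. For the empty
    -- chain it is the existence of a record.
    Y : Pair → Set
    Y (s , a) = Σ[ f ∈ FirstRecord (v ∷ []) a ] Below s (FirstRecord.rec f)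

    y? : ∀ p → Dec (Y p)
    y? (s , a) = step (scan (v ∷ []) a)
      where
      step : NoRecord (v ∷ []) a ⊎ FirstRecord (v ∷ []) a → Dec (Y (s , a))
      step (inj₁ none) = no λ (f , _) → noRecord-firstRecord none f
      step (inj₂ f) = map′ (f ,_) (λ (g , b) → subst (Below s) (proj₁ (proj₂ (firstRecord-unique g f))) b) (below? s (FirstRecord.rec f))

    ES : ℕ → Setoid 0ℓ 0ℓ
    ES k = setoid Pair such-that E k

    Lists : ℕ → Setoid 0ℓ 0ℓ
    Lists m = setoid Word such-that λ a → length a ≡ m

    size-Lists : ∀ m → HasSize (Lists m) (n ℕ.^ m)
    size-Lists zero = size-one {Lists 0} ([] , refl) λ { ([] , _) → refl }
    size-Lists (suc m) = size-≅ (injection+section {setoid Carrier ×ₛ Lists m} {Lists (suc m)}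
        (λ (x , a , e) → x ∷ a , cong suc e) (λ { (x ∷ a , e) → x , a , ℕ.suc-injective e })
        (λ { (refl , refl) → refl }) (λ e → List.∷-injective e) (λ { (x ∷ a , e) → refl }))
      (size-× {setoid Carrier} {Lists m} size (size-Lists m))

    key? : ∀ (k k′ : Key) → Dec (k ≡ k′)
    key? = ×P.≡-dec ℕ._≟_ (VecP.≡-dec ℕ._≟_)

    size-ES : ∀ k → ∃[ N ] HasSize (ES k) N
    size-ES k = _ , size-≅ (record
        { to = λ (((s , p) , (a , _)) , q) → (s , a) , p , q
        ; from = λ ((s , a) , p , q) → ((s , p) , (a , len-a {s} {a} p (proj₁ q))) , q
        ; to-cong = λ (p , q) → cong₂ _,_ p q
        ; from-cong = λ p → cong proj₁ p , cong proj₂ p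
        ; inverse = (λ (p , q) → cong₂ _,_ p q) , (λ p → cong proj₁ p , cong proj₂ p) })
      (size-such-that {Lists k ×ₛ Lists (proj₁ K ∸ k)} (size-× {Lists k} {Lists (proj₁ K ∸ k)} (size-Lists k) (size-Lists (proj₁ K ∸ k)))
        (λ { (refl , refl) q → q })
        (λ ((s , _) , (a , _)) → key? (key (s ++ a)) K ×-dec path? _<?_ v s ×-dec path? (λ x y → ¬? (y <? x)) v a))
      where
      len-a : ∀ {s a} → length s ≡ k → key (s ++ a) ≡ K → length a ≡ proj₁ K ∸ k
      len-a {s} {a} refl refl = sym (trans (cong (_∸ length s) (List.length-++ s)) (ℕ.m+n∸m≡n (length s) (length a)))

    move-key : ∀ s z a → key ((s ∷ʳ z) ++ a) ≡ key (s ++ a ∷ʳ z)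
    move-key s z a = key-≡ ((s ∷ʳ z) ++ a) (s ++ a ∷ʳ z)
      (trans (cong length (List.++-assoc s [ z ] a)) (trans (List.length-++ s) (trans (cong (length s ℕ.+_) (sym (trans (List.length-++ a) (ℕ.+-comm (length a) 1)))) (sym (List.length-++ s)))))
      (λ x → trans (cong (occurrences x) (List.++-assoc s [ z ] a)) (trans (occurrences-insert x s z a)
        (trans (cong (λ l → [ x ≟ z ]? ℕ.+ occurrences x l) (trans (cong (s ++_) (sym (List.++-identityʳ a))) (sym (List.++-assoc s a []))))
        (trans (sym (occurrences-insert x (s ++ a) z [])) (cong (occurrences x) (List.++-assoc s a [ z ]))))))

    -- Rules out the empty word under `X`: its last letter is read as `v`, and the top of a chain
    -- above `v` is not below `v`.
    path-last : ∀ {u} s → Path _<_ u s → ¬ lastOf u s < u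
    path-last [] _ lt = <-irrefl lt
    path-last {u} (x ∷ s) (u<x , p) lt = path-last s p (<-trans lt u<x)

    -- Moving the last letter of the word to the top of the chain.
    X≅ : ∀ k → (ES k such-that (X ∘ proj₁)) ≅ (ES (suc k) such-that (¬_ ∘ X ∘ proj₁))
    X≅ k = ≅-sym (injection+section {ES (suc k) such-that (¬_ ∘ X ∘ proj₁)} {ES k such-that (X ∘ proj₁)}
      (λ (((s , a) , len , ky , up , semi) , ¬x) → ((dropLast s , a ∷ʳ lastOf v s) , back s a len ky up semi ¬x) , back-X s a len up)
      (λ (((s , a) , e) , x) → ((s ∷ʳ lastOf v a , dropLast a) , forth s a e x) , forth-¬X s a e x)
      (λ { refl → refl })
      (λ {(((s , a) , len , _) , _)} {(((s′ , a′) , len′ , _) , _)} e → inj s a s′ a′ len len′ e)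
      (λ (((s , a) , e) , x) → sect s a e x))
      where
      E-back : ∀ s z a → E (suc k) (s ∷ʳ z , a) → ¬ X (s ∷ʳ z , a) → E k (s , a ∷ʳ z)
      E-back s z a (len , ky , up , semi) ¬x =
        ℕ.suc-injective (trans (sym (trans (List.length-++ s) (ℕ.+-comm (length s) 1))) len) , trans (sym (move-key s z a)) ky ,
        -- Since `z` is the top of the chain, `¬ X` is precisely the semistrict condition for
        -- appending `z` to the word.
        proj₁ (path-∷ʳ⁻ v s up) , path-∷ʳ⁺ v a semi (subst (λ t → ¬ t < lastOf v a) (lastOf-∷ʳ v s z) ¬x)
      rebuild : ∀ s → length s ≡ suc k → dropLast s ∷ʳ lastOf v s ≡ s
      rebuild (x ∷ s) _ = dropLast-lastOf v x s
      back : ∀ s a → length s ≡ suc k → key (s ++ a) ≡ K → Path _<_ v s → Path _≯_ v a → ¬ X (s , a) → E k (dropLast s , a ∷ʳ lastOf v s)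
      back s a len ky up semi ¬x = E-back (dropLast s) (lastOf v s) a
        (subst (λ s → E (suc k) (s , a)) (sym (rebuild s len)) (len , ky , up , semi)) (subst (λ s → ¬ X (s , a)) (sym (rebuild s len)) ¬x)
      back-X : ∀ s a → length s ≡ suc k → Path _<_ v s → X (dropLast s , a ∷ʳ lastOf v s)
      back-X s a len up = subst (lastOf v (dropLast s) <_) (sym (lastOf-∷ʳ v a (lastOf v s)))
        (proj₂ (path-∷ʳ⁻ v (dropLast s) (subst (Path _<_ v) (sym (rebuild s len)) up)))
      rebuild-a : ∀ s a → Path _<_ v s → X (s , a) → dropLast a ∷ʳ lastOf v a ≡ a
      rebuild-a s [] up x = contradiction x (path-last s up)
      rebuild-a s (y ∷ a) _ _ = dropLast-lastOf v y a
      forth : ∀ s a → E k (s , a) → X (s , a) → E (suc k) (s ∷ʳ lastOf v a , dropLast a)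
      forth s a (len , ky , up , semi) x =
        trans (List.length-++ s) (trans (ℕ.+-comm (length s) 1) (cong suc len)) ,
        trans (move-key s (lastOf v a) (dropLast a)) (trans (cong (λ a → key (s ++ a)) (rebuild-a s a up x)) ky) ,
        path-∷ʳ⁺ v s up x , proj₁ (path-∷ʳ⁻ v (dropLast a) (subst (Path _≯_ v) (sym (rebuild-a s a up x)) semi))
      forth-¬X : ∀ s a → E k (s , a) → X (s , a) → ¬ X (s ∷ʳ lastOf v a , dropLast a)
      forth-¬X s a (len , ky , up , semi) x lt = proj₂ (path-∷ʳ⁻ v (dropLast a) (subst (Path _≯_ v) (sym (rebuild-a s a up x)) semi))
        (subst (_< lastOf v (dropLast a)) (lastOf-∷ʳ v s (lastOf v a)) lt)
      inj : ∀ s a s′ a′ → length s ≡ suc k → length s′ ≡ suc k →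
        _≡_ {A = Pair} (dropLast s , a ∷ʳ lastOf v s) (dropLast s′ , a′ ∷ʳ lastOf v s′) → _≡_ {A = Pair} (s , a) (s′ , a′)
      inj s a s′ a′ len len′ e = let (p , q) = List.∷ʳ-injective a a′ (cong proj₂ e) in
        cong₂ _,_ (trans (sym (rebuild s len)) (trans (cong₂ _∷ʳ_ (cong proj₁ e) q) (rebuild s′ len′))) p
      sect : ∀ s a → E k (s , a) → X (s , a) → (dropLast (s ∷ʳ lastOf v a) , dropLast a ∷ʳ lastOf v (s ∷ʳ lastOf v a)) ≡ (s , a)
      sect s a (_ , _ , up , _) x = cong₂ _,_ (dropLast-∷ʳ s (lastOf v a)) (trans (cong (dropLast a ∷ʳ_) (lastOf-∷ʳ v s (lastOf v a))) (rebuild-a s a up x))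

    -- Moving the first record of the word to the bottom of the chain.
    Y≅ : ∀ k → (ES k such-that (Y ∘ proj₁)) ≅ (ES (suc k) such-that (¬_ ∘ Y ∘ proj₁))
    Y≅ k = ≅-sym (injection+section {ES (suc k) such-that (¬_ ∘ Y ∘ proj₁)} {ES k such-that (Y ∘ proj₁)}
      (λ { (((r ∷ s , b) , e) , ¬y) → ((s , insertBelow r b) , back r s b e) , back-Y r s b e ¬y })
      (λ (((s , a) , e) , f , bel) → ((FirstRecord.rec f ∷ s , FirstRecord.before f ++ FirstRecord.after f) , forth s a e f bel) , forth-¬Y s a e f)
      (λ { {((_ ∷ _ , _) , _) , _} refl → refl })
      (λ { {((r ∷ s , b) , e) , ¬y} {((r′ ∷ s′ , b′) , e′) , ¬y′} q → inj r s b e ¬y r′ s′ b′ e′ ¬y′ (cong proj₁ q) (cong proj₂ q) })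
      (λ (((s , a) , e) , f , bel) → cong (s ,_) (reinsert a f (proj₂ (proj₂ (proj₂ e))))))
      where
      insert-key : ∀ r s l h → key (s ++ l ++ r ∷ h) ≡ key (r ∷ s ++ l ++ h)
      insert-key r s l h = key-≡ (s ++ l ++ r ∷ h) (r ∷ s ++ l ++ h)
        (trans (cong length (sym (List.++-assoc s l (r ∷ h)))) (trans (List.length-++ (s ++ l)) (trans (ℕ.+-suc _ _) (cong suc (trans (sym (List.length-++ (s ++ l))) (cong length (List.++-assoc s l h)))))))
        (λ x → trans (cong (occurrences x) (sym (List.++-assoc s l (r ∷ h)))) (trans (occurrences-insert x (s ++ l) r h) (cong (λ c → [ x ≟ r ]? ℕ.+ occurrences x c) (List.++-assoc s l h))))
      chain-below : ∀ r s → v < r → Below s r → Path _<_ v s → Path _<_ v (r ∷ s)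
      chain-below r [] v<r _ _ = v<r , tt
      chain-below r (t ∷ s) v<r r<t (_ , p) = v<r , r<t , p
      below-chain : ∀ r s → Path _<_ r s → Below s r
      below-chain r [] _ = tt
      below-chain r (t ∷ s) (p , _) = p
      chain-tail : ∀ r s → Path _<_ v (r ∷ s) → Path _<_ v s
      chain-tail r [] _ = tt
      chain-tail r (t ∷ s) (v<r , r<t , p) = <-trans v<r r<t , p
      back : ∀ r s b → E (suc k) (r ∷ s , b) → E k (s , insertBelow r b)
      back r s b (len , ky , up , semi) = on (cut r b)
        where
        on : Cut r b → E k (s , insertBelow r b)
        on c@(mkCut l h refl ps hd) = subst (λ a → E k (s , a)) (sym (insertBelow-cut c))
          (ℕ.suc-injective len , trans (insert-key r s l h) ky , chain-tail r s up , path-insert v l semi (proj₁ up) ps hd)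
      recordAt : ∀ r s b → E (suc k) (r ∷ s , b) → ¬ Y (r ∷ s , b) → Σ[ f ∈ FirstRecord (v ∷ []) (insertBelow r b) ]
        FirstRecord.rec f ≡ r × FirstRecord.before f ++ FirstRecord.after f ≡ b
      recordAt r s b (_ , _ , up , _) ¬y = on (cut r b)
        where
        on : Cut r b → Σ[ f ∈ FirstRecord (v ∷ []) (insertBelow r b) ] FirstRecord.rec f ≡ r × FirstRecord.before f ++ FirstRecord.after f ≡ b
        on c@(mkCut l h refl ps hd) = firstRecord l r h (insertBelow-cut c) none (proj₁ up ∷ []) ps , refl , refl
          where
          none : NoRecord (v ∷ []) l
          -- A record inside `l` would be the first record of the whole word and lie below `r`,
          -- which is what `¬ y` forbids.
          none = [ id , (λ { (firstRecord p r′ q refl np ra rb) → contradiction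
            (firstRecord p r′ (q ++ h) (List.++-assoc p (r′ ∷ q) h) np ra rb , All.lookup ps (∈-insert p)) ¬y }) ]′ (scan (v ∷ []) l)
      back-Y : ∀ r s b (e : E (suc k) (r ∷ s , b)) → ¬ Y (r ∷ s , b) → Y (s , insertBelow r b)
      back-Y r s b e ¬y = let (f , p , _) = recordAt r s b e ¬y in f , subst (Below s) (sym p) (below-chain r s (proj₂ (proj₁ (proj₂ (proj₂ e)))))
      inj : ∀ r s b (e : E (suc k) (r ∷ s , b)) (¬y : ¬ Y (r ∷ s , b)) r′ s′ b′ (e′ : E (suc k) (r′ ∷ s′ , b′)) (¬y′ : ¬ Y (r′ ∷ s′ , b′)) →
        s ≡ s′ → insertBelow r b ≡ insertBelow r′ b′ → _≡_ {A = Pair} (r ∷ s , b) (r′ ∷ s′ , b′)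
      inj r s b e ¬y r′ s′ b′ e′ ¬y′ p q =
        let (f , fr , fb) = recordAt r s b e ¬y
            (g , gr , gb) = recordAt r′ s′ b′ e′ ¬y′
            (u , w , t) = unique q f g
        in cong₂ _,_ (cong₂ _∷_ (trans (sym fr) (trans w gr)) p) (trans (sym fb) (trans (cong₂ _++_ u t) gb))
        where
        unique : ∀ {a a′} → a ≡ a′ → (f : FirstRecord (v ∷ []) a) (g : FirstRecord (v ∷ []) a′) →
          FirstRecord.before f ≡ FirstRecord.before g × FirstRecord.rec f ≡ FirstRecord.rec g × FirstRecord.after f ≡ FirstRecord.after g
        unique refl = firstRecord-unique
      reinsert : ∀ a (f : FirstRecord (v ∷ []) a) → Path _≯_ v a → insertBelow (FirstRecord.rec f) (FirstRecord.before f ++ FirstRecord.after f) ≡ a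
      reinsert a (firstRecord p r q refl _ _ ps) semi = insertBelow-++ r p ps (path-head v p semi)
      forth : ∀ s a → E k (s , a) → (f : FirstRecord (v ∷ []) a) → Below s (FirstRecord.rec f) →
        E (suc k) (FirstRecord.rec f ∷ s , FirstRecord.before f ++ FirstRecord.after f)
      forth s a (len , ky , up , semi) (firstRecord p r q refl _ (v<r ∷ []) ps) bel =
        cong suc len , trans (sym (insert-key r s p q)) ky , chain-below r s v<r bel up , path-remove v p semi v<r ps
      forth-¬Y : ∀ s a → E k (s , a) → (f : FirstRecord (v ∷ []) a) → ¬ Y (FirstRecord.rec f ∷ s , FirstRecord.before f ++ FirstRecord.after f)
      forth-¬Y s a (_ , _ , _ , semi) (firstRecord p r q refl np _ _) (g , r′<r) =
        earlier (v ∷ []) p q np (path-head v p semi) g r′<r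
        -- As `p` contains no record, the new first record lies in `q`; it is the head of `q` or
        -- above that head, and the head of `q` is not below `r`.
        where
        earlier : ∀ prev p q → NoRecord prev p → HeadNotBelow r q → (g : FirstRecord prev (p ++ q)) → ¬ FirstRecord.rec g < r
        earlier prev [] (x ∷ q) _ h (firstRecord [] .x .q refl _ _ _) lt = h lt
        earlier prev [] (x ∷ q) _ h (firstRecord (.x ∷ _) r′ _ refl _ _ (x<r′ ∷ _)) lt = h (<-trans x<r′ lt)
        earlier prev [] [] _ h (firstRecord [] _ _ () _ _ _) lt
        earlier prev [] [] _ h (firstRecord (_ ∷ _) _ _ () _ _ _) lt
        earlier prev (x ∷ p) q (¬all , np) h (firstRecord [] .x _ refl _ all _) lt = ¬all all
        earlier prev (x ∷ p) q (¬all , np) h (firstRecord (y ∷ b) r′ c e (_ , nb) all (y<r′ ∷ bs)) lt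
          with refl , e₁ ← List.∷-injective e =
          earlier (x ∷ prev) p q np h (firstRecord b r′ c e₁ nb (y<r′ ∷ all) bs) lt

    complement-step : ∀ k → (ES k such-that (X ∘ proj₁)) ≅ (ES k such-that (Y ∘ proj₁)) →
      (ES k such-that (¬_ ∘ X ∘ proj₁)) ≅ (ES k such-that (¬_ ∘ Y ∘ proj₁))
    complement-step k = complement-≅ {ES k} {ES k} {X ∘ proj₁} {Y ∘ proj₁} (proj₂ (size-ES k))
      (λ { refl x → x }) (λ ((s , a) , _) → lastOf v s <? lastOf v a) (λ { refl y → y }) (λ (p , _) → y? p) ≅-refl

    E-bounded : ∀ k → proj₁ K ℕ.< k → ¬ ∣ ES k ∣ₛ
    E-bounded k lt ((s , a) , refl , refl , _) = ℕ.<⇒≱ lt (ℕ.≤-trans (ℕ.m≤m+n (length s) (length a)) (ℕ.≤-reflexive (sym (List.length-++ s))))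

    -- Downward induction on the level `k`, with `d` as the number of levels left; past the length
    -- of `K` both sides are empty. The complements at level `k + 1` are the parts `X` and `Y` at
    -- level `k`, by the two moves.
    X≅Y : ∀ d k → proj₁ K ℕ.< d ℕ.+ k → (ES k such-that (X ∘ proj₁)) ≅ (ES k such-that (Y ∘ proj₁))
    X≅Y zero k lt = ≅-trans (≅-sym (size-empty {ES k such-that (X ∘ proj₁)} (E-bounded k lt ∘ proj₁))) (size-empty {ES k such-that (Y ∘ proj₁)} (E-bounded k lt ∘ proj₁))
    X≅Y (suc d) k lt = ≅-trans (X≅ k) (≅-trans (complement-step (suc k) (X≅Y d (suc k) (subst (proj₁ K ℕ.<_) (sym (ℕ.+-suc d k)) lt))) (≅-sym (Y≅ k)))

    CyclicTail RecordFreeTail : Word → Set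
    CyclicTail a = key a ≡ K × Path _≯_ v a × ¬ v < lastOf v a
    RecordFreeTail a = key a ≡ K × Path _≯_ v a × NoRecord (v ∷ []) a

    cyclic≅recordFree : (setoid Word such-that CyclicTail) ≅ (setoid Word such-that RecordFreeTail)
    cyclic≅recordFree = ≅-trans
      (injection+section {setoid Word such-that CyclicTail} {ES 0 such-that (¬_ ∘ X ∘ proj₁)}
        (λ (a , ky , p , c) → (([] , a) , refl , ky , tt , p) , c) (λ { ((([] , a) , _ , ky , _ , p) , c) → a , ky , p , c })
        (cong ([] ,_)) (cong proj₂) (λ { ((([] , a) , _) , _) → refl }))
      (≅-trans (complement-step 0 (X≅Y (suc (proj₁ K)) 0 (ℕ.m≤m+n (suc (proj₁ K)) 0)))
      (≅-sym (injection+section {setoid Word such-that RecordFreeTail} {ES 0 such-that (¬_ ∘ Y ∘ proj₁)}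
        (λ (a , ky , p , r) → (([] , a) , refl , ky , tt , p) , λ (f , _) → noRecord-firstRecord r f)
        (λ { ((([] , a) , _ , ky , _ , p) , ¬y) → a , ky , p , [ id , (λ f → contradiction (f , tt) ¬y) ]′ (scan (v ∷ []) a) })
        (cong ([] ,_)) (cong proj₂) (λ { ((([] , a) , _) , _) → refl }))))

  CyclicWord RecordFreeWord : Word → Set
  CyclicWord [] = ⊥
  CyclicWord (v ∷ a) = Path _≯_ v a × ¬ v < lastOf v a
  RecordFreeWord [] = ⊥
  RecordFreeWord (v ∷ a) = Path _≯_ v a × NoRecord (v ∷ []) a

  CyclicWords RecordFreeWords : Setoid 0ℓ 0ℓ
  CyclicWords = setoid Word such-that CyclicWord
  RecordFreeWords = setoid Word such-that RecordFreeWord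

  cyclicKey : ∣ CyclicWords ∣ₛ → Carrier × Key
  cyclicKey (v ∷ a , _) = v , key a

  recordFreeKey : ∣ RecordFreeWords ∣ₛ → Carrier × Key
  recordFreeKey (v ∷ a , _) = v , key a

  private
    cyclic-fibre : ∀ v K → (CyclicWords such-that λ w → cyclicKey w ≡ (v , K)) ≅ (setoid Word such-that Marked.CyclicTail v K)
    cyclic-fibre v K = injection+section {CyclicWords such-that λ w → cyclicKey w ≡ (v , K)} {setoid Word such-that Marked.CyclicTail v K}
      (λ { ((u ∷ a , p) , e) → a , tail u a p e }) (λ (a , ky , p) → (v ∷ a , p) , cong (v ,_) ky)
      (λ { {(_ ∷ _ , _) , _} {(_ ∷ _ , _) , _} refl → refl })
      (λ { {(_ ∷ _ , _) , e} {(_ ∷ _ , _) , e′} q → cong₂ _∷_ (trans (cong proj₁ e) (sym (cong proj₁ e′))) q })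
      (λ _ → refl)
      where
      tail : ∀ u a → CyclicWord (u ∷ a) → (u , key a) ≡ (v , K) → Marked.CyclicTail v K a
      tail u a p refl = refl , p
    recordFree-fibre : ∀ v K → (RecordFreeWords such-that λ w → recordFreeKey w ≡ (v , K)) ≅ (setoid Word such-that Marked.RecordFreeTail v K)
    recordFree-fibre v K = injection+section {RecordFreeWords such-that λ w → recordFreeKey w ≡ (v , K)} {setoid Word such-that Marked.RecordFreeTail v K}
      (λ { ((u ∷ a , p) , e) → a , tail u a p e }) (λ (a , ky , p) → (v ∷ a , p) , cong (v ,_) ky)
      (λ { {(_ ∷ _ , _) , _} {(_ ∷ _ , _) , _} refl → refl })
      (λ { {(_ ∷ _ , _) , e} {(_ ∷ _ , _) , e′} q → cong₂ _∷_ (trans (cong proj₁ e) (sym (cong proj₁ e′))) q })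
      (λ _ → refl)
      where
      tail : ∀ u a → RecordFreeWord (u ∷ a) → (u , key a) ≡ (v , K) → Marked.RecordFreeTail v K a
      tail u a p refl = refl , p

    cyclicKey-cong : ∀ {w w′} → Setoid._≈_ CyclicWords w w′ → cyclicKey w ≡ cyclicKey w′
    cyclicKey-cong {_ ∷ _ , _} {_ ∷ _ , _} refl = refl
    recordFreeKey-cong : ∀ {w w′} → Setoid._≈_ RecordFreeWords w w′ → recordFreeKey w ≡ recordFreeKey w′
    recordFreeKey-cong {_ ∷ _ , _} {_ ∷ _ , _} refl = refl
    fibre : ∀ k → (CyclicWords such-that λ w → cyclicKey w ≡ k) ≅ (RecordFreeWords such-that λ w → recordFreeKey w ≡ k)
    fibre (v , K) = ≅-trans (cyclic-fibre v K) (≅-trans (Marked.cyclic≅recordFree v K) (≅-sym (recordFree-fibre v K)))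

  -- Fibres over the first letter and the content of the rest are matched, so a word keeps its
  -- letters and the rows of a tableau can be transformed independently.
  module Transform = Glue {CyclicWords} {RecordFreeWords} cyclicKey recordFreeKey
    (λ {w} {w′} → cyclicKey-cong {w} {w′}) (λ {w} {w′} → recordFreeKey-cong {w} {w′}) fibre

  abstract
    transform : CyclicWords ≅ RecordFreeWords
    transform = Transform.glue

    key-full : ∀ w w′ → cyclicKey w ≡ recordFreeKey w′ → length (proj₁ w) ≡ length (proj₁ w′) × (∀ x → occurrences x (proj₁ w) ≡ occurrences x (proj₁ w′))
    key-full (v ∷ a , _) (v′ ∷ a′ , _) e = cong (suc ∘ proj₁ ∘ proj₂) e ,
      λ x → cong₂ ℕ._+_ (cong (λ v → [ x ≟ v ]?) (cong proj₁ e)) (key-occurrences {a} {a′} (cong proj₂ e) x)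

    transform-content : ∀ w → length (proj₁ (Inverse.to transform w)) ≡ length (proj₁ w) ×
      (∀ x → occurrences x (proj₁ (Inverse.to transform w)) ≡ occurrences x (proj₁ w))
    transform-content w = let (p , q) = key-full w (Inverse.to transform w) (sym (Transform.to-key w)) in sym p , sym ∘ q

-- Tableaux as families of words

module RowWords {n} (P : FinitePoset n) where
  open PosetFacts P
  open Words P

  ∈⇒occurs : ∀ {x} {a : Word} → x ∈ₗ a → 1 ℕ.≤ occurrences x a
  ∈⇒occurs {x} {y ∷ a} (here refl) rewrite dec-true (x ≟ x) refl = s≤s z≤n
  ∈⇒occurs {x} {y ∷ a} (there x∈) = ℕ.≤-trans (∈⇒occurs x∈) (ℕ.m≤n+m _ _)

  occurs⇒∈ : ∀ {x} (a : Word) → 1 ℕ.≤ occurrences x a → x ∈ₗ a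
  occurs⇒∈ {x} (y ∷ a) le = step (x ≟ y) le
    where
    step : (d : Dec (x ≡ y)) → 1 ℕ.≤ [ d ]? ℕ.+ occurrences x a → x ∈ₗ y ∷ a
    step (yes e) _ = here e
    step (no _) le = there (occurs⇒∈ a le)

  AtMostOnce : Word → Set
  AtMostOnce a = ∀ x → occurrences x a ℕ.≤ 1

  atMostOnce⇒unique : ∀ a → AtMostOnce a → Unique a
  atMostOnce⇒unique [] _ = []
  atMostOnce⇒unique (y ∷ a) le = AllP.¬Any⇒All¬ a absent ∷ atMostOnce⇒unique a (λ x → ℕ.≤-trans (ℕ.m≤n+m _ _) (le x))
    where
    absent : y ∉ₗ a
    absent y∈ with le y
    ... | le′ rewrite dec-true (y ≟ y) refl = ℕ.<⇒≱ (s≤s (∈⇒occurs y∈)) le′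

  unique⇒atMostOnce : ∀ {a} → Unique a → AtMostOnce a
  unique⇒atMostOnce [] x = z≤n
  unique⇒atMostOnce {y ∷ a} (y∉ ∷ u) x = step (x ≟ y)
    where
    step : (d : Dec (x ≡ y)) → [ d ]? ℕ.+ occurrences x a ℕ.≤ 1
    step (yes refl) = s≤s (ℕ.≮⇒≥ λ lt → All.lookup y∉ (occurs⇒∈ a lt) refl)
    step (no _) = unique⇒atMostOnce u x

  module _ {m} (f : Fin m → Carrier) where

    SemistrictF WrapsF RecordFreeF : Set
    SemistrictF = ∀ j j′ → toℕ j′ ≡ suc (toℕ j) → ¬ f j′ < f j
    WrapsF = ∀ first last → toℕ first ≡ 0 → suc (toℕ last) ≡ m → ¬ f first < f last
    RecordFreeF = ∀ j → toℕ j ≢ 0 → ¬ (∀ k → k Fin.< j → f k < f j)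

  path⁺ : ∀ {m} (f : Fin (suc m) → Carrier) → SemistrictF f → Path _≯_ (f fzero) (tabulate (f ∘ fsuc))
  path⁺ {zero} f s = tt
  path⁺ {suc m} f s = s fzero (fsuc fzero) refl , path⁺ (f ∘ fsuc) (λ j j′ e → s (fsuc j) (fsuc j′) (cong suc e))

  path⁻ : ∀ {m} (f : Fin (suc m) → Carrier) → Path _≯_ (f fzero) (tabulate (f ∘ fsuc)) → SemistrictF f
  path⁻ {suc m} f (p , _) fzero (fsuc fzero) refl = p
  path⁻ {suc m} f (_ , p) (fsuc j) (fsuc j′) e = path⁻ (f ∘ fsuc) p j j′ (ℕ.suc-injective e)

  lastOf-tabulate : ∀ {m} (f : Fin (suc m) → Carrier) {j} → suc (toℕ j) ≡ suc m → lastOf (f fzero) (tabulate (f ∘ fsuc)) ≡ f j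
  lastOf-tabulate {zero} f {fzero} _ = refl
  lastOf-tabulate {suc m} f {fzero} ()
  lastOf-tabulate {suc m} f {fsuc j} e = lastOf-tabulate (f ∘ fsuc) (ℕ.suc-injective e)

  noRecord⁺ : ∀ {m} prev (g : Fin m → Carrier) → (∀ j → ¬ (All (_< g j) prev × (∀ k → k Fin.< j → g k < g j))) → NoRecord prev (tabulate g)
  noRecord⁺ {zero} prev g none = tt
  noRecord⁺ {suc m} prev g none = (λ all → none fzero (all , λ _ ())) ,
    noRecord⁺ (g fzero ∷ prev) (g ∘ fsuc) λ { j ((p ∷ all) , below) → none (fsuc j) (all , λ { fzero _ → p ; (fsuc k) (s≤s lt) → below k lt }) }

  noRecord⁻ : ∀ {m} prev (g : Fin m → Carrier) → NoRecord prev (tabulate g) → ∀ j → ¬ (All (_< g j) prev × (∀ k → k Fin.< j → g k < g j))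
  noRecord⁻ {suc m} prev g (p , _) fzero (all , _) = p all
  noRecord⁻ {suc m} prev g (_ , q) (fsuc j) (all , below) = noRecord⁻ (g fzero ∷ prev) (g ∘ fsuc) q j
    (below fzero (s≤s z≤n) ∷ all , λ k lt → below (fsuc k) (s≤s lt))

  cyclicWord⁺ : ∀ {m} (f : Fin m → Carrier) → NonZero m → SemistrictF f → WrapsF f → CyclicWord (tabulate f)
  cyclicWord⁺ {suc m} f _ s w = path⁺ f s , λ lt → w fzero (Fin.fromℕ m) refl (cong suc (Fin.toℕ-fromℕ m))
    (subst (f fzero <_) (lastOf-tabulate f (cong suc (Fin.toℕ-fromℕ m))) lt)

  cyclicWord⁻ : ∀ {m} (f : Fin m → Carrier) → CyclicWord (tabulate f) → SemistrictF f × WrapsF f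
  cyclicWord⁻ {suc m} f (p , w) = path⁻ f p , λ { fzero l _ e lt → w (subst (f fzero <_) (sym (lastOf-tabulate f e)) lt) }

  recordFreeWord⁺ : ∀ {m} (f : Fin m → Carrier) → NonZero m → RecordFreeF f → SemistrictF f → RecordFreeWord (tabulate f)
  recordFreeWord⁺ {suc m} f _ r s = path⁺ f s , noRecord⁺ (f fzero ∷ []) (f ∘ fsuc)
    λ { j ((p ∷ []) , below) → r (fsuc j) (λ ()) λ { fzero _ → p ; (fsuc k) (s≤s lt) → below k lt } }

  recordFreeWord⁻ : ∀ {m} (f : Fin m → Carrier) → RecordFreeWord (tabulate f) → RecordFreeF f × SemistrictF f
  recordFreeWord⁻ {suc m} f (p , r) = (λ { fzero ≢0 _ → ≢0 refl
    ; (fsuc j) _ below → noRecord⁻ (f fzero ∷ []) (f ∘ fsuc) r j (below fzero (s≤s z≤n) ∷ [] , λ k lt → below (fsuc k) (s≤s lt)) }) , path⁻ f p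

module RowFamilies {n} (P : FinitePoset n) (lam : Partition n) where
  open PosetFacts P
  open Words P
  open RowWords P
  open CyclicTableaux P lam using (Cyclic; boxes-surjective)
  open Boxes lam

  Family : Set
  Family = Fin (len lam) → Word

  -- Phrased by lengths and occurrences, the data that `transform-content` preserves. That every
  -- element occurs follows by counting boxes in `fromFamily`.
  record Arrangement (l : Family) : Set where
    field
      lengths : ∀ i → length (l i) ≡ part lam i
      once    : ∀ i → AtMostOnce (l i)
      apart   : ∀ {i j x} → 1 ℕ.≤ occurrences x (l i) → 1 ℕ.≤ occurrences x (l j) → i ≡ j

    unique : ∀ i → Unique (l i)
    unique i = atMostOnce⇒unique (l i) (once i)

    shared : ∀ {i j x} → x ∈ₗ l i → x ∈ₗ l j → i ≡ j
    shared p q = apart (∈⇒occurs p) (∈⇒occurs q)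

  arrangement-cong : ∀ {l l′} → (∀ i → length (l′ i) ≡ length (l i)) → (∀ i x → occurrences x (l′ i) ≡ occurrences x (l i)) → Arrangement l → Arrangement l′
  arrangement-cong p q a = record
    { lengths = λ i → trans (p i) (lengths i)
    ; once = λ i x → subst (ℕ._≤ 1) (sym (q i x)) (once i x)
    ; apart = λ {i} {j} {x} s t → apart (subst (1 ℕ.≤_) (q i x) s) (subst (1 ℕ.≤_) (q j x) t)
    }
    where open Arrangement a

  Families : Setoid 0ℓ 0ℓ
  Families = (Fin (len lam) →-setoid Word) such-that Arrangement

  rows : Tableau P lam → Family
  rows U i = tabulate (entry P lam U i)

  module _ {l : Family} (a : Arrangement l) where
    open Arrangement a

    cell : BoxOf → Carrier
    cell (i , j) = lookup (l i) (Fin.cast (sym (lengths i)) j)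

    cell-injective : Injective _≡_ _≡_ cell
    cell-injective {i , j} {i′ , j′} e = at (shared {i} {i′} {cell (i , j)} (∈-lookup _) (subst (_∈ₗ l i′) (sym e) (∈-lookup _))) j j′ e
      where
      at : ∀ {i i′} → i ≡ i′ → ∀ j j′ → cell (i , j) ≡ cell (i′ , j′) → _≡_ {A = BoxOf} (i , j) (i′ , j′)
      at {i} refl j j′ e = cong (i ,_) (trans (sym (Fin.cast-involutive (lengths i) (sym (lengths i)) j))
        (trans (cong (Fin.cast (lengths i)) (lookup-injective (unique i) _ _ e)) (Fin.cast-involutive (lengths i) (sym (lengths i)) j′)))

    fromFamily : Tableau P lam
    fromFamily = cell , boxes-surjective cell-injective

    somewhere : ∀ x → ∃[ i ] x ∈ₗ l i
    somewhere x = let ((i , j) , e) = proj₂ (proj₂ fromFamily) x in i , subst (_∈ₗ l i) (e refl) (∈-lookup _)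

    rows-fromFamily : ∀ i → rows fromFamily i ≡ l i
    rows-fromFamily i = at (l i) (lengths i)
      where
      at : ∀ (a : Word) {m} (e : length a ≡ m) → tabulate (λ j → lookup a (Fin.cast (sym e) j)) ≡ a
      at a refl = trans (List.tabulate-cong (λ j → cong (lookup a) (Fin.cast-is-id refl j))) (List.tabulate-lookup a)

  rows-arrangement : ∀ U → Arrangement (rows U)
  rows-arrangement U = record
    { lengths = λ i → List.length-tabulate (entry P lam U i)
    ; once = λ i → unique⇒atMostOnce (Unique.tabulate⁺ λ e → same-row-≡ (proj₁ (proj₂ U) e))
    ; apart = λ {i} {j} p q → let (k , e) = ∈-tabulate⁻ (occurs⇒∈ (rows U i) p) ; (k′ , e′) = ∈-tabulate⁻ (occurs⇒∈ (rows U j) q) in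
        cong proj₁ (proj₁ (proj₂ U) {i , k} {j , k′} (trans (sym e) e′))
    }

  tableaux≅families : Tableaux P lam ≅ Families
  tableaux≅families = injection+section {Tableaux P lam} {Families}
    (λ U → rows U , rows-arrangement U) (λ (l , a) → fromFamily a)
    (λ e i → List.tabulate-cong (λ j → e (i , j)))
    (λ e (i , j) → tabulate-injective (e i) j)
    (λ (l , a) → rows-fromFamily a)
    where
    tabulate-injective : ∀ {m} {f g : Fin m → Carrier} → tabulate f ≡ tabulate g → ∀ j → f j ≡ g j
    tabulate-injective e fzero = proj₁ (List.∷-injective e)
    tabulate-injective e (fsuc j) = tabulate-injective (proj₂ (List.∷-injective e)) j

  CyclicFamilies RecordFreeFamilies RecordFreeTableaux : Setoid 0ℓ 0ℓ
  CyclicFamilies = Families such-that λ (l , _) → ∀ i → CyclicWord (l i)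
  RecordFreeFamilies = Families such-that λ (l , _) → ∀ i → RecordFreeWord (l i)
  RecordFreeTableaux = Tableaux P lam such-that λ U → RecordFree P lam U × RowSemistrict P lam U

  positive-part : ∀ i → NonZero (part lam i)
  positive-part i = All.lookup (positive lam) (∈-lookup i)

  cyclic≅families : Cyclic ≅ CyclicFamilies
  cyclic≅families = such-that-≅ {Tableaux P lam} {Families} tableaux≅families
    (λ U (s , w) i → cyclicWord⁺ (entry P lam U i) (positive-part i) (s i) (w i))
    (λ (l , a) c → let at = λ i → cyclicWord⁻ (entry P lam (fromFamily a) i) (subst CyclicWord (sym (rows-fromFamily a i)) (c i)) in
      (λ i → proj₁ (at i)) , (λ i → proj₂ (at i)))

  recordFree≅families : RecordFreeTableaux ≅ RecordFreeFamilies
  recordFree≅families = such-that-≅ {Tableaux P lam} {Families} tableaux≅families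
    (λ U (r , s) i → recordFreeWord⁺ (entry P lam U i) (positive-part i) (λ j ≢0 below → r (i , j , ≢0 , below)) (s i))
    (λ (l , a) c → let at = λ i → recordFreeWord⁻ (entry P lam (fromFamily a) i) (subst RecordFreeWord (sym (rows-fromFamily a i)) (c i)) in
      (λ (i , j , ≢0 , below) → proj₁ (at i) j ≢0 below) , (λ i → proj₂ (at i)))

  families≅ : CyclicFamilies ≅ RecordFreeFamilies
  families≅ = record
    { to = λ ((l , a) , c) → ((λ i → proj₁ (φ.to (l i , c i))) , arrangement-cong (λ i → proj₁ (transform-content (l i , c i))) (λ i → proj₂ (transform-content (l i , c i))) a)
        , λ i → proj₂ (φ.to (l i , c i))
    ; from = λ ((l , a) , c) → ((λ i → proj₁ (φ.from (l i , c i))) , arrangement-cong (λ i → proj₁ (content-back (l i , c i))) (λ i → proj₂ (content-back (l i , c i))) a)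
        , λ i → proj₂ (φ.from (l i , c i))
    ; to-cong = λ {((l , _) , c)} {((l′ , _) , c′)} e i → φ.to-cong {l i , c i} {l′ i , c′ i} (e i)
    ; from-cong = λ {((l , _) , c)} {((l′ , _) , c′)} e i → φ.from-cong {l i , c i} {l′ i , c′ i} (e i)
    ; inverse = (λ {((l , _) , c)} {((l′ , _) , c′)} e i → φ.inverseˡ {l i , c i} {l′ i , c′ i} (e i))
              , (λ {((l , _) , c)} {((l′ , _) , c′)} e i → φ.inverseʳ {l i , c i} {l′ i , c′ i} (e i))
    }
    where
    module φ = Inverse transform
    content-back : ∀ w → length (proj₁ (φ.from w)) ≡ length (proj₁ w) × (∀ x → occurrences x (proj₁ (φ.from w)) ≡ occurrences x (proj₁ w))
    content-back w = let (p , q) = transform-content (φ.from w) ; e = φ.inverseˡ {w} {φ.from w} refl in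
      trans (sym p) (cong length e) , λ x → trans (sym (q x)) (cong (occurrences x) e)

  cyclic≅recordFree : Cyclic ≅ RecordFreeTableaux
  cyclic≅recordFree = ≅-trans cyclic≅families (≅-trans families≅ (≅-sym recordFree≅families))

-- Words and acyclic orientations

module WordOrientations {n} (P : FinitePoset n) where
  open PosetFacts P
  open Words P
  open RowWords P

  _∈?_ : ∀ (x : Carrier) (a : Word) → Dec (x ∈ₗ a)
  x ∈? a = Any.any? (x ≟_) a

  Before : Word → Rel Carrier 0ℓ
  Before [] u v = ⊥
  Before (x ∷ a) u v = (u ≡ x × v ∈ₗ a) ⊎ Before a u v

  before? : ∀ a u v → Dec (Before a u v)
  before? [] u v = no λ ()
  before? (x ∷ a) u v = ((u ≟ x) ×-dec (v ∈? a)) ⊎-dec before? a u v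

  before-∈ˡ : ∀ {a u v} → Before a u v → u ∈ₗ a
  before-∈ˡ {x ∷ a} (inj₁ (e , _)) = here e
  before-∈ˡ {x ∷ a} (inj₂ b) = there (before-∈ˡ b)

  before-∈ʳ : ∀ {a u v} → Before a u v → v ∈ₗ a
  before-∈ʳ {x ∷ a} (inj₁ (_ , v∈)) = there v∈
  before-∈ʳ {x ∷ a} (inj₂ b) = there (before-∈ʳ b)

  before-total : ∀ {a u v} → u ≢ v → u ∈ₗ a → v ∈ₗ a → Before a u v ⊎ Before a v u
  before-total u≢v (here p) (here q) = contradiction (trans p (sym q)) u≢v
  before-total u≢v (here p) (there q) = inj₁ (inj₁ (p , q))
  before-total u≢v (there p) (here q) = inj₂ (inj₁ (q , p))
  before-total u≢v (there p) (there q) with before-total u≢v p q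
  ... | inj₁ b = inj₁ (inj₂ b)
  ... | inj₂ b = inj₂ (inj₂ b)

  before-irrefl : ∀ {a u} → Unique a → ¬ Before a u u
  before-irrefl (x∉ ∷ _) (inj₁ (refl , u∈)) = All.lookup x∉ u∈ refl
  before-irrefl (_ ∷ uq) (inj₂ b) = before-irrefl uq b

  before-trans : ∀ {a u v w} → Unique a → Before a u v → Before a v w → Before a u w
  before-trans (x∉ ∷ _) (inj₁ (_ , v∈)) (inj₁ (refl , _)) = contradiction refl (All.lookup x∉ v∈)
  before-trans (_ ∷ _) (inj₁ (e , _)) (inj₂ b) = inj₁ (e , before-∈ʳ b)
  before-trans (x∉ ∷ _) (inj₂ b) (inj₁ (refl , _)) = contradiction refl (All.lookup x∉ (before-∈ʳ b))
  before-trans (_ ∷ uq) (inj₂ b) (inj₂ c) = inj₂ (before-trans uq b c)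

  before-split : ∀ p {x q u} → u ∈ₗ p → Before (p ++ x ∷ q) u x
  before-split (y ∷ p) (here e) = inj₁ (e , ∈-insert p)
  before-split (y ∷ p) (there u∈) = inj₂ (before-split p u∈)

  after-split : ∀ p {x q u} → u ∈ₗ q → Before (p ++ x ∷ q) x u
  after-split [] u∈ = inj₁ (refl , u∈)
  after-split (y ∷ p) u∈ = inj₂ (after-split p u∈)

  -- Reading backwards from x, each letter is comparable to x and does not exceed its successor.
  comparable-prefix : ∀ v p {x q} → Path _≯_ v (p ++ x ∷ q) → All (_≢ x) (v ∷ p) → All (λ u → ¬ Incomparable u x) (v ∷ p) → All (_< x) (v ∷ p)
  comparable-prefix v [] (x≮v , _) (v≢x ∷ []) (c ∷ []) = comparable v≢x c x≮v ∷ []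
    where
    comparable : ∀ {v x} → v ≢ x → ¬ Incomparable v x → ¬ x < v → v < x
    comparable {v} {x} v≢x c x≮v with v <? x
    ... | yes p = p
    ... | no v≮x = contradiction (≮⇒incomparable v≢x v≮x x≮v) c
  comparable-prefix v (y ∷ p) {x} (y≮v , path) (v≢x ∷ ≢s) (c ∷ cs) with comparable-prefix y p path ≢s cs | v <? x | x <? v
  ... | below | yes v<x | _ = v<x ∷ below
  ... | y<x ∷ _ | no _ | yes x<v = contradiction (<-trans y<x x<v) y≮v
  ... | _ | no v≮x | no x≮v = contradiction (≮⇒incomparable v≢x v≮x x≮v) c

  Semi : Word → Set
  Semi [] = ⊤
  Semi (v ∷ a) = Path _≯_ v a

  semi-tail : ∀ x a → Semi (x ∷ a) → Semi a
  semi-tail x [] _ = tt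
  semi-tail x (y ∷ a) (_ , p) = p

  ∈-split : ∀ {x : Carrier} {a} → x ∈ₗ a → ∃[ p ] ∃[ q ] a ≡ p ++ x ∷ q
  ∈-split (here refl) = [] , _ , refl
  ∈-split {a = y ∷ a} (there x∈) = let (p , q , e) = ∈-split x∈ in y ∷ p , q , cong (y ∷_) e

  Agree : Word → Word → Set
  Agree a b = ∀ {u v} → Incomparable u v → Before a u v → Before b u v

  -- If the heads differed, each would be smaller than the other.
  head-below : ∀ x a y b → Semi (y ∷ b) → Unique (x ∷ a) → Unique (y ∷ b) → x ∈ₗ b → (∀ {u} → u ∈ₗ y ∷ b → u ∈ₗ x ∷ a) → Agree (y ∷ b) (x ∷ a) → y < x
  head-below x a y b semi uq uq′ x∈ sub agree = on (∈-split x∈)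
    where
    on : ∃[ p ] ∃[ q ] b ≡ p ++ x ∷ q → y < x
    on (p , q , refl) = All.head (comparable-prefix y p semi (All.tabulate distinct) (All.tabulate comparable))
      where
      before-x : ∀ {u} → u ∈ₗ y ∷ p → Before (y ∷ p ++ x ∷ q) u x
      before-x = before-split (y ∷ p)
      distinct : ∀ {u} → u ∈ₗ y ∷ p → u ≢ x
      distinct u∈ refl = before-irrefl uq′ (before-x u∈)
      comparable : ∀ {u} → u ∈ₗ y ∷ p → ¬ Incomparable u x
      comparable u∈ inc with agree inc (before-x u∈)
      ... | inj₁ (_ , x∈a) = All.lookup (AllPairs.head uq) x∈a refl
      ... | inj₂ bf = All.lookup (AllPairs.head uq) (before-∈ʳ bf) refl

  -- Yields injectivity of the passage from words to orientations: equal heads are stripped, and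
  -- unequal heads are excluded by `head-below` used in both directions.
  normal-form-unique : ∀ a b → Semi a → Semi b → Unique a → Unique b → (∀ {u} → u ∈ₗ a → u ∈ₗ b) → (∀ {u} → u ∈ₗ b → u ∈ₗ a) → Agree a b → Agree b a → a ≡ b
  normal-form-unique [] [] _ _ _ _ _ _ _ _ = refl
  normal-form-unique [] (y ∷ b) _ _ _ _ _ sup _ _ = case sup (here refl) of λ ()
  normal-form-unique (x ∷ a) [] _ _ _ _ sub _ _ _ = case sub (here refl) of λ ()
  normal-form-unique (x ∷ a) (y ∷ b) sa sb ua@(x∉ ∷ ua′) ub@(y∉ ∷ ub′) sub sup ab ba = step (x ≟ y)
    where
    step : Dec (x ≡ y) → x ∷ a ≡ y ∷ b
    step (yes refl) = cong (x ∷_) (normal-form-unique a b (semi-tail x a sa) (semi-tail x b sb) ua′ ub′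
        (λ u∈ → strip x∉ u∈ (sub (there u∈))) (λ u∈ → strip y∉ u∈ (sup (there u∈)))
        (λ inc bf → strip-before x∉ bf (ab inc (inj₂ bf))) (λ inc bf → strip-before y∉ bf (ba inc (inj₂ bf))))
      where
      strip : ∀ {c d u} → All (x ≢_) c → u ∈ₗ c → u ∈ₗ x ∷ d → u ∈ₗ d
      strip x∉ u∈ (here refl) = contradiction refl (All.lookup x∉ u∈)
      strip x∉ u∈ (there u∈′) = u∈′
      strip-before : ∀ {c d u v} → All (x ≢_) c → Before c u v → Before (x ∷ d) u v → Before d u v
      strip-before x∉ bf (inj₁ (refl , _)) = contradiction refl (All.lookup x∉ (before-∈ˡ bf))
      strip-before x∉ bf (inj₂ bf′) = bf′
    step (no x≢y) = contradiction (<-trans (head-below x a y b sb ua ub (other x≢y (sub (here refl))) sup ba)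
                                           (head-below y b x a sa ub ua (other (x≢y ∘ sym) (sup (here refl))) sub ab)) <-irrefl
      where
      other : ∀ {u v c} → u ≢ v → u ∈ₗ v ∷ c → u ∈ₗ c
      other u≢v (here e) = contradiction e u≢v
      other _ (there u∈) = u∈

  -- The word of an acyclic orientation: repeatedly remove the P-least source.
  module Greedy (A : Rel Carrier 0ℓ) (A? : ∀ u v → Dec (A u v)) (A⇒inc : ∀ {u v} → A u v → Incomparable u v)
    (acyclic : ∀ v → ¬ TransClosure A v v) where

    private
      _⊏_ : Rel (Fin n) 0ℓ
      i ⊏ j = TransClosure A (elem i) (elem j)

      -- Acyclicity makes the transitive closure a strict order on finitely many elements, hence
      -- well-founded, and it contains `A`.
      A-wf : WellFounded (λ i j → A (elem i) (elem j))
      A-wf = Subrelation.wellFounded {_<₂_ = _⊏_} (λ a → [ a ]⁺) (spo-wellFounded {_≈_ = _≡_} {_⊏_ = _⊏_} record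
        { isEquivalence = Eq.isEquivalence ; irrefl = λ { refl → acyclic _ } ; trans = _++⁺_
        ; <-resp-≈ = (λ { refl p → p }) , (λ { refl p → p }) })

      <-wf : WellFounded (λ i j → elem i < elem j)
      <-wf = spo-wellFounded {_≈_ = _≡_} record
        { isEquivalence = Eq.isEquivalence ; irrefl = λ { refl → <-irrefl } ; trans = <-trans
        ; <-resp-≈ = (λ { refl p → p }) , (λ { refl p → p }) }

    SourceIn : Word → Carrier → Set
    SourceIn ys y = y ∈ₗ ys × All (λ u → ¬ A u y) ys

    sourceIn? : ∀ ys y → Dec (SourceIn ys y)
    sourceIn? ys y = (y ∈? ys) ×-dec All.all? (λ u → ¬? (A? u y)) ys

    -- Stated as minimality. For an orientation of all incomparable pairs the sources form a chain,
    -- since an edge between two of them would have a head, so the minimal source is the least one.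
    LeastSource : Word → Carrier → Set
    LeastSource ys y = SourceIn ys y × (∀ x → x < y → ¬ SourceIn ys x)

    -- An `A`-minimal letter shows that sources exist; among them one minimal in P is taken.
    leastSource : ∀ y ys → ∃ (LeastSource (y ∷ ys))
    leastSource y ys = least (minimal A-wf (λ i j → A? (elem i) (elem j)) (λ i → elem i ∈? (y ∷ ys)) (index y , here (elem-index y)))
      where
      least : ∃[ i ] elem i ∈ₗ y ∷ ys × (∀ j → A (elem j) (elem i) → ¬ elem j ∈ₗ y ∷ ys) → ∃ (LeastSource (y ∷ ys))
      least (i , i∈ , i-min) =
        let (j , src , j-min) = minimal <-wf (λ i j → elem i <? elem j) (λ i → sourceIn? (y ∷ ys) (elem i))
              (i , i∈ , All.tabulate λ {u} u∈ a → i-min (index u) (subst (λ u → A u (elem i)) (sym (elem-index u)) a) (subst (_∈ₗ y ∷ ys) (sym (elem-index u)) u∈))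
        in elem j , src , λ x lt src′ → j-min (index x) (subst (_< elem j) (sym (elem-index x)) lt) (subst (SourceIn (y ∷ ys)) (sym (elem-index x)) src′)

    without : Carrier → Word → Word
    without y = filter (λ z → ¬? (z ≟ y))

    record Sorted (ys : Word) : Set where
      field
        word   : Word
        sound  : ∀ {x} → x ∈ₗ word → x ∈ₗ ys
        total  : ∀ {x} → x ∈ₗ ys → x ∈ₗ word
        unique : Unique word
        order  : ∀ {u v} → Before word u v → ¬ A v u
        semi   : Semi word
        -- Retained for the induction: the semistrict condition between the removed source and the
        -- next letter uses that the latter is a source of the rest.
        heads  : ∀ {y a} → word ≡ y ∷ a → LeastSource ys y

    abstract
      sort-acyclic : ∀ m ys → length ys ℕ.≤ m → Sorted ys
      sort-acyclic m [] _ = record { word = [] ; sound = id ; total = id ; unique = [] ; order = λ () ; semi = tt ; heads = λ () }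
      sort-acyclic (suc m) ys@(y₀ ∷ ys₀) (s≤s le) = record
        { word = y ∷ R.word
        ; sound = λ { (here refl) → y∈ ; (there x∈) → proj₁ (rest x∈) }
        ; total = λ {x} x∈ → place x∈ (x ≟ y)
        ; unique = All.tabulate (λ x∈ e → proj₂ (rest x∈) (sym e)) ∷ R.unique
        ; order = λ { (inj₁ (refl , v∈)) → All.lookup y-source (proj₁ (rest v∈)) ; (inj₂ b) → R.order b }
        ; semi = semistrict R.word refl
        ; heads = λ { refl → proj₂ (leastSource y₀ ys₀) }
        }
        where
        y : Carrier
        y = proj₁ (leastSource y₀ ys₀)
        y∈ : y ∈ₗ ys
        y∈ = proj₁ (proj₁ (proj₂ (leastSource y₀ ys₀)))
        y-source : All (λ u → ¬ A u y) ys
        y-source = proj₂ (proj₁ (proj₂ (leastSource y₀ ys₀)))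
        y-least : ∀ x → x < y → ¬ SourceIn ys x
        y-least = proj₂ (proj₂ (leastSource y₀ ys₀))
        keep? : ∀ z → Dec (z ≢ y)
        keep? = λ z → ¬? (z ≟ y)
        shorter : length (without y ys) ℕ.≤ m
        shorter = ℕ.≤-trans (ℕ.s≤s⁻¹ (List.filter-notAll keep? ys (Any.map (λ e ¬e → ¬e (sym e)) y∈))) le
        module R = Sorted (sort-acyclic m (without y ys) shorter)
        rest : ∀ {x} → x ∈ₗ R.word → x ∈ₗ ys × x ≢ y
        rest x∈ = ∈-filter⁻ keep? {xs = ys} (R.sound x∈)
        place : ∀ {x} → x ∈ₗ ys → Dec (x ≡ y) → x ∈ₗ y ∷ R.word
        place _ (yes e) = here e
        place x∈ (no x≢y) = there (R.total (∈-filter⁺ keep? x∈ x≢y))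
        semistrict : ∀ w → R.word ≡ w → Path _≯_ y w
        semistrict [] _ = tt
        -- If `y′` were below `y`, it would already have been a smaller source: `y` is comparable
        -- with it, hence not adjacent, and no other letter points to it because it is a source of
        -- the rest.
        semistrict (y′ ∷ w) e = (λ lt → y-least y′ lt (proj₁ (rest (subst (y′ ∈ₗ_) (sym e) (here refl))) , All.tabulate λ {u} u∈ a → source lt u∈ a (u ≟ y))) , subst Semi e R.semi
          where
          source : y′ < y → ∀ {u} → u ∈ₗ ys → A u y′ → ¬ Dec (u ≡ y)
          source lt u∈ a (yes refl) = proj₂ (A⇒inc a) (proj₁ lt)
          source lt u∈ a (no u≢y) = All.lookup (proj₂ (proj₁ (R.heads e))) (∈-filter⁺ keep? u∈ u≢y) a

-- Oriented sequences and families of record-free words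

module Orientations {n} (P : FinitePoset n) (lam : Partition n) where
  open PosetFacts P
  open Words P
  open RowWords P
  open WordOrientations P
  open RowFamilies P lam
  open Boxes lam

  Pointed : OrientedSequence (inc P) lam → Set
  Pointed X = ∀ j → Orientation.Acyclic (O X j) × Orientation.HasOneSource (O X j)

  PointedSequences : Setoid 0ℓ 0ℓ
  PointedSequences = OrientedSequences (inc P) lam such-that Pointed

  Arc? : ∀ a u v → Dec (Incomparable u v × Before a u v)
  Arc? a u v = incomparable? u v ×-dec before? a u v

  module FromWords (l : Family) (arr : Arrangement l) where
    open Arrangement arr

    blockOf : Fin (len lam) → Carrier → Bool
    blockOf i v = does (v ∈? l i)

    ∈block : ∀ {i v} → v ∈ₗ l i → v ∈ blockOf i
    ∈block {i} {v} = ⇒does (v ∈? l i)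

    block∈ : ∀ {i v} → v ∈ blockOf i → v ∈ₗ l i
    block∈ {i} {v} = does⇒ (v ∈? l i)

    partition : OrderedSetPartition Carrier lam
    partition = record
      { block = blockOf
      ; disjoint = λ i≢j p q → i≢j (shared (block∈ p) (block∈ q))
      ; covering = λ v → let (i , v∈) = somewhere arr v in i , ∈block v∈
      ; sizes = λ i → ≡-size {setoid Carrier such-that (_∈ blockOf i)} (lengths i) (size-list (l i) (unique i) ∈block block∈)
      }

    orientation : ∀ i → Orientation (induced (inc P) (blockOf i))
    orientation i = record
      { arc = λ (u , _) (v , _) → does (Arc? (l i) u v)
      ; sound = λ {(u , _)} {(v , _)} t → proj₁ (does⇒ (Arc? (l i) u v) t)
      ; orient = λ {(u , p)} {(v , q)} adj → either {u} {v} adj (before-total (λ { refl → irrefl (inc P) adj }) (block∈ p) (block∈ q))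
      ; oneWay = λ {(u , _)} {(v , _)} t t′ → before-irrefl (unique i)
          (before-trans (unique i) (proj₂ (does⇒ (Arc? (l i) u v) t)) (proj₂ (does⇒ (Arc? (l i) v u) t′)))
      }
      where
      either : ∀ {u v} → Incomparable u v → Before (l i) u v ⊎ Before (l i) v u → T (does (Arc? (l i) u v)) ⊎ T (does (Arc? (l i) v u))
      either {u} {v} adj (inj₁ b) = inj₁ (⇒does (Arc? (l i) u v) (adj , b))
      either {u} {v} adj (inj₂ b) = inj₂ (⇒does (Arc? (l i) v u) (symm (inc P) adj , b))

    sequence : OrientedSequence (inc P) lam
    sequence = record { blocks = partition ; O = orientation }

    module _ (rf : ∀ i → RecordFreeWord (l i)) where

      acyclic : ∀ i → Orientation.Acyclic (orientation i)
      acyclic i v c = before-irrefl (unique i) (along c)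
        where
        along : ∀ {x y} → TransClosure (λ x y → T (Orientation.arc (orientation i) x y)) x y → Before (l i) (proj₁ x) (proj₁ y)
        along {x} {y} [ t ]⁺ = proj₂ (does⇒ (Arc? (l i) (proj₁ x) (proj₁ y)) t)
        along {x} (_∷⁺_ {y = y} t c) = before-trans (unique i) (proj₂ (does⇒ (Arc? (l i) (proj₁ x) (proj₁ y)) t)) (along c)

      -- Any letter before a source is comparable with it, otherwise their edge would point at the
      -- source. By `comparable-prefix` all of them lie below the source, which is therefore a
      -- record unless it comes first.
      oneSource : ∀ i → Orientation.HasOneSource (orientation i)
      oneSource i = at (l i) refl (unique i) (rf i)
        where
        at : ∀ w → l i ≡ w → Unique w → RecordFreeWord w → Orientation.HasOneSource (orientation i)
        at (v ∷ a) e uq@(v∉ ∷ _) (semi , none) = (v , ∈block (subst (v ∈ₗ_) (sym e) (here refl))) ,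
          (λ (u , _) t → first-source (subst (λ w → Before w u v) e (proj₂ (does⇒ (Arc? (l i) u v) t)))) ,
          λ (x , p) src → T-Σ-≡ (only x (λ {u} inc bf →
              let bf′ = subst (λ w → Before w u x) (sym e) bf in
              src (u , ∈block (before-∈ˡ bf′)) (⇒does (Arc? (l i) u x) (inc , bf′))) (subst (x ∈ₗ_) e (block∈ p)))
          where
          first-source : ∀ {u} → ¬ Before (v ∷ a) u v
          first-source (inj₁ (_ , v∈)) = All.lookup v∉ v∈ refl
          first-source (inj₂ b) = All.lookup v∉ (before-∈ʳ b) refl
          only : ∀ x → (∀ {u} → Incomparable u x → ¬ Before (v ∷ a) u x) → x ∈ₗ v ∷ a → x ≡ v
          only x src (here e) = e
          only x src (there x∈) = ⊥-elim (on (∈-split x∈))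
            where
            on : ¬ (∃[ p ] ∃[ q ] a ≡ p ++ x ∷ q)
            on (p , q , refl) = later (v ∷ []) p none (All.head below ∷ []) (All.tail below)
              where
              below : All (_< x) (v ∷ p)
              below = comparable-prefix v p semi
                (All.tabulate λ { u∈ refl → before-irrefl uq (before-split (v ∷ p) u∈) })
                (All.tabulate λ u∈ inc → src inc (before-split (v ∷ p) u∈))
              later : ∀ prev p → NoRecord prev (p ++ x ∷ q) → All (_< x) prev → ¬ All (_< x) p
              later prev [] (¬all , _) all _ = ¬all all
              later prev (y ∷ p) (_ , none) all (y<x ∷ ps) = later (y ∷ prev) p none (y<x ∷ all) ps

  module ToWords (X : OrientedSequence (inc P) lam) (pointed : Pointed X) (j : Fin (len lam)) where
    open OrderedSetPartition (blocks X) using (sizes)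
    private
      module Oⱼ = Orientation (O X j)

    -- The arcs of one block as a relation on all of P, with the proofs of membership in the block
    -- quantified away.
    A : Rel Carrier 0ℓ
    A u v = Σ[ p ∈ u ∈ block X j ] Σ[ q ∈ v ∈ block X j ] T (Oⱼ.arc (u , p) (v , q))

    A? : ∀ u v → Dec (A u v)
    A? u v = step (T? (block X j u)) (T? (block X j v))
      where
      step : Dec (u ∈ block X j) → Dec (v ∈ block X j) → Dec (A u v)
      step (yes p) (yes q) = map′ (λ t → p , q , t)
        (λ (p′ , q′ , t) → subst (λ (p , q) → T (Oⱼ.arc (u , p) (v , q))) (cong₂ _,_ (T-irrelevant p′ p) (T-irrelevant q′ q)) t) (T? (Oⱼ.arc (u , p) (v , q)))
      step (no ¬p) _ = no λ (p , _) → ¬p p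
      step _ (no ¬q) = no λ (_ , q , _) → ¬q q

    A⇒inc : ∀ {u v} → A u v → Incomparable u v
    A⇒inc (_ , _ , t) = Oⱼ.sound t

    A⇒arc : ∀ {u v} p q → A u v → T (Oⱼ.arc (u , p) (v , q))
    A⇒arc p q (p′ , q′ , t) = subst (λ (p , q) → T (Oⱼ.arc (_ , p) (_ , q))) (cong₂ _,_ (T-irrelevant p′ p) (T-irrelevant q′ q)) t

    A-acyclic : ∀ v → ¬ TransClosure A v v
    A-acyclic v c = proj₁ (pointed j) (v , member c) (lift c (member c) (member c))
      where
      member : ∀ {u v} → TransClosure A u v → u ∈ block X j
      member [ p , _ ]⁺ = p
      member ((p , _) ∷⁺ _) = p
      lift : ∀ {u v} → TransClosure A u v → ∀ p q → TransClosure (λ x y → T (Oⱼ.arc x y)) (u , p) (v , q)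
      lift [ a ]⁺ p q = [ A⇒arc p q a ]⁺
      lift (a ∷⁺ c) p q = A⇒arc p (member c) a ∷⁺ lift c (member c) q

    open Greedy A A? A⇒inc A-acyclic

    members : Word
    members = filter (λ v → T? (block X j v)) (map elem (allFin n))

    members⇒ : ∀ {v} → v ∈ₗ members → v ∈ block X j
    members⇒ v∈ = proj₂ (∈-filter⁻ (λ v → T? (block X j v)) {xs = map elem (allFin n)} v∈)

    ⇒members : ∀ {v} → v ∈ block X j → v ∈ₗ members
    ⇒members {v} p = ∈-filter⁺ (λ v → T? (block X j v)) (subst (_∈ₗ map elem (allFin n)) (elem-index v) (∈-map⁺ elem (∈-allFin (index v)))) p

    module S = Sorted (sort-acyclic (length members) members ℕ.≤-refl)

    word∈ : ∀ {v} → v ∈ₗ S.word → v ∈ block X j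
    word∈ = members⇒ ∘ S.sound

    ∈word : ∀ {v} → v ∈ block X j → v ∈ₗ S.word
    ∈word = S.total ∘ ⇒members

    word-length : length S.word ≡ part lam j
    word-length = size-unique (size-list S.word S.unique word∈ ∈word) (sizes j)

    A⇒before : ∀ {u v} → A u v → Before S.word u v
    A⇒before {u} {v} a@(p , q , _) with before-total {S.word} {u} {v} (λ { refl → irrefl (inc P) (A⇒inc a) }) (∈word p) (∈word q)
    ... | inj₁ b = b
    ... | inj₂ b = contradiction a (S.order b)

    before⇒A : ∀ {u v} → Incomparable u v → Before S.word u v → A u v
    before⇒A {u} {v} inc b with Oⱼ.orient {u , word∈ (before-∈ˡ b)} {v , word∈ (before-∈ʳ b)} inc
    ... | inj₁ t = _ , _ , t
    ... | inj₂ t = contradiction (_ , _ , t) (S.order b)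

    -- A record `r` would be a second source: the letters before it lie below it and so are not
    -- adjacent to it, and those after it do not point to it by `order`. The first letter is a
    -- source as well, and it differs from `r`, being below it.
    recordFree : RecordFreeWord S.word
    recordFree = at S.word refl (subst NonZero (sym word-length) (positive-part j))
      where
      at : ∀ w → S.word ≡ w → NonZero (length w) → RecordFreeWord w
      at (v ∷ a) e _ = subst Semi e S.semi , [ id , (λ f → ⊥-elim (on f)) ]′ (scan (v ∷ []) a)
        where
        source : ∀ {x} → x ∈ₗ S.word → (∀ {u} → A u x → ⊥) → ∀ p → Orientation.Source (O X j) (x , p)
        source x∈ none p (u , q) t = none (q , p , t)
        on : ¬ FirstRecord (v ∷ []) a
        on (firstRecord p r q refl _ (v<r ∷ []) below) = contradiction v<r (subst (λ x → ¬ v < x) (sym r≡v) <-irrefl)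
          where
          v∈ : v ∈ₗ S.word
          v∈ = subst (v ∈ₗ_) (sym e) (here refl)
          r∈ : r ∈ₗ S.word
          r∈ = subst (r ∈ₗ_) (sym e) (there (∈-insert p))
          v-source : Orientation.Source (O X j) (v , word∈ v∈)
          v-source = source v∈ (λ a@(p , _) → All.lookup (proj₂ (proj₁ (S.heads e))) (⇒members p) a) (word∈ v∈)
          r-source : Orientation.Source (O X j) (r , word∈ r∈)
          r-source = source r∈ (λ a → no-arc a (subst (λ w → Before w _ r) e (A⇒before a))) (word∈ r∈)
            where
            smaller : ∀ {u} → A u r → ¬ u < r
            smaller a lt = proj₁ (A⇒inc a) (proj₁ lt)
            no-arc : ∀ {u} → A u r → ¬ Before (v ∷ p ++ r ∷ q) u r
            no-arc a b = earlier (subst (_ ∈ₗ_) e (before-∈ˡ (A⇒before a)))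
              where
              earlier : ¬ (_ ∈ₗ v ∷ p ++ r ∷ q)
              earlier u∈ with ∈-++⁻ (v ∷ p) u∈
              ... | inj₁ u∈p = smaller a (All.lookup (v<r ∷ below) u∈p)
              ... | inj₂ (here refl) = irrefl (inc P) (A⇒inc a)
              ... | inj₂ (there u∈q) = S.order (subst (λ w → Before w r _) (sym e) (after-split (v ∷ p) u∈q)) a
          r≡v : r ≡ v
          r≡v = let (s , _ , only) = proj₂ (pointed j) in cong proj₁ (trans (only _ r-source) (sym (only _ v-source)))

  toFamily : ∣ PointedSequences ∣ₛ → ∣ RecordFreeFamilies ∣ₛ
  toFamily (X , pt) = ((λ j → ToWords.S.word X pt j) , record
    { lengths = ToWords.word-length X pt
    ; once = λ i → unique⇒atMostOnce (ToWords.S.unique X pt i)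
    ; apart = λ {i} {j} p q → together (ToWords.word∈ X pt i (occurs⇒∈ _ p)) (ToWords.word∈ X pt j (occurs⇒∈ _ q))
    }) , ToWords.recordFree X pt
    where
    together : ∀ {i j v} → v ∈ block X i → v ∈ block X j → i ≡ j
    together {i} {j} p q with i Fin.≟ j
    ... | yes e = e
    ... | no i≢j = ⊥-elim (OrderedSetPartition.disjoint (blocks X) i≢j p q)

  -- The oriented blocks determine the letters of each row and the order of its incomparable
  -- letters, hence the semistrict word. Conversely, the word read off an orientation induces it
  -- again, because `order` forbids reversed arcs.
  recordFree≅pointed : RecordFreeFamilies ≅ PointedSequences
  recordFree≅pointed = injection+section {RecordFreeFamilies} {PointedSequences}
    (λ ((l , arr) , rf) → FromWords.sequence l arr , λ i → FromWords.acyclic l arr rf i , FromWords.oneSource l arr rf i)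
    toFamily
    (λ e → (λ j v → cong (λ w → does (v ∈? w)) (e j)) , λ j u v _ _ _ _ → cong (λ w → does (Arc? w u v)) (e j))
    (λ {((l , arr) , rf)} {((l′ , arr′) , rf′)} e i → normal-form-unique (l i) (l′ i) (semi (l i) (rf i)) (semi (l′ i) (rf′ i))
        (Arrangement.unique arr i) (Arrangement.unique arr′ i)
        (λ {u} → members-⊆ (proj₁ e i u)) (λ {u} → members-⊆ (sym (proj₁ e i u)))
        (λ {u} {v} → agree l l′ i (λ u → proj₁ e i u) (λ u v → proj₂ e i u v))
        (λ {u} {v} → agree l′ l i (λ u → sym (proj₁ e i u)) (λ u v p q p′ q′ → sym (proj₂ e i u v p′ q′ p q))))
    (λ (X , pt) → (λ j v → T-≡ (ToWords.word∈ X pt j ∘ does⇒ (v ∈? _)) (⇒does (v ∈? _) ∘ ToWords.∈word X pt j)) ,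
      λ j u v p q p′ q′ → T-≡
        (λ t → let (inc , b) = does⇒ (Arc? _ u v) t in ToWords.A⇒arc X pt j p′ q′ (ToWords.before⇒A X pt j inc b))
        (λ t → ⇒does (Arc? _ u v) (Orientation.sound (O X j) t , ToWords.A⇒before X pt j (p′ , q′ , t))))
    where
    semi : ∀ w → RecordFreeWord w → Semi w
    semi (v ∷ a) (p , _) = p
    members-⊆ : ∀ {w w′ u} → does (u ∈? w) ≡ does (u ∈? w′) → u ∈ₗ w → u ∈ₗ w′
    members-⊆ {w} {w′} {u} e u∈ = does⇒ (u ∈? w′) (subst T e (⇒does (u ∈? w) u∈))
    agree : ∀ (l l′ : Family) i → (∀ u → does (u ∈? l i) ≡ does (u ∈? l′ i)) →
      (∀ u v (p : T (does (u ∈? l i))) (q : T (does (v ∈? l i))) (p′ : T (does (u ∈? l′ i))) (q′ : T (does (v ∈? l′ i))) → does (Arc? (l i) u v) ≡ does (Arc? (l′ i) u v)) →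
      Agree (l i) (l′ i)
    agree l l′ i same arcs {u} {v} inc b = proj₂ (does⇒ (Arc? (l′ i) u v) (subst T (arcs u v p q (subst T (same u) p) (subst T (same v) q)) (⇒does (Arc? (l i) u v) (inc , b))))
      where
      p = ⇒does (u ∈? l i) (before-∈ˡ b)
      q = ⇒does (v ∈? l i) (before-∈ʳ b)

theorem3p10 : ∀ {n : ℕ} (P : FinitePoset n) (lam : Partition n) →
    ∃[ N ]
    (ψ lam ⟦ inc P ⟧≔ (+ N / 1)) ×
    HasSize (Tableaux P lam such-that CyclicallyRowSemistrict P lam) N ×
    HasSize (Tableaux P lam such-that λ U → RecordFree P lam U × RowSemistrict P lam U) N ×
    HasSize (CyclicCovers (ngr P) lam) N ×
    HasSize (OrientedSequences (inc P) lam such-that λ X → ∀ j → Orientation.Acyclic (O X j) × Orientation.HasOneSource (O X j)) N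
theorem3p10 P lam =
    N
  , subst (ψ lam ⟦ inc P ⟧≔_) evaluate-ψ (trace-evaluation P (ψ lam) (λ {v} {w} → ψ-class lam {v} {w}))
  , size-Cyclic
  , size-≅ cyclic≅recordFree size-Cyclic
  , size-≅ (≅-sym covers≅cyclic) size-Cyclic
  , size-≅ (≅-trans (≅-trans cyclic≅recordFree recordFree≅families) recordFree≅pointed) size-Cyclic
  where
  open CyclicTableaux P lam
  open RowFamilies P lam using (cyclic≅recordFree; recordFree≅families)
  open Orientations P lam using (recordFree≅pointed)
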